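{- For dimension three, we have $\mathrm{OT}_3(n) = 2^{2^{\Theta(n)}}$.
   Context: A point set (or sequence of points) in $\mathbb{R}^3$ is in general position if no $4$ of its members lie on a common plane and, for each $1 \leq i \leq 3$, no two of its members share the same $i$-th coordinate. Let $P = (p_1,\dots,p_N)$ be a sequence of points in $\mathbb{R}^3$ in general position. For $i_1 < i_2 < i_3 < i_4$, the orientation of the $4$-tuple $(p_{i_1},p_{i_2},p_{i_3},p_{i_4})$ is the sign ($+1$ or $-1$) of the determinant of the unique linear map sending $p_{i_2}-p_{i_1},\, p_{i_3}-p_{i_1},\, p_{i_4}-p_{i_1}$ to the standard basis $e_1,e_2,e_3$; equivalently, it is the sign of the determinant of the $3\times 3$ matrix with columns $p_{i_2}-p_{i_1},\, p_{i_3}-p_{i_1},\, p_{i_4}-p_{i_1}$. A point sequence in $\mathbb{R}^3$ is order-type homogeneous if all of its $4$-tuples (taken with indices in increasing order) have the same orientation. $\mathrm{OT}_3(n)$ is the smallest integer $N$ such that every $N$-element point sequence in $\mathbb{R}^3$ in general position contains an $n$-element subsequence that is order-type homogeneous. Asymptotic notation: $f(n) = O(g(n))$ if $|f(n)| \leq c|g(n)|$ for some fixed constant $c$ and for all $n \geq 1$; $f(n) = \Omega(g(n))$ if $g(n) = O(f(n))$; and $f(n) = \Theta(g(n))$ if both $f(n) = O(g(n))$ and $f(n) = \Omega(g(n))$ hold.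
   Formalization: The lower bound in Θ(n) is claimed only for n ≥ 3, not for all n ≥ 1: since OT₃(1) = 1 and OT₃(2) = 2 = 2^{2^0}, no positive constant works for n = 1, 2. -}

module Defs where

open import Data.Fin.Base as Fin using (Fin)
open import Data.Fin.Patterns using (0F; 1F; 2F; 3F)
open import Data.Nat.Base as ℕ using (ℕ; _⊔_)
import Data.Nat.Properties as ℕₚ
open import Data.Product.Base using (_×_; _,_; ∃-syntax)
open import Data.Rational.Base as ℚ using (ℚ; 0ℚ; 1ℚ; ½; ∣_∣)
import Data.Rational.Properties as ℚₚ
open import Data.Sign.Base using (Sign)
open import Data.Sum.Base using (_⊎_)
open import Function.Base using (_∘_)
open import Level using (0ℓ)
open import Relation.Binary.Definitions using (Monotonic₁)
open import Relation.Nullary.Decidable.Core using (dec⇒maybe)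
open import Relation.Binary.PropositionalEquality using (_≡_; refl; sym; trans; cong; subst)
open import Tactic.RingSolver using (solve-∀)
open import Tactic.RingSolver.Core.AlmostCommutativeRing using (AlmostCommutativeRing; fromCommutativeRing)

IsCauchy : (ℕ → ℚ) → Set
IsCauchy x = ∀ ε → 0ℚ ℚ.< ε →
  ∃[ K ] (∀ m n → K ℕ.≤ m → K ℕ.≤ n → ∣ x m ℚ.- x n ∣ ℚ.< ε)

-- Two sequences represent the same real number when their difference tends to
-- 0; only the order and apartness below, which respect this, are needed.
record ℝ : Set where
  constructor mkℝ
  field
    seq    : ℕ → ℚ
    cauchy : IsCauchy seq
open ℝ public

private
  ℚ-ring : AlmostCommutativeRing 0ℓ 0ℓ
  ℚ-ring = fromCommutativeRing ℚₚ.+-*-commutativeRing (λ q → dec⇒maybe (0ℚ ℚₚ.≟ q))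

  sum-diff : ∀ a b c d → (a ℚ.+ b) ℚ.- (c ℚ.+ d) ≡ (a ℚ.- c) ℚ.+ (b ℚ.- d)
  sum-diff = solve-∀ ℚ-ring

  neg-diff : ∀ a b → ℚ.- (a ℚ.- b) ≡ (ℚ.- a) ℚ.- (ℚ.- b)
  neg-diff = solve-∀ ℚ-ring

  prod-diff : ∀ a b c d → (a ℚ.* b) ℚ.- (c ℚ.* d) ≡ a ℚ.* (b ℚ.- d) ℚ.+ d ℚ.* (a ℚ.- c)
  prod-diff = solve-∀ ℚ-ring

  diff-add : ∀ a b → a ≡ (a ℚ.- b) ℚ.+ b
  diff-add = solve-∀ ℚ-ring

  half-pos : ∀ {ε} → 0ℚ ℚ.< ε → 0ℚ ℚ.< ½ ℚ.* ε
  half-pos {ε} 0<ε = subst (ℚ._< ½ ℚ.* ε) (ℚₚ.*-zeroʳ ½) (ℚₚ.*-monoʳ-<-pos ½ 0<ε)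

  half+half : ∀ ε → ½ ℚ.* ε ℚ.+ ½ ℚ.* ε ≡ ε
  half+half ε = trans (sym (ℚₚ.*-distribʳ-+ ε ½ ½)) (ℚₚ.*-identityˡ ε)

  abstract
    +-cauchy : ∀ {x y} → IsCauchy x → IsCauchy y → IsCauchy (λ n → x n ℚ.+ y n)
    +-cauchy {x} {y} cx cy ε 0<ε
      with cx (½ ℚ.* ε) (half-pos 0<ε) | cy (½ ℚ.* ε) (half-pos 0<ε)
    ... | K , hK | L , hL = K ⊔ L , λ m n p q → begin-strict
        ∣ (x m ℚ.+ y m) ℚ.- (x n ℚ.+ y n) ∣
          ≡⟨ cong ∣_∣ (sum-diff (x m) (y m) (x n) (y n)) ⟩
        ∣ (x m ℚ.- x n) ℚ.+ (y m ℚ.- y n) ∣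
          ≤⟨ ℚₚ.∣p+q∣≤∣p∣+∣q∣ (x m ℚ.- x n) (y m ℚ.- y n) ⟩
        ∣ x m ℚ.- x n ∣ ℚ.+ ∣ y m ℚ.- y n ∣
          <⟨ ℚₚ.+-mono-< (hK m n (ℕₚ.m⊔n≤o⇒m≤o K L p) (ℕₚ.m⊔n≤o⇒m≤o K L q))
                         (hL m n (ℕₚ.m⊔n≤o⇒n≤o K L p) (ℕₚ.m⊔n≤o⇒n≤o K L q)) ⟩
        ½ ℚ.* ε ℚ.+ ½ ℚ.* ε
          ≡⟨ half+half ε ⟩
        ε ∎
      where open ℚₚ.≤-Reasoning

  abstract
    neg-cauchy : ∀ {x} → IsCauchy x → IsCauchy (λ n → ℚ.- x n)
    neg-cauchy {x} cx ε 0<ε with cx ε 0<ε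
    ... | K , hK = K , λ m n p q → subst (ℚ._< ε) (eq m n) (hK m n p q)
      where
      eq : ∀ m n → ∣ x m ℚ.- x n ∣ ≡ ∣ ℚ.- x m ℚ.- (ℚ.- x n) ∣
      eq m n = trans (sym (ℚₚ.∣-p∣≡∣p∣ (x m ℚ.- x n)))
        (cong ∣_∣ (neg-diff (x m) (x n)))

  0<1 : 0ℚ ℚ.< 1ℚ
  0<1 = ℚₚ.positive⁻¹ 1ℚ

  bounded : ∀ {x} → IsCauchy x →
    ∃[ K ] ∃[ B ] 0ℚ ℚ.< B × (∀ m → K ℕ.≤ m → ∣ x m ∣ ℚ.≤ B)
  bounded {x} cx with cx 1ℚ 0<1
  ... | K , hK = K , 1ℚ ℚ.+ ∣ x K ∣
      , ℚₚ.+-mono-<-≤ 0<1 (ℚₚ.0≤∣p∣ (x K))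
      , λ m p → begin
          ∣ x m ∣
            ≡⟨ cong ∣_∣ (diff-add (x m) (x K)) ⟩
          ∣ (x m ℚ.- x K) ℚ.+ x K ∣
            ≤⟨ ℚₚ.∣p+q∣≤∣p∣+∣q∣ (x m ℚ.- x K) (x K) ⟩
          ∣ x m ℚ.- x K ∣ ℚ.+ ∣ x K ∣
            ≤⟨ ℚₚ.+-monoˡ-≤ ∣ x K ∣ (ℚₚ.<⇒≤ (hK m K p ℕₚ.≤-refl)) ⟩
          1ℚ ℚ.+ ∣ x K ∣ ∎
    where open ℚₚ.≤-Reasoning

  divide : ∀ B ε → 0ℚ ℚ.< B → 0ℚ ℚ.< ε → ∃[ δ ] 0ℚ ℚ.< δ × B ℚ.* δ ≡ ε
  divide B ε 0<B 0<ε = (ℚ.1/ B) ℚ.* ε , ℚₚ.positive⁻¹ ((ℚ.1/ B) ℚ.* ε) , eq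
    where
    instance
      B⁺ = ℚ.positive 0<B
      ε⁺ = ℚ.positive 0<ε
      B≢0 = ℚₚ.pos⇒nonZero B
      1/B⁺ = ℚₚ.1/pos⇒pos B
      δ⁺ = ℚₚ.pos*pos⇒pos (ℚ.1/ B) ε
    eq : B ℚ.* ((ℚ.1/ B) ℚ.* ε) ≡ ε
    eq = trans (sym (ℚₚ.*-assoc B (ℚ.1/ B) ε))
      (trans (cong (ℚ._* ε) (ℚₚ.*-inverseʳ B)) (ℚₚ.*-identityˡ ε))

  small : ∀ {B δ ε} a d → 0ℚ ℚ.< B → B ℚ.* δ ≡ ε →
    ∣ a ∣ ℚ.≤ B → ∣ d ∣ ℚ.< δ → ∣ a ℚ.* d ∣ ℚ.< ε
  small {B} {δ} {ε} a d 0<B Bδ≡ε a≤B d<δ = begin-strict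
    ∣ a ℚ.* d ∣        ≡⟨ ℚₚ.∣p*q∣≡∣p∣*∣q∣ a d ⟩
    ∣ a ∣ ℚ.* ∣ d ∣    ≤⟨ ℚₚ.*-monoʳ-≤-nonNeg ∣ d ∣ {{ℚ.nonNegative (ℚₚ.0≤∣p∣ d)}} a≤B ⟩
    B ℚ.* ∣ d ∣        <⟨ ℚₚ.*-monoʳ-<-pos B {{ℚ.positive 0<B}} d<δ ⟩
    B ℚ.* δ            ≡⟨ Bδ≡ε ⟩
    ε ∎
    where open ℚₚ.≤-Reasoning

  prod-bound : ∀ {A B δ η ε} x₁ y₁ x₂ y₂ → 0ℚ ℚ.< A → 0ℚ ℚ.< B →
    A ℚ.* δ ≡ ½ ℚ.* ε → B ℚ.* η ≡ ½ ℚ.* ε → ∣ x₁ ∣ ℚ.≤ A → ∣ y₂ ∣ ℚ.≤ B →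
    ∣ y₁ ℚ.- y₂ ∣ ℚ.< δ → ∣ x₁ ℚ.- x₂ ∣ ℚ.< η → ∣ x₁ ℚ.* y₁ ℚ.- x₂ ℚ.* y₂ ∣ ℚ.< ε
  prod-bound {ε = ε} x₁ y₁ x₂ y₂ 0<A 0<B Aδ Bη x₁≤A y₂≤B dy dx = begin-strict
    ∣ x₁ ℚ.* y₁ ℚ.- x₂ ℚ.* y₂ ∣
      ≡⟨ cong ∣_∣ (prod-diff x₁ y₁ x₂ y₂) ⟩
    ∣ x₁ ℚ.* (y₁ ℚ.- y₂) ℚ.+ y₂ ℚ.* (x₁ ℚ.- x₂) ∣
      ≤⟨ ℚₚ.∣p+q∣≤∣p∣+∣q∣ (x₁ ℚ.* (y₁ ℚ.- y₂)) (y₂ ℚ.* (x₁ ℚ.- x₂)) ⟩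
    ∣ x₁ ℚ.* (y₁ ℚ.- y₂) ∣ ℚ.+ ∣ y₂ ℚ.* (x₁ ℚ.- x₂) ∣
      <⟨ ℚₚ.+-mono-< (small x₁ (y₁ ℚ.- y₂) 0<A Aδ x₁≤A dy)
                     (small y₂ (x₁ ℚ.- x₂) 0<B Bη y₂≤B dx) ⟩
    ½ ℚ.* ε ℚ.+ ½ ℚ.* ε
      ≡⟨ half+half ε ⟩
    ε ∎
    where open ℚₚ.≤-Reasoning

  ⊔-above : ∀ I J K L m → (I ⊔ J) ⊔ (K ⊔ L) ℕ.≤ m → I ℕ.≤ m × J ℕ.≤ m × K ℕ.≤ m × L ℕ.≤ m
  ⊔-above I J K L m p =
    let IJ = ℕₚ.m⊔n≤o⇒m≤o (I ⊔ J) (K ⊔ L) p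
        KL = ℕₚ.m⊔n≤o⇒n≤o (I ⊔ J) (K ⊔ L) p
    in ℕₚ.m⊔n≤o⇒m≤o I J IJ , ℕₚ.m⊔n≤o⇒n≤o I J IJ , ℕₚ.m⊔n≤o⇒m≤o K L KL , ℕₚ.m⊔n≤o⇒n≤o K L KL

  abstract
    *-cauchy : ∀ {x y} → IsCauchy x → IsCauchy y → IsCauchy (λ n → x n ℚ.* y n)
    *-cauchy {x} {y} cx cy ε 0<ε =
      let I , A , 0<A , hA = bounded cx
          J , B , 0<B , hB = bounded cy
          δ , 0<δ , Aδ = divide A (½ ℚ.* ε) 0<A (half-pos 0<ε)
          η , 0<η , Bη = divide B (½ ℚ.* ε) 0<B (half-pos 0<ε)
          K , hK = cy δ 0<δ
          L , hL = cx η 0<η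
          above = ⊔-above I J K L
      in (I ⊔ J) ⊔ (K ⊔ L) , λ m n p q →
        let m≥I , _ , m≥K , m≥L = above m p
            _ , n≥J , n≥K , n≥L = above n q
        in prod-bound (x m) (y m) (x n) (y n) 0<A 0<B Aδ Bη (hA m m≥I) (hB n n≥J)
             (hK m n m≥K n≥K) (hL m n m≥L n≥L)

  abstract
    const-cauchy : ∀ q → IsCauchy (λ _ → q)
    const-cauchy q ε 0<ε = 0 , λ _ _ _ _ →
      subst (ℚ._< ε) (sym (cong ∣_∣ (ℚₚ.+-inverseʳ q))) 0<ε

infixl 6 _+_ _-_
infixl 7 _*_
infix  8 -_
infix  4 _<_ _#_

fromℚ : ℚ → ℝ
fromℚ q = mkℝ (λ _ → q) (const-cauchy q)

0ℝ : ℝ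
0ℝ = fromℚ 0ℚ

_+_ : ℝ → ℝ → ℝ
x + y = mkℝ (λ n → seq x n ℚ.+ seq y n) (+-cauchy {seq x} {seq y} (cauchy x) (cauchy y))

-_ : ℝ → ℝ
- x = mkℝ (λ n → ℚ.- seq x n) (neg-cauchy {seq x} (cauchy x))

_-_ : ℝ → ℝ → ℝ
x - y = x + (- y)

_*_ : ℝ → ℝ → ℝ
x * y = mkℝ (λ n → seq x n ℚ.* seq y n) (*-cauchy {seq x} {seq y} (cauchy x) (cauchy y))

_<_ : ℝ → ℝ → Set
x < y = ∃[ ε ] 0ℚ ℚ.< ε × ∃[ K ] (∀ n → K ℕ.≤ n → seq x n ℚ.+ ε ℚ.≤ seq y n)

-- Classically x # y is the negation of "x and y are the same real number".
_#_ : ℝ → ℝ → Set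
x # y = x < y ⊎ y < x

Point : Set
Point = Fin 3 → ℝ

PointSeq : ℕ → Set
PointSeq N = Fin N → Point

Increasing : ∀ {m n} → (Fin m → Fin n) → Set
Increasing σ = Monotonic₁ Fin._<_ Fin._<_ σ

infixl 6 _⊖_
_⊖_ : Point → Point → Point
(p ⊖ q) i = p i - q i

dot : Point → Point → ℝ
dot a p = a 0F * p 0F + a 1F * p 1F + a 2F * p 2F

-- No plane { x : a · x = b } with a ≠ 0 contains all four points: every plane
-- misses one of them.
NotCoplanar : PointSeq 4 → Set
NotCoplanar q = ∀ (a : Point) (b : ℝ) → (∃[ i ] a i # 0ℝ) → ∃[ j ] dot a (q j) # b

record GeneralPosition {N : ℕ} (p : PointSeq N) : Set where
  field
    notCoplanar    : ∀ (σ : Fin 4 → Fin N) → Increasing σ → NotCoplanar (p ∘ σ)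
    distinctCoords : ∀ {i j} → i Fin.< j → ∀ (k : Fin 3) → p i k # p j k

-- determinant of the 3×3 matrix with columns u, v, w
det : Point → Point → Point → ℝ
det u v w =
    u 0F * (v 1F * w 2F - w 1F * v 2F)
  - v 0F * (u 1F * w 2F - w 1F * u 2F)
  + w 0F * (u 1F * v 2F - v 1F * u 2F)

HasSign : Sign → ℝ → Set
HasSign Sign.+ x = 0ℝ < x
HasSign Sign.- x = x < 0ℝ

HasOrientation : Sign → PointSeq 4 → Set
HasOrientation s q = HasSign s (det (q 1F ⊖ q 0F) (q 2F ⊖ q 0F) (q 3F ⊖ q 0F))

Homogeneous : ∀ {n} → PointSeq n → Set
Homogeneous {n} p = ∃[ s ] (∀ (τ : Fin 4 → Fin n) → Increasing τ → HasOrientation s (p ∘ τ))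

ForcesHomogeneous : ℕ → ℕ → Set
ForcesHomogeneous n N = ∀ (p : PointSeq N) → GeneralPosition p →
  ∃[ σ ] Increasing {n} {N} σ × Homogeneous (p ∘ σ)

-- OT₃(n) = N.  A relation rather than a function, as computing the minimum
-- would need a decision procedure for ForcesHomogeneous.
IsOT₃ : ℕ → ℕ → Set
IsOT₃ n N = ForcesHomogeneous n N × (∀ M → ForcesHomogeneous n M → N ℕ.≤ M)

-- The real inequality 2 ^ (2 ^ (n / k)) ≤ N, for k ≥ 1 and N ≥ 1.  As
-- 2 ^ (n / k) is usually irrational, 2 ^ x is taken to be the supremum of the
-- 2 ^ (a / b) over the rationals 0 ≤ a / b ≤ x; both a / b ≤ 2 ^ (n / k) and
-- 2 ^ (a / b) ≤ N are then cleared of roots and denominators.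
2^2^[_/_]≤_ : ℕ → ℕ → ℕ → Set
2^2^[ n / k ]≤ N = ∀ a b → 0 ℕ.< b →
  a ℕ.^ k ℕ.≤ 2 ℕ.^ n ℕ.* b ℕ.^ k → 2 ℕ.^ a ℕ.≤ N ℕ.^ b

{-# OPTIONS --safe #-}

-- Upper bound. At a late enough stage of the Cauchy sequences all orientations
-- agree with those of rational points. An Erdős–Rado thinning, at the price of one
-- exponential, makes the orientation of a quadruple depend on its first three
-- entries only; the last point q of the thinned sequence then turns it into the
-- planar order type of the projection from q. In this plane Erdős–Szekeres
-- arguments (first a monotone sequence, then a cup or a cap) cost a second
-- exponential. They only use the Grassmann–Plücker relations, so instead of sorting
-- by a coordinate one sorts around the first point of the sequence.
--
-- Lower bound. Let δ(a, b) be the level of the first difference of two binary words.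
-- The planar points Σⱼ aⱼ Bʲ⁺¹ (1, j), with a of length r, satisfy: a < b < c is
-- positively oriented iff δ(a, b) < δ(b, c). Let v_i = (1, x_i, y_i) come from the i-th
-- of these 2^r points, and take the 2^2^r space points Σᵢ aᵢ Bⁱ⁺¹ v_i + (m, m², m³),
-- m being the index of a. The last summand only provides general position. When
-- the δ's of consecutive points of a quadruple are distinct, its orientation is the
-- sign of det(v_δ₁, v_δ₂, v_δ₃). Split a homogeneous sequence at its maximal δ:
-- in either half the consecutive δ's cannot have a local maximum, so they first
-- decrease and then increase. Both monotone parts give homogeneous sequences in the
-- plane, and there the δ's are again monotone, hence O(r) in number.

module Submission where

open import Defs using (ℝ; seq; cauchy; fromℚ; 0ℝ; _#_; Point; PointSeq; Increasing; _⊖_; dot;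
  NotCoplanar; GeneralPosition; det; HasSign; HasOrientation; ForcesHomogeneous;
  IsOT₃; 2^2^[_/_]≤_)
import Defs as D
open import Data.Empty using (⊥; ⊥-elim)
open import Data.Fin.Base as Fin using (Fin; toℕ)
open import Data.Fin.Patterns using (0F; 1F; 2F; 3F)
import Data.Fin.Properties as Finₚ
open import Data.Integer.Base as ℤ using (ℤ; 0ℤ; 1ℤ)
import Data.Integer.Properties as ℤₚ
open import Data.List.Base using (List; []; _∷_; length; filter; map; _++_; lookup; cartesianProduct; allFin; tabulate)
import Data.List.Properties as Listₚ
open import Data.List.Membership.Propositional using (_∈_; find; lose)
open import Data.List.Membership.Propositional.Properties using (∈-lookup; ∈-cartesianProduct⁺; ∈-map⁺; ∈-++⁺ˡ; ∈-tabulate⁻; ∈-++⁺ʳ)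
open import Data.List.Relation.Binary.Sublist.Propositional using (_⊆_; []; _∷_; _∷ʳ_; ⊆-refl; ⊆-trans)
import Data.List.Relation.Binary.Sublist.Propositional as Sublist
open import Data.List.Relation.Binary.Sublist.Propositional.Properties using (filter-⊆; All-resp-⊆)
open import Data.List.Relation.Unary.All as All using (All; []; _∷_)
import Data.List.Relation.Unary.All.Properties as Allₚ
open import Data.List.Relation.Unary.AllPairs as AllPairs using (AllPairs; []; _∷_)
import Data.List.Relation.Unary.AllPairs.Properties as AllPairsₚ
open import Data.List.Relation.Unary.Any as Any using (Any; here; there)
open import Data.Nat.Base using (ℕ; zero; suc; _+_; _*_; _^_; _∸_; _≤_; _<_; _⊔_; z≤n; s≤s)
import Data.Nat.Coprimality as Coprime
import Data.Nat.Properties as ℕₚ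
open import Data.Nat.DivMod using (_/_; _%_; m≡m%n+[m/n]*n; m%n<n)
open import Data.Nat.Induction using (<-rec)
open import Data.Nat.Solver using (module +-*-Solver)
open import Data.Product.Base using (_×_; _,_; proj₁; proj₂; ∃; ∃-syntax; ∃₂)
open import Data.Rational.Base as ℚ using (ℚ; 0ℚ; 1ℚ; ½)
import Data.Rational.Properties as ℚₚ
import Data.Rational.Unnormalised.Base as ℚᵘ
import Data.Rational.Unnormalised.Properties as ℚᵘₚ
open import Data.Sign.Base as Sign using (Sign)
import Data.Sign.Properties as Signₚ
open import Data.Sum.Base using (_⊎_; inj₁; inj₂; [_,_]′)
import Data.Sum.Base as Sum
open import Data.Unit.Base using (⊤; tt)
open import Data.Bool.Base using (Bool; true; false)
open import Data.Vec.Base using (Vec; []; _∷_)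
open import Function.Base using (_∘_; flip; id; case_of_)
open import Level using (0ℓ)
open import Relation.Binary.Core using (Rel)
open import Relation.Binary.Definitions using (Decidable; Transitive; Asymmetric; tri<; tri≈; tri>)
open import Relation.Binary.PropositionalEquality using (_≡_; _≢_; refl; sym; trans; cong; cong₂; subst; subst₂)
open import Relation.Nullary using (¬_; Dec; yes; no; contradiction)
open import Relation.Nullary.Decidable using (_×-dec_)
open import Relation.Nullary.Decidable.Core using (dec⇒maybe)
import Relation.Unary as U
open import Relation.Unary.Properties using (∁?)
import Tactic.RingSolver.NonReflective as RingSolver
open import Tactic.RingSolver.Core.AlmostCommutativeRing using (AlmostCommutativeRing; fromCommutativeRing)

-- Ramsey theory of linearly ordered colourings

-- The sign of a real number is not decidable, whereas every Ramsey step filters a list by a sign;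
-- this forces the passage to a single rational stage. In the thinning each new vertex costs one
-- halving per pair of earlier vertices, so t vertices cost about t³ halvings. The planar arguments
-- ask for t = 2^O(n), whence the double exponential.
--
-- In the lower bound the two bases are chosen one after the other: the v_i must be fixed integers
-- before the base in space can dominate them. No base is explicit, as each of finitely many
-- conditions holds for all large bases. The orientation of four points is a determinant of
-- consecutive differences, and each difference is dominated by B^(δ+1) v_δ. If two of the δ's
-- coincide, the leading determinant vanishes and says nothing about the sign; general position
-- therefore needs its own device: modulo B the digit sums vanish and a moment curve remains. Local
-- maxima of δ are excluded in one half with the help of the other: a word from there adds the
-- maximal δ as a further column to the triples of columns of this half.

AllPairs-resp-⊆ : ∀ {A : Set} {R : Rel A 0ℓ} {xs ys} → xs ⊆ ys → AllPairs R ys → AllPairs R xs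
AllPairs-resp-⊆ []         []        = []
AllPairs-resp-⊆ (_ ∷ʳ p)   (_ ∷ rs)  = AllPairs-resp-⊆ p rs
AllPairs-resp-⊆ (refl ∷ p) (r ∷ rs)  = All-resp-⊆ p r ∷ AllPairs-resp-⊆ p rs

length-filter-∁ : ∀ {A : Set} {P : U.Pred A 0ℓ} (P? : U.Decidable P) xs →
  length (filter P? xs) + length (filter (∁? P?) xs) ≡ length xs
length-filter-∁ P? [] = refl
length-filter-∁ P? (x ∷ xs) with P? x
... | yes _ = cong suc (length-filter-∁ P? xs)
... | no  _ = trans (ℕₚ.+-suc _ _) (cong suc (length-filter-∁ P? xs))

splitting : ∀ {A : Set} {P : U.Pred A 0ℓ} (P? : U.Decidable P) m n xs → m + n ≤ length xs →
  (∃[ ys ] ys ⊆ xs × All P ys × n ≤ length ys) ⊎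
  (∃[ ys ] ys ⊆ xs × All (U.∁ P) ys × m ≤ length ys)
splitting P? m n xs m+n≤ with n ℕₚ.≤? length (filter P? xs)
... | yes n≤ = inj₁ (filter P? xs , filter-⊆ P? xs , Allₚ.all-filter P? xs , n≤)
... | no  n≰ = inj₂ (filter (∁? P?) xs , filter-⊆ (∁? P?) xs , Allₚ.all-filter (∁? P?) xs ,
  ℕₚ.+-cancelʳ-≤ n m _ (begin
    m + n                                                  ≤⟨ m+n≤ ⟩
    length xs                                              ≡⟨ length-filter-∁ P? xs ⟨
    length (filter P? xs) + length (filter (∁? P?) xs)   ≡⟨ ℕₚ.+-comm (length (filter P? xs)) _ ⟩
    length (filter (∁? P?) xs) + length (filter P? xs)   ≤⟨ ℕₚ.+-monoʳ-≤ _ (ℕₚ.<⇒≤ (ℕₚ.≰⇒> n≰)) ⟩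
    length (filter (∁? P?) xs) + n                       ∎))
  where open ℕₚ.≤-Reasoning

2^suc : ∀ h → 2 ^ suc h ≡ 2 ^ h + 2 ^ h
2^suc h = cong (2 ^ h +_) (ℕₚ.+-identityʳ (2 ^ h))

≢+⇒≡- : ∀ {s} → s ≢ Sign.+ → s ≡ Sign.-
≢+⇒≡- {Sign.+} s≢+ = contradiction refl s≢+
≢+⇒≡- {Sign.-} _   = refl

majority : ∀ {A : Set} (c : A → Sign) m xs → m + m ≤ length xs →
  ∃[ ys ] ys ⊆ xs × m ≤ length ys × ∃[ s ] All (λ x → c x ≡ s) ys
majority c m xs m+m≤ with splitting (λ x → c x Signₚ.≟ Sign.+) m m xs m+m≤
... | inj₁ (ys , ys⊆ , all , m≤) = ys , ys⊆ , m≤ , Sign.+ , all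
... | inj₂ (ys , ys⊆ , all , m≤) = ys , ys⊆ , m≤ , Sign.- , All.map ≢+⇒≡- all

ConstantOn : ∀ {A : Set} → List A → (A → Sign) → Set
ConstantOn xs c = ∀ {x y} → x ∈ xs → y ∈ xs → c x ≡ c y

majorities : ∀ {A : Set} (cs : List (A → Sign)) h xs → 2 ^ (length cs + h) ≤ length xs →
  ∃[ ys ] ys ⊆ xs × 2 ^ h ≤ length ys × All (ConstantOn ys) cs
majorities []       h xs h≤ = xs , ⊆-refl , h≤ , []
majorities (c ∷ cs) h xs h≤
  with ys , ys⊆ , m≤ , s , const ← majority c (2 ^ (length cs + h)) xs
         (subst (_≤ length xs) (2^suc (length cs + h)) h≤)
  with zs , zs⊆ , h≤zs , consts ← majorities cs h ys m≤
  = zs , ⊆-trans zs⊆ ys⊆ , h≤zs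
  , (λ x∈ y∈ → trans (All.lookup const (Sublist.lookup zs⊆ x∈))
                     (sym (All.lookup const (Sublist.lookup zs⊆ y∈))))
  ∷ consts

length-cartesianProduct : ∀ {A B : Set} (xs : List A) (ys : List B) →
  length (cartesianProduct xs ys) ≡ length xs * length ys
length-cartesianProduct []       ys = refl
length-cartesianProduct (x ∷ xs) ys = trans (Listₚ.length-++ (map (x ,_) ys))
  (cong₂ _+_ (Listₚ.length-map (x ,_) ys) (length-cartesianProduct xs ys))

module _ {A : Set} {_≺_ : Rel A 0ℓ} (≺-asym : Asymmetric _≺_) (χ : A → A → A → A → Sign) where

  -- Only the first two entries may come from xs, the vertices chosen before ys.
  EndHomogeneous : List A → List A → Set
  EndHomogeneous xs ys = ∀ {a b c d e} → a ∈ xs ⊎ a ∈ ys → b ∈ xs ⊎ b ∈ ys →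
    c ∈ ys → d ∈ ys → e ∈ ys → a ≺ c → b ≺ c → c ≺ d → c ≺ e → χ a b c d ≡ χ a b c e

  private
    move : ∀ {a x : A} {xs ys} → a ∈ xs ⊎ a ∈ x ∷ ys → a ∈ x ∷ xs ⊎ a ∈ ys
    move (inj₁ a∈)         = inj₁ (there a∈)
    move (inj₂ (here a≡))  = inj₁ (here a≡)
    move (inj₂ (there a∈)) = inj₂ a∈

    after : ∀ {c d x ys} → All (x ≺_) ys → c ∈ x ∷ ys → d ∈ x ∷ ys → c ≺ d → d ∈ ys
    after x≺ys c∈         (there d∈) c≺d = d∈
    after x≺ys (here refl) (here refl) c≺d = ⊥-elim (≺-asym c≺d c≺d)
    after x≺ys (there c∈) (here refl) c≺d = ⊥-elim (≺-asym c≺d (All.lookup x≺ys c∈))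

    before : ∀ {a x xs ys} → All (x ≺_) ys → a ∈ xs ⊎ a ∈ x ∷ ys → a ≺ x → a ∈ xs
    before x≺ys (inj₁ a∈)           a≺x = a∈
    before x≺ys (inj₂ (here refl))  a≺x = ⊥-elim (≺-asym a≺x a≺x)
    before x≺ys (inj₂ (there a∈))   a≺x = ⊥-elim (≺-asym a≺x (All.lookup x≺ys a∈))

    consEndHomogeneous : ∀ {x xs ys} → All (x ≺_) ys →
      (∀ {a b} → a ∈ xs → b ∈ xs → ConstantOn ys (χ a b x)) →
      EndHomogeneous (x ∷ xs) ys → EndHomogeneous xs (x ∷ ys)
    consEndHomogeneous x≺ys const hom a∈ b∈ (here refl) d∈ e∈ a≺c b≺c c≺d c≺e =
      const (before x≺ys a∈ a≺c) (before x≺ys b∈ b≺c)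
        (after x≺ys (here refl) d∈ c≺d) (after x≺ys (here refl) e∈ c≺e)
    consEndHomogeneous x≺ys const hom a∈ b∈ (there c∈) d∈ e∈ a≺c b≺c c≺d c≺e =
      hom (move a∈) (move b∈) c∈
        (after x≺ys (there c∈) d∈ c≺d) (after x≺ys (there c∈) e∈ c≺e) a≺c b≺c c≺d c≺e

  private
    colourings : A → List A → List (A → Sign)
    colourings x xs = map (λ (a , b) → χ a b x) (cartesianProduct xs xs)

    length-colourings : ∀ x xs → length (colourings x xs) ≡ length xs * length xs
    length-colourings x xs = trans (Listₚ.length-map _ (cartesianProduct xs xs))
      (length-cartesianProduct xs xs)

    -- Of the exponent `suc (m * m)` reserved for one vertex, `m * m` pays for the colourings and
    -- the remaining 1 for the loss of the vertex itself: 2 ^ suc k ≤ suc n implies 2 ^ k ≤ n.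
    afterRemoval : ∀ m t x xs (ys : List A) → length xs ≤ m → 2 ^ (suc t * suc (m * m)) ≤ suc (length ys) →
      2 ^ (length (colourings x xs) + t * suc (m * m)) ≤ length ys
    afterRemoval m t x xs ys xs≤m big = ℕₚ.≤-pred (begin
      suc (2 ^ (length (colourings x xs) + t * suc (m * m)))
        ≤⟨ s≤s (ℕₚ.^-monoʳ-≤ 2 (ℕₚ.+-monoˡ-≤ (t * suc (m * m)) few)) ⟩
      suc (2 ^ (m * m + t * suc (m * m)))
        ≤⟨ ℕₚ.+-monoˡ-≤ _ (ℕₚ.m^n>0 2 (m * m + t * suc (m * m))) ⟩
      2 ^ (m * m + t * suc (m * m)) + 2 ^ (m * m + t * suc (m * m))
        ≡⟨ 2^suc (m * m + t * suc (m * m)) ⟨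
      2 ^ suc (m * m + t * suc (m * m))
        ≤⟨ big ⟩
      suc (length ys) ∎)
      where
      open ℕₚ.≤-Reasoning
      few : length (colourings x xs) ≤ m * m
      few = ℕₚ.≤-trans (ℕₚ.≤-reflexive (length-colourings x xs)) (ℕₚ.*-mono-≤ xs≤m xs≤m)

  -- Vertices are chosen greedily: once the head y is taken, the rest is thinned until `χ a b y` is
  -- constant on it for all earlier vertices a and b. As `m` bounds the final number of vertices,
  -- there are never more than `m * m` such pairs.
  erdős-rado : ∀ m t xs ys → length xs + t ≤ m → AllPairs _≺_ ys →
    2 ^ (t * suc (m * m)) ≤ length ys →
    ∃[ zs ] zs ⊆ ys × length zs ≡ t × EndHomogeneous xs zs
  erdős-rado m zero xs ys _ _ _ = [] , Sublist.minimum ys , refl , λ _ _ ()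
  erdős-rado m (suc t) xs [] _ _ big = ⊥-elim (ℕₚ.n≮0 (ℕₚ.<-≤-trans (ℕₚ.m^n>0 2 (suc t * suc (m * m))) big))
  erdős-rado m (suc t) xs (y ∷ ys) xs+t≤m (y≺ys ∷ ys-sorted) big
    with zs , zs⊆ , big′ , consts ← majorities (colourings y xs) (t * suc (m * m)) ys
      (afterRemoval m t y xs ys (ℕₚ.m+n≤o⇒m≤o _ xs+t≤m) big)
    with us , us⊆ , ∣us∣≡t , hom ← erdős-rado m t (y ∷ xs) zs
          (subst (_≤ m) (ℕₚ.+-suc (length xs) t) xs+t≤m) (AllPairs-resp-⊆ zs⊆ ys-sorted) big′
    = y ∷ us , refl ∷ ⊆-trans us⊆ zs⊆ , cong suc ∣us∣≡t
    , consEndHomogeneous (All-resp-⊆ (⊆-trans us⊆ zs⊆) y≺ys)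
        (λ a∈ b∈ x∈ y∈ → All.lookup consts (∈-map⁺ _ (∈-cartesianProduct⁺ a∈ b∈))
          (Sublist.lookup us⊆ x∈) (Sublist.lookup us⊆ y∈))
        hom

-- Chains, cups and caps in finite lists

module _ {A : Set} where

  AllTriples : (A → A → A → Set) → List A → Set
  AllTriples T []       = ⊤
  AllTriples T (x ∷ xs) = AllPairs (T x) xs × AllTriples T xs

  AllPairs-lookup : ∀ {R : Rel A 0ℓ} {xs i j} → AllPairs R xs → i Fin.< j →
    R (lookup xs i) (lookup xs j)
  AllPairs-lookup {i = 0F}        {j = Fin.suc j} (r ∷ _)  _         = All.lookup r (∈-lookup j)
  AllPairs-lookup {i = Fin.suc i} {j = Fin.suc j} (_ ∷ rs) (s≤s i<j) = AllPairs-lookup rs i<j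

  AllTriples-lookup : ∀ {T xs i j k} → AllTriples T xs → i Fin.< j → j Fin.< k →
    T (lookup xs i) (lookup xs j) (lookup xs k)
  AllTriples-lookup {xs = x ∷ xs} {0F} {Fin.suc j} {Fin.suc k} (t , _) _ (s≤s j<k) =
    AllPairs-lookup t j<k
  AllTriples-lookup {xs = x ∷ xs} {Fin.suc i} {Fin.suc j} {Fin.suc k} (_ , ts) (s≤s i<j) (s≤s j<k) =
    AllTriples-lookup ts i<j j<k

  pair-or-empty : ∀ {P : A → A → Set} (P? : Decidable P) {R : Rel A 0ℓ} {xs} → AllPairs R xs →
    (∃₂ λ x y → x ∈ xs × y ∈ xs × R x y × P x y) ⊎ AllPairs (λ x y → ¬ P x y) xs
  pair-or-empty P? [] = inj₂ []
  pair-or-empty P? {xs = x ∷ xs} (x≺xs ∷ sorted) with Any.any? (P? x) xs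
  ... | yes any = let y , y∈ , p = find any in
    inj₁ (x , y , here refl , there y∈ , All.lookup x≺xs y∈ , p)
  ... | no ¬any with pair-or-empty P? sorted
  ...   | inj₁ (y , z , y∈ , z∈ , r , p) = inj₁ (y , z , there y∈ , there z∈ , r , p)
  ...   | inj₂ none = inj₂ (Allₚ.¬Any⇒All¬ xs ¬any ∷ none)

  module Chains (R : Rel A 0ℓ) (R? : Decidable R) (S : List A) where

    Chain : ℕ → A → Set
    Chain zero    x = ⊤
    Chain (suc k) x = Any (λ y → R x y × Chain k y) S

    chain? : ∀ k → U.Decidable (Chain k)
    chain? zero    x = yes tt
    chain? (suc k) x = Any.any? (λ y → R? x y ×-dec chain? k y) S

    -- Collect the elements at which a chain with k steps starts. If there are l of them, either two
    -- are related, which gives a chain with k + 1 steps, or they form the antichain; if there are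
    -- fewer, the induction hypothesis applies to the others.
    chain-or-antichain : ∀ {_≺_ : Rel A 0ℓ} k l xs → xs ⊆ S → AllPairs _≺_ xs → suc (k * l) ≤ length xs →
      (∃[ x ] x ∈ xs × Chain k x) ⊎ (∃[ ys ] ys ⊆ xs × l ≤ length ys × AllPairs (λ x y → ¬ R x y) ys)
    chain-or-antichain zero l (x ∷ xs) _ _ _ = inj₁ (x , here refl , tt)
    chain-or-antichain (suc k) l xs xs⊆S sorted long
      with splitting (chain? k) (suc (k * l)) l xs
             (subst (_≤ length xs) (cong suc (ℕₚ.+-comm l (k * l))) long)
    ... | inj₁ (ys , ys⊆ , chains , l≤) with pair-or-empty R? (AllPairs-resp-⊆ ys⊆ sorted)
    ...   | inj₁ (x , y , x∈ , y∈ , _ , r) = inj₁ (x , Sublist.lookup ys⊆ x∈ ,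
              lose (Sublist.lookup (⊆-trans ys⊆ xs⊆S) y∈) (r , All.lookup chains y∈))
    ...   | inj₂ none = inj₂ (ys , ys⊆ , l≤ , none)
    chain-or-antichain (suc k) l xs xs⊆S sorted long
        | inj₂ (ys , ys⊆ , noChains , kl<)
      with chain-or-antichain k l ys (⊆-trans ys⊆ xs⊆S) (AllPairs-resp-⊆ ys⊆ sorted) kl<
    ...   | inj₁ (x , x∈ , chain) = contradiction chain (All.lookup noChains x∈)
    ...   | inj₂ (zs , zs⊆ , l≤ , none) = inj₂ (zs , ⊆-trans zs⊆ ys⊆ , l≤ , none)

    chain⇒list : (∀ {x y z} → x ∈ S → y ∈ S → z ∈ S → R x y → R y z → R x z) →
      ∀ k {x} → x ∈ S → Chain k x →
      ∃[ xs ] length xs ≡ k × All (_∈ S) (x ∷ xs) × AllPairs R (x ∷ xs)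
    chain⇒list R-trans zero    x∈ _ = [] , refl , x∈ ∷ [] , [] ∷ []
    chain⇒list R-trans (suc k) x∈ chain with find chain
    ... | y , y∈ , r , chain′ with chain⇒list R-trans k y∈ chain′
    ...   | xs , len , y∈ ∷ xs∈ , rs ∷ sorted = y ∷ xs , cong suc len , x∈ ∷ y∈ ∷ xs∈
            , (r ∷ All.zipWith (λ (z∈ , s) → R-trans x∈ y∈ z∈ r s) (xs∈ , rs)) ∷ rs ∷ sorted

  module Paths (R : Rel A 0ℓ) (R? : Decidable R) (T : A → A → A → Set)
    (T? : ∀ x y z → Dec (T x y z)) (S : List A) where

    -- A path on k + 2 vertices, of which x and y are the first two.
    Path : ℕ → A → A → Set
    Path zero    x y = R x y
    Path (suc k) x y = R x y × Any (λ z → T x y z × Path k y z) S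

    path? : ∀ k → Decidable (Path k)
    path? zero    x y = R? x y
    path? (suc k) x y = R? x y ×-dec Any.any? (λ z → T? x y z ×-dec path? k y z) S

    path-first : ∀ k {x y} → Path k x y → R x y
    path-first zero    r       = r
    path-first (suc k) (r , _) = r

    module _ (R-trans : Transitive R)
      (T-trans : ∀ {x y z w} → x ∈ S → y ∈ S → z ∈ S → w ∈ S →
        R x y → R y z → R z w → T x y z → T y z w → T x y w × T x z w) where

      private
        -- Consecutive triples suffice: T x y z and T y z w give T x y w for every later w
        -- (`first`), after which T x y p and T y p q give T x p q (`later`).
        extend : ∀ {x y z xs} → x ∈ S → R x y → T x y z → All (_∈ S) (y ∷ z ∷ xs) →
          AllPairs R (y ∷ z ∷ xs) → AllTriples T (y ∷ z ∷ xs) → AllPairs (T x) (y ∷ z ∷ xs)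
        extend {x} {y} {z} {xs} x∈ r t (y∈ ∷ z∈ ∷ xs∈) ((ryz ∷ rys) ∷ (rzs ∷ rs)) ((tyzs ∷ tys) , ts) =
          (t ∷ first) ∷ later (z∈ ∷ xs∈) (ryz ∷ rys) (t ∷ first) (rzs ∷ rs) (tyzs ∷ tys)
          where
          first : All (T x y) xs
          first = All.zipWith (λ ((w∈ , rzw) , tyzw) →
            proj₁ (T-trans x∈ y∈ z∈ w∈ r ryz rzw t tyzw)) (All.zip (xs∈ , rzs) , tyzs)
          later : ∀ {ys} → All (_∈ S) ys → All (R y) ys → All (T x y) ys → AllPairs R ys →
            AllPairs (T y) ys → AllPairs (T x) ys
          later [] [] [] [] [] = []
          later (p∈ ∷ ps∈) (ryp ∷ ryps) (txyp ∷ txyps) (rps ∷ rs) (typs ∷ tyss) =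
            All.zipWith (λ ((q∈ , rpq) , typq) →
              proj₂ (T-trans x∈ y∈ p∈ q∈ r ryp rpq txyp typq)) (All.zip (ps∈ , rps) , typs)
            ∷ later ps∈ ryps txyps rs tyss

      path⇒list : ∀ k {x y} → x ∈ S → y ∈ S → Path k x y →
        ∃[ xs ] length xs ≡ k × All (_∈ S) (x ∷ y ∷ xs) × AllPairs R (x ∷ y ∷ xs) × AllTriples T (x ∷ y ∷ xs)
      path⇒list zero x∈ y∈ r = [] , refl , x∈ ∷ y∈ ∷ [] , (r ∷ []) ∷ [] ∷ [] , ([] ∷ []) , [] , tt
      path⇒list (suc k) x∈ y∈ (r , any) with find any
      ... | z , z∈ , t , path with path⇒list k y∈ z∈ path
      ...   | xs , len , ∈S , sorted@(rys ∷ _) , triples = z ∷ xs , cong suc len , x∈ ∷ ∈S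
              , (r ∷ All.map (R-trans r) rys) ∷ sorted
              , extend x∈ r t ∈S sorted triples , triples

  module CupsCaps (_≺_ : Rel A 0ℓ) (_≺?_ : Decidable _≺_) (χ : A → A → A → Sign) (S : List A) where

    module Cup = Paths _≺_ _≺?_ (λ x y z → χ x y z ≡ Sign.+) (λ x y z → χ x y z Signₚ.≟ Sign.+) S
    -- Built from right to left: the first vertex of the path is the last one of the cap, at which a
    -- cup may start.
    module Cap = Paths (flip _≺_) (flip _≺?_) (λ x y z → χ z y x ≡ Sign.-) (λ x y z → χ z y x Signₚ.≟ Sign.-) S

    private
      two : ∀ {xs} → AllPairs _≺_ xs → 2 ≤ length xs → ∃₂ λ x y → x ∈ xs × y ∈ xs × x ≺ y
      two {_ ∷ []} _ (s≤s ())
      two {x ∷ y ∷ xs} ((r ∷ _) ∷ _) _ = x , y , here refl , there (here refl) , r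

      2≤2^suc : ∀ n → 2 ≤ 2 ^ suc n
      2≤2^suc n = ℕₚ.m≤m*n 2 (2 ^ n) {{ℕₚ.m^n≢0 2 n}}

    -- The vertices at which a k-cup starts either are few, or contain by
    -- induction a cap, whose last vertex starts a k-cup: then one of the two extends.
    cup-or-cap : ∀ k l xs → xs ⊆ S → AllPairs _≺_ xs → 2 ^ suc (k + l) ≤ length xs →
      (∃₂ λ x y → x ∈ xs × y ∈ xs × Cup.Path k x y) ⊎ (∃₂ λ x y → x ∈ xs × y ∈ xs × Cap.Path l x y)
    cup-or-cap zero l xs xs⊆S sorted long = inj₁ (two sorted (ℕₚ.≤-trans (2≤2^suc l) long))
    cup-or-cap (suc k) zero xs xs⊆S sorted long with two sorted (ℕₚ.≤-trans (2≤2^suc (suc k + 0)) long)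
    ... | x , y , x∈ , y∈ , r = inj₂ (y , x , y∈ , x∈ , r)
    cup-or-cap (suc k) (suc l) xs xs⊆S sorted long
      with splitting (λ x → Any.any? (Cup.path? k x) xs) (2 ^ suc (k + suc l)) (2 ^ suc (suc k + l)) xs
             (subst (_≤ length xs) (trans (2^suc (suc (k + suc l)))
               (cong (λ n → (2 ^ suc (k + suc l)) + 2 ^ suc n) (ℕₚ.+-suc k l))) long)
    ... | inj₂ (ys , ys⊆ , noCups , long′)
        with cup-or-cap k (suc l) ys (⊆-trans ys⊆ xs⊆S) (AllPairs-resp-⊆ ys⊆ sorted) long′
    ...   | inj₁ (x , y , x∈ , y∈ , cup) = contradiction (lose (Sublist.lookup ys⊆ y∈) cup) (All.lookup noCups x∈)
    ...   | inj₂ (x , y , x∈ , y∈ , cap) = inj₂ (x , y , Sublist.lookup ys⊆ x∈ , Sublist.lookup ys⊆ y∈ , cap)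
    cup-or-cap (suc k) (suc l) xs xs⊆S sorted long
        | inj₁ (ys , ys⊆ , cups , long′)
        with cup-or-cap (suc k) l ys (⊆-trans ys⊆ xs⊆S) (AllPairs-resp-⊆ ys⊆ sorted) long′
    ...   | inj₁ (x , y , x∈ , y∈ , cup) = inj₁ (x , y , Sublist.lookup ys⊆ x∈ , Sublist.lookup ys⊆ y∈ , cup)
    ...   | inj₂ (x , v , x∈ , v∈ , cap) with find (All.lookup cups x∈)
    ...     | w , w∈ , cup with χ v x w Signₚ.≟ Sign.+
    ...       | yes ≡+ = inj₁ (v , x , Sublist.lookup ys⊆ v∈ , Sublist.lookup ys⊆ x∈
                , Cap.path-first l cap , lose (Sublist.lookup xs⊆S w∈) (≡+ , cup))
    ...       | no ≢+ = inj₂ (w , x , w∈ , Sublist.lookup ys⊆ x∈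
                , Cup.path-first k cup , lose (Sublist.lookup (⊆-trans ys⊆ xs⊆S) v∈) (≢+⇒≡- ≢+ , cap))

-- Chirotopes of rational points

ℚ-ring : AlmostCommutativeRing 0ℓ 0ℓ
ℚ-ring = fromCommutativeRing ℚₚ.+-*-commutativeRing (λ q → dec⇒maybe (0ℚ ℚₚ.≟ q))

module ℚ-Solver = RingSolver ℚ-ring

detℚ : (u v w : Fin 3 → ℚ) → ℚ
detℚ u v w =
    u 0F ℚ.* (v 1F ℚ.* w 2F ℚ.- w 1F ℚ.* v 2F)
  ℚ.- v 0F ℚ.* (u 1F ℚ.* w 2F ℚ.- w 1F ℚ.* u 2F)
  ℚ.+ w 0F ℚ.* (u 1F ℚ.* v 2F ℚ.- v 1F ℚ.* u 2F)

opaque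
  orient : (a b c d : Fin 3 → ℚ) → ℚ
  orient a b c d = detℚ (λ i → b i ℚ.- a i) (λ i → c i ℚ.- a i) (λ i → d i ℚ.- a i)

module OrientExpr where
  open ℚ-Solver
  Vector : ℕ → Set
  Vector n = Expr ℚ n × Expr ℚ n × Expr ℚ n

  infixl 6 _⊝_
  _⊝_ : ∀ {n} → Expr ℚ n → Expr ℚ n → Expr ℚ n
  x ⊝ y = x ⊕ ⊝ y

  det′ : ∀ {n} (u v w : Vector n) → Expr ℚ n
  det′ (u₀ , u₁ , u₂) (v₀ , v₁ , v₂) (w₀ , w₁ , w₂) =
    u₀ ⊗ (v₁ ⊗ w₂ ⊝ w₁ ⊗ v₂) ⊝ v₀ ⊗ (u₁ ⊗ w₂ ⊝ w₁ ⊗ u₂) ⊕ w₀ ⊗ (u₁ ⊗ v₂ ⊝ v₁ ⊗ u₂)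

  infixl 6 _⊖′_
  _⊖′_ : ∀ {n} → Vector n → Vector n → Vector n
  (u₀ , u₁ , u₂) ⊖′ (v₀ , v₁ , v₂) = u₀ ⊝ v₀ , u₁ ⊝ v₁ , u₂ ⊝ v₂

  orient′ : ∀ {n} (a b c d : Vector n) → Expr ℚ n
  orient′ a b c d = det′ (b ⊖′ a) (c ⊖′ a) (d ⊖′ a)

  cross′ : ∀ {n} → Vector n → Vector n → Vector n
  cross′ (u₀ , u₁ , u₂) (v₀ , v₁ , v₂) =
    u₁ ⊗ v₂ ⊝ u₂ ⊗ v₁ , u₂ ⊗ v₀ ⊝ u₀ ⊗ v₂ , u₀ ⊗ v₁ ⊝ u₁ ⊗ v₀

  dot′ : ∀ {n} → Vector n → Vector n → Expr ℚ n
  dot′ (u₀ , u₁ , u₂) (v₀ , v₁ , v₂) = u₀ ⊗ v₀ ⊕ u₁ ⊗ v₁ ⊕ u₂ ⊗ v₂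

module _ (q u i j k l : Fin 3 → ℚ) where
  open ℚ-Solver
  open OrientExpr

  opaque
    unfolding orient

    -- Three-term relation of the contraction by q and one further point: j here, k and u in the
    -- next two. All three are arranged without subtraction, so that signs can be read off by
    -- `sgn-of-quotient`.
    grassmann-plücker₁ : orient i j l q ℚ.* orient u j k q ≡
      orient i j k q ℚ.* orient u j l q ℚ.+ orient u i j q ℚ.* orient j k l q
    grassmann-plücker₁ = solve 18
      (λ q₀ q₁ q₂ u₀ u₁ u₂ i₀ i₁ i₂ j₀ j₁ j₂ k₀ k₁ k₂ l₀ l₁ l₂ →
        let q = q₀ , q₁ , q₂ ; u = u₀ , u₁ , u₂ ; i = i₀ , i₁ , i₂
            j = j₀ , j₁ , j₂ ; k = k₀ , k₁ , k₂ ; l = l₀ , l₁ , l₂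
        in (orient′ i j l q ⊗ orient′ u j k q) ⊜
           (orient′ i j k q ⊗ orient′ u j l q ⊕ orient′ u i j q ⊗ orient′ j k l q))
      refl (q 0F) (q 1F) (q 2F) (u 0F) (u 1F) (u 2F) (i 0F) (i 1F) (i 2F)
           (j 0F) (j 1F) (j 2F) (k 0F) (k 1F) (k 2F) (l 0F) (l 1F) (l 2F)

    grassmann-plücker₂ : orient i k l q ℚ.* orient u j k q ≡
      orient j k l q ℚ.* orient u i k q ℚ.+ orient u k l q ℚ.* orient i j k q
    grassmann-plücker₂ = solve 18
      (λ q₀ q₁ q₂ u₀ u₁ u₂ i₀ i₁ i₂ j₀ j₁ j₂ k₀ k₁ k₂ l₀ l₁ l₂ →
        let q = q₀ , q₁ , q₂ ; u = u₀ , u₁ , u₂ ; i = i₀ , i₁ , i₂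
            j = j₀ , j₁ , j₂ ; k = k₀ , k₁ , k₂ ; l = l₀ , l₁ , l₂
        in (orient′ i k l q ⊗ orient′ u j k q) ⊜
           (orient′ j k l q ⊗ orient′ u i k q ⊕ orient′ u k l q ⊗ orient′ i j k q))
      refl (q 0F) (q 1F) (q 2F) (u 0F) (u 1F) (u 2F) (i 0F) (i 1F) (i 2F)
           (j 0F) (j 1F) (j 2F) (k 0F) (k 1F) (k 2F) (l 0F) (l 1F) (l 2F)

    grassmann-plücker₃ : orient u i k q ℚ.* orient u l j q ≡
      orient u i j q ℚ.* orient u l k q ℚ.+ orient u l i q ℚ.* orient u j k q
    grassmann-plücker₃ = solve 18
      (λ q₀ q₁ q₂ u₀ u₁ u₂ i₀ i₁ i₂ j₀ j₁ j₂ k₀ k₁ k₂ l₀ l₁ l₂ →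
        let q = q₀ , q₁ , q₂ ; u = u₀ , u₁ , u₂ ; i = i₀ , i₁ , i₂
            j = j₀ , j₁ , j₂ ; k = k₀ , k₁ , k₂ ; l = l₀ , l₁ , l₂
        in (orient′ u i k q ⊗ orient′ u l j q) ⊜
           (orient′ u i j q ⊗ orient′ u l k q ⊕ orient′ u l i q ⊗ orient′ u j k q))
      refl (q 0F) (q 1F) (q 2F) (u 0F) (u 1F) (u 2F) (i 0F) (i 1F) (i 2F)
           (j 0F) (j 1F) (j 2F) (k 0F) (k 1F) (k 2F) (l 0F) (l 1F) (l 2F)

HasSignℚ : Sign → ℚ → Set
HasSignℚ Sign.+ x = 0ℚ ℚ.< x
HasSignℚ Sign.- x = x ℚ.< 0ℚ

sign-unique : ∀ {s t x} → HasSignℚ s x → HasSignℚ t x → s ≡ t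
sign-unique {Sign.+} {Sign.+} _ _ = refl
sign-unique {Sign.-} {Sign.-} _ _ = refl
sign-unique {Sign.+} {Sign.-} p q = ⊥-elim (ℚₚ.<-asym p q)
sign-unique {Sign.-} {Sign.+} p q = ⊥-elim (ℚₚ.<-asym p q)

sign-* : ∀ {s t x y} → HasSignℚ s x → HasSignℚ t y → HasSignℚ (s Sign.* t) (x ℚ.* y)
sign-* {Sign.+} {Sign.+} {x} {y} p q =
  ℚₚ.positive⁻¹ _ {{ℚₚ.pos*pos⇒pos x {{ℚ.positive p}} y {{ℚ.positive q}}}}
sign-* {Sign.+} {Sign.-} {x} {y} p q =
  ℚₚ.negative⁻¹ _ {{ℚₚ.pos*neg⇒neg x {{ℚ.positive p}} y {{ℚ.negative q}}}}
sign-* {Sign.-} {Sign.+} {x} {y} p q =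
  ℚₚ.negative⁻¹ _ {{ℚₚ.neg*pos⇒neg x {{ℚ.negative p}} y {{ℚ.positive q}}}}
sign-* {Sign.-} {Sign.-} {x} {y} p q =
  ℚₚ.positive⁻¹ _ {{ℚₚ.neg*neg⇒pos x {{ℚ.negative p}} y {{ℚ.negative q}}}}

sign-+ : ∀ {s x y} → HasSignℚ s x → HasSignℚ s y → HasSignℚ s (x ℚ.+ y)
sign-+ {Sign.+} = ℚₚ.+-mono-<
sign-+ {Sign.-} = ℚₚ.+-mono-<

-- Junk value: sgn 0ℚ is Sign.- .
sgn : ℚ → Sign
sgn x with 0ℚ ℚₚ.<? x
... | yes _ = Sign.+
... | no  _ = Sign.-

sgn-correct : ∀ {s x} → HasSignℚ s x → HasSignℚ (sgn x) x
sgn-correct {s} {x} h with 0ℚ ℚₚ.<? x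
sgn-correct          h | yes 0<x = 0<x
sgn-correct {Sign.+} h | no  0≮x = contradiction h 0≮x
sgn-correct {Sign.-} h | no  0≮x = h

-- The hypothesis has the shape of a Grassmann-Plücker relation whose auxiliary factors share the
-- sign `t`. The right side then has the sign of s times t, and cancelling t leaves s for x.
sgn-of-quotient : ∀ {t s x w y w′ w″ z} → x ℚ.* w ≡ y ℚ.* w′ ℚ.+ w″ ℚ.* z →
  HasSignℚ t w → HasSignℚ t w′ → HasSignℚ t w″ → HasSignℚ s y → HasSignℚ s z →
  HasSignℚ (sgn x) x → sgn x ≡ s
sgn-of-quotient {t} {s} {x} {w} {y} {w′} {w″} {z} eq hw hw′ hw″ hy hz hx =
  Signₚ.*-cancelʳ-≡ t (sgn x) s (sign-unique {x = x ℚ.* w} (sign-* {x = x} hx hw)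
    (subst (HasSignℚ (s Sign.* t)) (sym eq)
      (sign-+ {s Sign.* t} (sign-* {x = y} hy hw′)
        (subst (λ r → HasSignℚ r (w″ ℚ.* z)) (Signₚ.*-comm t s) (sign-* {x = w″} hw″ hz)))))

maximum : ∀ {A : Set} {R : Rel A 0ℓ} {x xs} → AllPairs R (x ∷ xs) →
  ∃₂ λ q ys → q ∈ x ∷ xs × ys ⊆ x ∷ xs × length ys ≡ length xs × All (λ y → R y q) ys
maximum {x = x} {[]} _ = x , [] , here refl , x ∷ʳ [] , refl , []
maximum {x = x} {_ ∷ _} (rx ∷ sorted) =
  let q , ys , q∈ , ys⊆ , len , below = maximum sorted in
  q , x ∷ ys , there q∈ , refl ∷ ys⊆ , cong suc len , All.lookup rx q∈ ∷ below

AllPairs-∈ : ∀ {A : Set} {R P : Rel A 0ℓ} {x y xs} → Asymmetric R → AllPairs R xs → AllPairs P xs →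
  x ∈ xs → y ∈ xs → R x y → P x y
AllPairs-∈ asym (_ ∷ _)  (_ ∷ _)  (here refl) (here refl) r = ⊥-elim (asym r r)
AllPairs-∈ asym (_ ∷ _)  (p ∷ _)  (here refl) (there y∈)  r = All.lookup p y∈
AllPairs-∈ asym (rs ∷ _) (_ ∷ _)  (there x∈)  (here refl) r = ⊥-elim (asym r (All.lookup rs x∈))
AllPairs-∈ asym (_ ∷ rs) (_ ∷ ps) (there x∈)  (there y∈)  r = AllPairs-∈ asym rs ps x∈ y∈ r

opposite-anti-< : ∀ {n} {i j : Fin n} → i Fin.< j → Fin.opposite j Fin.< Fin.opposite i
opposite-anti-< {n} {i} {j} i<j = subst₂ _<_ (sym (Finₚ.opposite-prop j)) (sym (Finₚ.opposite-prop i))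
  (ℕₚ.∸-monoʳ-< (s≤s i<j) (Finₚ.toℕ<n j))

module RationalPoints {N : ℕ} (p : Fin N → Fin 3 → ℚ) where

  χ : (i j k l : Fin N) → Sign
  χ i j k l = sgn (orient (p i) (p j) (p k) (p l))

  module _ (nondegenerate : ∀ {i j k l} → i Fin.< j → j Fin.< k → k Fin.< l →
              HasSignℚ (χ i j k l) (orient (p i) (p j) (p k) (p l))) where

    private
      hasSign : ∀ {s i j k l} → i Fin.< j → j Fin.< k → k Fin.< l → χ i j k l ≡ s →
        HasSignℚ s (orient (p i) (p j) (p k) (p l))
      hasSign {i = i} {j} {k} {l} i<j j<k k<l eq =
        subst (λ s → HasSignℚ s (orient (p i) (p j) (p k) (p l))) eq (nondegenerate i<j j<k k<l)

    -- The contraction of the chirotope by u and q, on the side of the plane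
    -- through u, v, q where v sees all points with the same sign, is a linear order.
    χ-trans₂ : ∀ {s τ q u v i j k} → u Fin.< v → v Fin.< i → i Fin.< j → j Fin.< k → k Fin.< q →
      χ u v i q ≡ τ → χ u v j q ≡ τ → χ u v k q ≡ τ →
      χ u i j q ≡ s → χ u j k q ≡ s → χ u i k q ≡ s
    χ-trans₂ {s} {τ} {q} {u} {v} {i} {j} {k} u<v v<i i<j j<k k<q vi vj vk ij jk =
      sgn-of-quotient {τ} {s} {y = orient (p u) (p i) (p j) (p q)} {w″ = orient (p u) (p v) (p i) (p q)}
        (grassmann-plücker₃ (p q) (p u) (p i) (p j) (p k) (p v))
        (hasSign u<v v<j j<q vj) (hasSign u<v v<k k<q vk) (hasSign u<v v<i i<q vi)
        (hasSign u<i i<j j<q ij) (hasSign u<j j<k k<q jk) (nondegenerate u<i (ℕₚ.<-trans i<j j<k) k<q)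
      where
      j<q = ℕₚ.<-trans j<k k<q
      i<q = ℕₚ.<-trans i<j j<q
      v<j = ℕₚ.<-trans v<i i<j
      v<k = ℕₚ.<-trans v<j j<k
      u<i = ℕₚ.<-trans u<v v<i
      u<j = ℕₚ.<-trans u<v v<j

    -- `W` says that in the projection from q the points turn around u in one direction. This
    -- replaces the order by first coordinate, with u as the point at infinity, and gives the
    -- auxiliary factors of the relations contracted by j and by k the common sign ω.
    χ-trans₃ : ∀ {s ω q u i j k l} → u Fin.< i → i Fin.< j → j Fin.< k → k Fin.< l → l Fin.< q →
      (∀ {a b} → a ∈ i ∷ j ∷ k ∷ l ∷ [] → b ∈ i ∷ j ∷ k ∷ l ∷ [] → a Fin.< b → χ u a b q ≡ ω) →
      χ i j k q ≡ s → χ j k l q ≡ s → χ i j l q ≡ s × χ i k l q ≡ s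
    χ-trans₃ {s} {ω} {q} {u} {i} {j} {k} {l} u<i i<j j<k k<l l<q W ijk jkl =
      sgn-of-quotient {ω} {s} {y = orient (p i) (p j) (p k) (p q)} {w″ = orient (p u) (p i) (p j) (p q)}
        (grassmann-plücker₁ (p q) (p u) (p i) (p j) (p k) (p l))
        (hasSign u<j j<k k<q (W j∈ k∈ j<k)) (hasSign u<j j<l l<q (W j∈ l∈ j<l))
        (hasSign u<i i<j j<q (W i∈ j∈ i<j))
        (hasSign i<j j<k k<q ijk) (hasSign j<k k<l l<q jkl) (nondegenerate i<j j<l l<q) ,
      sgn-of-quotient {ω} {s} {y = orient (p j) (p k) (p l) (p q)} {w″ = orient (p u) (p k) (p l) (p q)}
        (grassmann-plücker₂ (p q) (p u) (p i) (p j) (p k) (p l))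
        (hasSign u<j j<k k<q (W j∈ k∈ j<k)) (hasSign u<i i<k k<q (W i∈ k∈ i<k))
        (hasSign u<k k<l l<q (W k∈ l∈ k<l))
        (hasSign j<k k<l l<q jkl) (hasSign i<j j<k k<q ijk) (nondegenerate i<k k<l l<q)
      where
      k<q = ℕₚ.<-trans k<l l<q
      j<q = ℕₚ.<-trans j<k k<q
      j<l = ℕₚ.<-trans j<k k<l
      i<k = ℕₚ.<-trans i<j j<k
      u<j = ℕₚ.<-trans u<i i<j
      u<k = ℕₚ.<-trans u<j j<k
      i∈ = here refl
      j∈ = there (here refl)
      k∈ = there (there (here refl))
      l∈ = there (there (there (here refl)))

    module Contraction (q u v : Fin N) (u<v : u Fin.< v) {S : List (Fin N)} (sorted : AllPairs Fin._<_ S)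
      (v<S : All (v Fin.<_) S) (S<q : All (Fin._< q) S) {τ} (side : All (λ i → χ u v i q ≡ τ) S) where

      private
        Positive : Rel (Fin N) 0ℓ
        Positive x y = x Fin.< y × χ u x y q ≡ Sign.+

        positive? : Decidable Positive
        positive? x y = (x Finₚ.<? y) ×-dec (χ u x y q Signₚ.≟ Sign.+)

        module C = Chains Positive positive? S

      -- The Erdős-Szekeres theorem on monotone subsequences, for the index order against the
      -- angular order around u. In an antichain every pair has the sign -.
      monotone : ∀ m → suc (m * m) ≤ length S →
        ∃[ xs ] All (_∈ S) xs × m ≤ length xs × AllPairs Fin._<_ xs ×
          ∃[ ω ] AllPairs (λ x y → χ u x y q ≡ ω) xs
      monotone m long with C.chain-or-antichain m m S ⊆-refl sorted long
      ... | inj₂ (xs , xs⊆S , m≤ , none) = xs , All.tabulate (Sublist.lookup xs⊆S) , m≤ , xs-sorted , Sign.-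
            , AllPairs.zipWith (λ (¬pos , x<y) → ≢+⇒≡- (λ ≡+ → ¬pos (x<y , ≡+))) (none , xs-sorted)
        where xs-sorted = AllPairs-resp-⊆ xs⊆S sorted
      ... | inj₁ (x , x∈ , chain)
        with xs , len , ∈S , chain ← C.chain⇒list
               (λ x∈ y∈ z∈ (x<y , xy) (y<z , yz) → ℕₚ.<-trans x<y y<z ,
                 χ-trans₂ u<v (All.lookup v<S x∈) x<y y<z (All.lookup S<q z∈)
                   (All.lookup side x∈) (All.lookup side y∈) (All.lookup side z∈) xy yz)
               m x∈ chain
        = x ∷ xs , ∈S , ℕₚ.≤-trans (ℕₚ.≤-reflexive (sym len)) (ℕₚ.n≤1+n _)
          , AllPairs.map proj₁ chain , Sign.+ , AllPairs.map proj₂ chain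

      Homogeneous₃ : ∀ {n} → (Fin n → Fin N) → Set
      Homogeneous₃ σ = ∃[ s ] (∀ {i j k} → i Fin.< j → j Fin.< k → χ (σ i) (σ j) (σ k) q ≡ s)

      private
        module Monotone {S′} (S′⊆S : All (_∈ S) S′) (sorted′ : AllPairs Fin._<_ S′)
          {ω} (W : AllPairs (λ x y → χ u x y q ≡ ω) S′) where

          open CupsCaps Fin._<_ Finₚ._<?_ (λ x y z → χ x y z q) S′

          trans₃ : ∀ {s x y z w} → x ∈ S′ → y ∈ S′ → z ∈ S′ → w ∈ S′ →
            x Fin.< y → y Fin.< z → z Fin.< w →
            χ x y z q ≡ s → χ y z w q ≡ s → χ x y w q ≡ s × χ x z w q ≡ s
          trans₃ {x = x} {y} {z} {w} x∈ y∈ z∈ w∈ x<y y<z z<w =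
            χ-trans₃ (ℕₚ.<-trans u<v (All.lookup v<S (All.lookup S′⊆S x∈))) x<y y<z z<w
              (All.lookup S<q (All.lookup S′⊆S w∈))
              (λ a∈ b∈ → AllPairs-∈ ℕₚ.<-asym sorted′ W (All.lookup ∈S′ a∈) (All.lookup ∈S′ b∈))
            where
            ∈S′ : All (_∈ S′) (x ∷ y ∷ z ∷ w ∷ [])
            ∈S′ = x∈ ∷ y∈ ∷ z∈ ∷ w∈ ∷ []

          fromCup : ∀ n {x y} → x ∈ S′ → y ∈ S′ → Cup.Path n x y →
            ∃[ σ ] Increasing {n} {N} σ × (∀ i → σ i ∈ S) × Homogeneous₃ σ
          fromCup n x∈ y∈ cup
            -- The path has n + 2 vertices; the first two are dropped.
            with xs , refl , _ ∷ _ ∷ ∈S′ , _ ∷ _ ∷ xs-sorted , _ , _ , triples ←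
              Cup.path⇒list ℕₚ.<-trans trans₃ n x∈ y∈ cup
            = lookup xs , AllPairs-lookup xs-sorted
            , (λ i → All.lookup S′⊆S (All.lookup ∈S′ (∈-lookup i)))
            , Sign.+ , AllTriples-lookup triples

          fromCap : ∀ n {x y} → x ∈ S′ → y ∈ S′ → Cap.Path n x y →
            ∃[ σ ] Increasing {n} {N} σ × (∀ i → σ i ∈ S) × Homogeneous₃ σ
          fromCap n x∈ y∈ cap
            with xs , refl , _ ∷ _ ∷ ∈S′ , _ ∷ _ ∷ xs-sorted , _ , _ , triples ←
              Cap.path⇒list (flip ℕₚ.<-trans)
                (λ x∈ y∈ z∈ w∈ y<x z<y w<z zyx wzy →
                  let wyx , wzx = trans₃ w∈ z∈ y∈ x∈ w<z z<y y<x wzy zyx in wzx , wyx)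
                n x∈ y∈ cap
            -- A cap is listed from right to left and has to be turned around.
            = lookup xs ∘ Fin.opposite , AllPairs-lookup xs-sorted ∘ opposite-anti-<
            , (λ i → All.lookup S′⊆S (All.lookup ∈S′ (∈-lookup (Fin.opposite i))))
            , Sign.- , λ i<j j<k → AllTriples-lookup triples (opposite-anti-< j<k) (opposite-anti-< i<j)

          cupsCaps : ∀ n → 2 ^ suc (n + n) ≤ length S′ →
            ∃[ σ ] Increasing {n} {N} σ × (∀ i → σ i ∈ S) × Homogeneous₃ σ
          cupsCaps n long with cup-or-cap n n S′ ⊆-refl sorted′ long
          ... | inj₁ (_ , _ , x∈ , y∈ , cup) = fromCup n x∈ y∈ cup
          ... | inj₂ (_ , _ , x∈ , y∈ , cap) = fromCap n x∈ y∈ cap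

      homogeneous₃ : ∀ n → suc (2 ^ suc (n + n) * 2 ^ suc (n + n)) ≤ length S →
        ∃[ σ ] Increasing {n} {N} σ × (∀ i → σ i ∈ S) × Homogeneous₃ σ
      homogeneous₃ n long with monotone (2 ^ suc (n + n)) long
      ... | S′ , S′⊆S , long′ , sorted′ , ω , W = Monotone.cupsCaps S′⊆S sorted′ W n long′

-- The upper bound for rational points

module _ where
  open ℕₚ.≤-Reasoning

  private
    2^-square : ∀ m → 2 ^ m * 2 ^ m ≡ 2 ^ (m + m)
    2^-square m = sym (ℕₚ.^-distribˡ-+-* 2 m m)

  -- The left side is the exponent in `erdős-rado` for t = m = 2 ^ e.
  cubic-bound : ∀ e → 2 ^ e * suc (2 ^ e * 2 ^ e) ≤ 2 ^ suc (e + (e + e))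
  cubic-bound e = begin
    2 ^ e * suc (2 ^ e * 2 ^ e)              ≡⟨ cong (λ x → 2 ^ e * suc x) (2^-square e) ⟩
    2 ^ e * suc (2 ^ (e + e))                ≤⟨ ℕₚ.*-monoʳ-≤ (2 ^ e) (ℕₚ.+-monoˡ-≤ _ (ℕₚ.m^n>0 2 (e + e))) ⟩
    2 ^ e * (2 ^ (e + e) + 2 ^ (e + e))      ≡⟨ cong (2 ^ e *_) (2^suc (e + e)) ⟨
    2 ^ e * 2 ^ suc (e + e)                  ≡⟨ ℕₚ.^-distribˡ-+-* 2 e (suc (e + e)) ⟨
    2 ^ (e + suc (e + e))                    ≡⟨ cong (2 ^_) (ℕₚ.+-suc e (e + e)) ⟩
    2 ^ suc (e + (e + e))                    ∎

  -- The 3 stands for u, v and q; the rest is twice what `homogeneous₃` asks for, because only the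
  -- majority side of the line through u and v is kept.
  square-bound : ∀ e → 3 + (suc (2 ^ e * 2 ^ e) + suc (2 ^ e * 2 ^ e)) ≤ 2 ^ (3 + (e + e))
  square-bound e = begin
    3 + (suc x + suc x)              ≡⟨ cong (4 +_) (ℕₚ.+-suc x x) ⟩
    5 + (x + x)                      ≤⟨ ℕₚ.+-monoˡ-≤ (x + x) (ℕₚ.*-monoʳ-≤ 5 1≤x) ⟩
    5 * x + (x + x)                  ≤⟨ ℕₚ.+-monoʳ-≤ (5 * x) (ℕₚ.+-monoʳ-≤ x (ℕₚ.m≤m+n x (x + 0))) ⟩
    5 * x + 3 * x                    ≡⟨ ℕₚ.*-distribʳ-+ x 5 3 ⟨
    8 * x                            ≡⟨ cong (8 *_) (2^-square e) ⟩
    2 ^ 3 * 2 ^ (e + e)              ≡⟨ ℕₚ.^-distribˡ-+-* 2 3 (e + e) ⟨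
    2 ^ (3 + (e + e))                ∎
    where
    x = 2 ^ e * 2 ^ e
    1≤x : 1 ≤ x
    1≤x = ℕₚ.*-mono-≤ (ℕₚ.m^n>0 2 e) (ℕₚ.m^n>0 2 e)

-- The binary logarithm of the number of vertices that the thinning keeps: `square-bound` for e =
-- suc (n + n), the exponent of the cup-cap bound.
thinnedLength : ℕ → ℕ
thinnedLength n = 3 + (suc (n + n) + suc (n + n))

tower : ℕ → ℕ
tower n = 2 ^ (2 ^ suc (thinnedLength n + (thinnedLength n + thinnedLength n)))

allFin-sorted : ∀ n → AllPairs Fin._<_ (allFin n)
allFin-sorted n = AllPairsₚ.tabulate⁺-< id

module _ {N : ℕ} (p : Fin N → Fin 3 → ℚ) where
  open RationalPoints p

  module _ (nondegenerate : ∀ {i j k l} → i Fin.< j → j Fin.< k → k Fin.< l →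
              HasSignℚ (χ i j k l) (orient (p i) (p j) (p k) (p l))) where

    private
      Homogeneous₄ : ∀ {n} → (Fin n → Fin N) → Set
      Homogeneous₄ σ = ∃[ s ] (∀ {i j k l} → i Fin.< j → j Fin.< k → k Fin.< l →
        χ (σ i) (σ j) (σ k) (σ l) ≡ s)

      fromThinned : ∀ n zs → AllPairs Fin._<_ zs → EndHomogeneous {_≺_ = Fin._<_} ℕₚ.<-asym χ [] zs →
        2 ^ thinnedLength n ≤ length zs → ∃[ σ ] Increasing {n} {N} σ × Homogeneous₄ σ
      fromThinned n zs sorted coherent long with ℕₚ.≤-trans (square-bound (suc (n + n))) long
      fromThinned n (u ∷ v ∷ w ∷ rest) ((u<v ∷ _) ∷ v<ws ∷ sorted) coherent long | s≤s (s≤s (s≤s long′))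
        -- The first two entries serve as u and v, the last one as q; the planar argument takes
        -- place strictly between them.
        with q , ys , q∈ , ys⊆ , len , ys<q ← maximum sorted
        with S , S⊆ , longS , τ , side ← majority (λ i → χ u v i q) (suc (2 ^ suc (n + n) * 2 ^ suc (n + n))) ys
               (ℕₚ.≤-trans long′ (ℕₚ.≤-reflexive (sym len)))
        with σ , σ-inc , σ∈S , s , hom ← Contraction.homogeneous₃ nondegenerate q u v u<v
               (AllPairs-resp-⊆ (⊆-trans S⊆ ys⊆) sorted) (All-resp-⊆ (⊆-trans S⊆ ys⊆) v<ws)
               (All-resp-⊆ S⊆ ys<q) side n longS
        -- By end-homogeneity the fourth point of a quadruple may be replaced by q.
        = σ , σ-inc , s , λ {i} {j} {k} {l} i<j j<k k<l → trans
            (coherent (inj₂ (σ∈ i)) (inj₂ (σ∈ j)) (σ∈ k) (σ∈ l) (there (there q∈))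
              (σ-inc (ℕₚ.<-trans i<j j<k)) (σ-inc j<k) (σ-inc k<l)
              (All.lookup ys<q (Sublist.lookup S⊆ (σ∈S k))))
            (hom i<j j<k)
        where
        σ∈ : ∀ i → σ i ∈ u ∷ v ∷ w ∷ rest
        σ∈ i = there (there (Sublist.lookup (⊆-trans S⊆ ys⊆) (σ∈S i)))

    homogeneous₄ : ∀ n → tower n ≤ N → ∃[ σ ] Increasing {n} {N} σ × Homogeneous₄ σ
    homogeneous₄ n big
      with zs , zs⊆ , len , coherent ← erdős-rado ℕₚ.<-asym χ (2 ^ thinnedLength n) (2 ^ thinnedLength n) []
             (allFin N) ℕₚ.≤-refl (allFin-sorted N)
             (ℕₚ.≤-trans (ℕₚ.≤-trans (ℕₚ.^-monoʳ-≤ 2 (cubic-bound (thinnedLength n))) big)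
               (ℕₚ.≤-reflexive (sym (Listₚ.length-tabulate {n = N} id))))
      = fromThinned n zs (AllPairs-resp-⊆ zs⊆ (allFin-sorted N)) coherent (ℕₚ.≤-reflexive (sym len))

-- From real to rational points

Eventually : (ℕ → Set) → Set
Eventually P = ∃[ K ] (∀ n → K ≤ n → P n)

eventually-× : ∀ {P Q} → Eventually P → Eventually Q → Eventually (λ n → P n × Q n)
eventually-× (K , p) (L , q) = K ⊔ L , λ n KL≤n →
  p n (ℕₚ.m⊔n≤o⇒m≤o K L KL≤n) , q n (ℕₚ.m⊔n≤o⇒n≤o K L KL≤n)

eventually-∀ : ∀ {N} {P : Fin N → ℕ → Set} → (∀ i → Eventually (P i)) → Eventually (λ n → ∀ i → P i n)
eventually-∀ {zero}  _ = 0 , λ _ _ ()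
eventually-∀ {suc N} h with eventually-× (h 0F) (eventually-∀ (h ∘ Fin.suc))
... | K , all = K , λ n K≤n → λ { 0F → proj₁ (all n K≤n) ; (Fin.suc i) → proj₂ (all n K≤n) i }

eventually-→ : ∀ {A : Set} {P} → Dec A → (A → Eventually P) → Eventually (λ n → A → P n)
eventually-→ (yes a) h = proj₁ (h a) , λ n K≤n _ → proj₂ (h a) n K≤n
eventually-→ (no ¬a) h = 0 , λ _ _ a → contradiction a ¬a

module _ where
  open ℚ-Solver
  open OrientExpr using (_⊝_)
  private
    <-transfer-eq : ∀ x y ε u → (x ℚ.+ ε) ℚ.+ (u ℚ.- x) ≡ u ℚ.+ ε
    <-transfer-eq = solve 4 (λ x y ε u → ((x ⊕ ε) ⊕ (u ⊝ x)) ⊜ (u ⊕ ε)) refl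

    difference-swap : ∀ x y u v → (u ℚ.- v) ℚ.+ (v ℚ.- x) ≡ u ℚ.- x
    difference-swap = solve 4 (λ x y u v → ((u ⊝ v) ⊕ (v ⊝ x)) ⊜ (u ⊝ x)) refl

    cancel-middle : ∀ x y v → y ℚ.+ ((x ℚ.- y) ℚ.+ (v ℚ.- x)) ≡ v
    cancel-middle = solve 3 (λ x y v → (y ⊕ ((x ⊝ y) ⊕ (v ⊝ x))) ⊜ v) refl

  -- The order sees only the termwise difference of two sequences. In this way polynomial identities
  -- over the rationals act on order and apartness of reals, with no ring laws for the reals
  -- themselves.
  <-transfer : ∀ {x y u v} → (∀ n → seq u n ℚ.- seq v n ≡ seq x n ℚ.- seq y n) → x D.< y → u D.< v
  <-transfer {x} {y} {u} {v} eq (ε , 0<ε , K , h) = ε , 0<ε , K , λ n K≤n → begin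
    seq u n ℚ.+ ε                                 ≡⟨ <-transfer-eq (seq x n) (seq y n) ε (seq u n) ⟨
    (seq x n ℚ.+ ε) ℚ.+ (seq u n ℚ.- seq x n)     ≤⟨ ℚₚ.+-monoˡ-≤ (seq u n ℚ.- seq x n) (h n K≤n) ⟩
    seq y n ℚ.+ (seq u n ℚ.- seq x n)
      ≡⟨ cong (seq y n ℚ.+_) (difference-swap (seq x n) (seq y n) (seq u n) (seq v n)) ⟨
    seq y n ℚ.+ ((seq u n ℚ.- seq v n) ℚ.+ (seq v n ℚ.- seq x n))
      ≡⟨ cong (λ z → seq y n ℚ.+ (z ℚ.+ (seq v n ℚ.- seq x n))) (eq n) ⟩
    seq y n ℚ.+ ((seq x n ℚ.- seq y n) ℚ.+ (seq v n ℚ.- seq x n))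
      ≡⟨ cancel-middle (seq x n) (seq y n) (seq v n) ⟩
    seq v n                                       ∎
    where open ℚₚ.≤-Reasoning

  #-transfer : ∀ {x y u v} → (∀ n → seq u n ℚ.- seq v n ≡ seq x n ℚ.- seq y n) → x # y → u # v
  #-transfer {x} {y} {u} {v} eq (inj₁ x<y) = inj₁ (<-transfer {x} {y} {u} {v} eq x<y)
  #-transfer {x} {y} {u} {v} eq (inj₂ y<x) = inj₂ (<-transfer {y} {x} {v} {u} eq′ y<x)
    where
    swap : ∀ a b → ℚ.- (a ℚ.- b) ≡ b ℚ.- a
    swap = solve 2 (λ a b → (⊝ (a ⊝ b)) ⊜ (b ⊝ a)) refl
    eq′ : ∀ n → seq v n ℚ.- seq u n ≡ seq y n ℚ.- seq x n
    eq′ n = trans (sym (swap (seq u n) (seq v n))) (trans (cong ℚ.-_ (eq n)) (swap (seq x n) (seq y n)))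

#-sym : ∀ {x y} → x # y → y # x
#-sym (inj₁ x<y) = inj₂ x<y
#-sym (inj₂ y<x) = inj₁ y<x

<⇒<ℚ : ∀ {x y} → x D.< y → Eventually (λ n → seq x n ℚ.< seq y n)
<⇒<ℚ {x} {y} (ε , 0<ε , K , h) = K , λ n K≤n → ℚₚ.<-≤-trans
  (subst (ℚ._< seq x n ℚ.+ ε) (ℚₚ.+-identityʳ (seq x n)) (ℚₚ.+-monoʳ-< (seq x n) 0<ε)) (h n K≤n)

#-≗-contra : ∀ {x y} {A : Set} → (∀ n → seq x n ≡ seq y n) → x # y → A
#-≗-contra {x} {y} eq (inj₁ x<y) with <⇒<ℚ {x} {y} x<y
... | K , lt = ⊥-elim (ℚₚ.<-irrefl (eq K) (lt K ℕₚ.≤-refl))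
#-≗-contra {x} {y} eq (inj₂ y<x) with <⇒<ℚ {y} {x} y<x
... | K , lt = ⊥-elim (ℚₚ.<-irrefl (sym (eq K)) (lt K ℕₚ.≤-refl))

HasSign⇒HasSignℚ : ∀ s {x} → HasSign s x → Eventually (λ n → HasSignℚ s (seq x n))
HasSign⇒HasSignℚ Sign.+ {x} = <⇒<ℚ {0ℝ} {x}
HasSign⇒HasSignℚ Sign.- {x} = <⇒<ℚ {x} {0ℝ}

#0⇒HasSign : ∀ {x} → x # 0ℝ → ∃[ s ] HasSign s x
#0⇒HasSign (inj₁ x<0) = Sign.- , x<0
#0⇒HasSign (inj₂ 0<x) = Sign.+ , 0<x

cross : Point → Point → Point
cross u v 0F = u 1F D.* v 2F D.- u 2F D.* v 1F
cross u v 1F = u 2F D.* v 0F D.- u 0F D.* v 2F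
cross u v 2F = u 0F D.* v 1F D.- u 1F D.* v 0F

e₃ : Point
e₃ 0F = 0ℝ
e₃ 1F = 0ℝ
e₃ 2F = fromℚ 1ℚ

module _ where
  open ℚ-Solver
  open OrientExpr

  private
    third : ∀ {n} → Vector n → Expr ℚ n
    third (_ , _ , x) = x

    e₃′ : ∀ {n} → Vector n
    e₃′ = Κ 0ℚ , Κ 0ℚ , Κ 1ℚ

  module _ (p q : Point) where
    private
      d = q ⊖ p

    line-in-vertical : ∀ n → seq (dot (cross d e₃) q) n ≡ seq (dot (cross d e₃) p) n
    line-in-vertical n = solve 6 (λ p₀ p₁ p₂ q₀ q₁ q₂ →
        let p = p₀ , p₁ , p₂ ; q = q₀ , q₁ , q₂ in
        dot′ (cross′ (q ⊖′ p) e₃′) q ⊜ dot′ (cross′ (q ⊖′ p) e₃′) p) refl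
      (seq (p 0F) n) (seq (p 1F) n) (seq (p 2F) n) (seq (q 0F) n) (seq (q 1F) n) (seq (q 2F) n)

    line-in-plane : ∀ r n → seq (dot (cross d (r ⊖ p)) q) n ≡ seq (dot (cross d (r ⊖ p)) p) n
    line-in-plane r n = solve 9 (λ p₀ p₁ p₂ q₀ q₁ q₂ r₀ r₁ r₂ →
        let p = p₀ , p₁ , p₂ ; q = q₀ , q₁ , q₂ ; r = r₀ , r₁ , r₂ in
        dot′ (cross′ (q ⊖′ p) (r ⊖′ p)) q ⊜ dot′ (cross′ (q ⊖′ p) (r ⊖′ p)) p) refl
      (seq (p 0F) n) (seq (p 1F) n) (seq (p 2F) n) (seq (q 0F) n) (seq (q 1F) n) (seq (q 2F) n)
      (seq (r 0F) n) (seq (r 1F) n) (seq (r 2F) n)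

    third-in-plane : ∀ r n → seq (dot (cross d (r ⊖ p)) r) n ≡ seq (dot (cross d (r ⊖ p)) p) n
    third-in-plane r n = solve 9 (λ p₀ p₁ p₂ q₀ q₁ q₂ r₀ r₁ r₂ →
        let p = p₀ , p₁ , p₂ ; q = q₀ , q₁ , q₂ ; r = r₀ , r₁ , r₂ in
        dot′ (cross′ (q ⊖′ p) (r ⊖′ p)) r ⊜ dot′ (cross′ (q ⊖′ p) (r ⊖′ p)) p) refl
      (seq (p 0F) n) (seq (p 1F) n) (seq (p 2F) n) (seq (q 0F) n) (seq (q 1F) n) (seq (q 2F) n)
      (seq (r 0F) n) (seq (r 1F) n) (seq (r 2F) n)

    cross-third : ∀ r n → 0ℚ ℚ.- seq (cross d (r ⊖ p) 2F) n ≡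
      seq (dot (cross d e₃) r) n ℚ.- seq (dot (cross d e₃) p) n
    cross-third r n = solve 9 (λ p₀ p₁ p₂ q₀ q₁ q₂ r₀ r₁ r₂ →
        let p = p₀ , p₁ , p₂ ; q = q₀ , q₁ , q₂ ; r = r₀ , r₁ , r₂ in
        (Κ 0ℚ ⊝ third (cross′ (q ⊖′ p) (r ⊖′ p))) ⊜
        (dot′ (cross′ (q ⊖′ p) e₃′) r ⊝ dot′ (cross′ (q ⊖′ p) e₃′) p)) refl
      (seq (p 0F) n) (seq (p 1F) n) (seq (p 2F) n) (seq (q 0F) n) (seq (q 1F) n) (seq (q 2F) n)
      (seq (r 0F) n) (seq (r 1F) n) (seq (r 2F) n)

    det-as-dot : ∀ r s n → seq (det d (r ⊖ p) (s ⊖ p)) n ℚ.- 0ℚ ≡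
      seq (dot (cross d (r ⊖ p)) s) n ℚ.- seq (dot (cross d (r ⊖ p)) p) n
    det-as-dot r s n = solve 12 (λ p₀ p₁ p₂ q₀ q₁ q₂ r₀ r₁ r₂ s₀ s₁ s₂ →
        let p = p₀ , p₁ , p₂ ; q = q₀ , q₁ , q₂ ; r = r₀ , r₁ , r₂ ; s = s₀ , s₁ , s₂ in
        (det′ (q ⊖′ p) (r ⊖′ p) (s ⊖′ p) ⊝ Κ 0ℚ) ⊜
        (dot′ (cross′ (q ⊖′ p) (r ⊖′ p)) s ⊝ dot′ (cross′ (q ⊖′ p) (r ⊖′ p)) p)) refl
      (seq (p 0F) n) (seq (p 1F) n) (seq (p 2F) n) (seq (q 0F) n) (seq (q 1F) n) (seq (q 2F) n)
      (seq (r 0F) n) (seq (r 1F) n) (seq (r 2F) n) (seq (s 0F) n) (seq (s 1F) n) (seq (s 2F) n)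

    det-as-dot′ : ∀ r s n → 0ℚ ℚ.- seq (det d (r ⊖ p) (s ⊖ p)) n ≡
      seq (dot (cross d (s ⊖ p)) r) n ℚ.- seq (dot (cross d (s ⊖ p)) p) n
    det-as-dot′ r s n = solve 12 (λ p₀ p₁ p₂ q₀ q₁ q₂ r₀ r₁ r₂ s₀ s₁ s₂ →
        let p = p₀ , p₁ , p₂ ; q = q₀ , q₁ , q₂ ; r = r₀ , r₁ , r₂ ; s = s₀ , s₁ , s₂ in
        (Κ 0ℚ ⊝ det′ (q ⊖′ p) (r ⊖′ p) (s ⊖′ p)) ⊜
        (dot′ (cross′ (q ⊖′ p) (s ⊖′ p)) r ⊝ dot′ (cross′ (q ⊖′ p) (s ⊖′ p)) p)) refl
      (seq (p 0F) n) (seq (p 1F) n) (seq (p 2F) n) (seq (q 0F) n) (seq (q 1F) n) (seq (q 2F) n)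
      (seq (r 0F) n) (seq (r 1F) n) (seq (r 2F) n) (seq (s 0F) n) (seq (s 1F) n) (seq (s 2F) n)

    e₃-horizontal : ∀ n → seq (cross d e₃ 1F) n ℚ.- 0ℚ ≡ seq (p 0F) n ℚ.- seq (q 0F) n
    e₃-horizontal n = solve 6 (λ p₀ p₁ p₂ q₀ q₁ q₂ →
        let d₀ = q₀ ⊝ p₀ ; d₂ = q₂ ⊝ p₂ in
        (d₂ ⊗ Κ 0ℚ ⊝ d₀ ⊗ Κ 1ℚ ⊝ Κ 0ℚ) ⊜ (p₀ ⊝ q₀)) refl
      (seq (p 0F) n) (seq (p 1F) n) (seq (p 2F) n) (seq (q 0F) n) (seq (q 1F) n) (seq (q 2F) n)

private
  fin4 : ∀ {P : Fin 4 → Set} {A : Set} → (P 0F → A) → (P 1F → A) → (P 2F → A) → (P 3F → A) → ∃ P → A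
  fin4 a b c d (0F , x) = a x
  fin4 a b c d (1F , x) = b x
  fin4 a b c d (2F , x) = c x
  fin4 a b c d (3F , x) = d x

-- First the plane through p and q parallel to the third axis misses r or s, so
-- p and q span a plane with it; that plane then misses the remaining point.
notCoplanar⇒oriented : ∀ q → NotCoplanar q → q 0F 0F # q 1F 0F → ∃[ σ ] HasOrientation σ q
notCoplanar⇒oriented P notCoplanar p₀#q₀ =
  fin4 (#-≗-contra {dot (cross d e₃) p} {b} (λ _ → refl))
       (#-≗-contra {dot (cross d e₃) q} {b} (line-in-vertical p q))
       (λ r# → spanned-by-r (vertical r r#))
       (λ s# → spanned-by-s (vertical s s#))
       -- The normal of the vertical plane is (d₁, -d₀, 0), and d₀ is apart from 0 by the distinct
       -- first coordinates. Starting with this plane yields a normal that is apart from 0, without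
       -- having to decide whether p, q, r are collinear.
       (notCoplanar (cross d e₃) b (1F , #-transfer {p 0F} {q 0F} {cross d e₃ 1F} {0ℝ} (e₃-horizontal p q) p₀#q₀))
  where
  p = P 0F
  q = P 1F
  r = P 2F
  s = P 3F
  d = q ⊖ p
  b = dot (cross d e₃) p
  D = det d (r ⊖ p) (s ⊖ p)

  vertical : ∀ t → dot (cross d e₃) t # b → ∃[ i ] cross d (t ⊖ p) i # 0ℝ
  vertical t t# = 2F , #-sym {0ℝ} {cross d (t ⊖ p) 2F}
    (#-transfer {dot (cross d e₃) t} {b} {0ℝ} {cross d (t ⊖ p) 2F} (cross-third p q t) t#)

  spanned-by-r : ∃[ i ] cross d (r ⊖ p) i # 0ℝ → ∃[ σ ] HasSign σ D
  spanned-by-r a# = fin4 {λ j → dot a (P j) # dot a p}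
    (#-≗-contra {dot a p} {dot a p} (λ _ → refl))
    (#-≗-contra {dot a q} {dot a p} (line-in-plane p q r))
    (#-≗-contra {dot a r} {dot a p} (third-in-plane p q r))
    (λ s# → #0⇒HasSign (#-transfer {dot a s} {dot a p} {D} {0ℝ} (det-as-dot p q r s) s#))
    (notCoplanar a (dot a p) a#)
    where a = cross d (r ⊖ p)

  spanned-by-s : ∃[ i ] cross d (s ⊖ p) i # 0ℝ → ∃[ σ ] HasSign σ D
  spanned-by-s a# = fin4 {λ j → dot a (P j) # dot a p}
    (#-≗-contra {dot a p} {dot a p} (λ _ → refl))
    (#-≗-contra {dot a q} {dot a p} (line-in-plane p q s))
    (λ r# → #0⇒HasSign (#-sym {0ℝ} {D}
      (#-transfer {dot a r} {dot a p} {0ℝ} {D} (det-as-dot′ p q r s) r#)))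
    (#-≗-contra {dot a s} {dot a p} (third-in-plane p q s))
    (notCoplanar a (dot a p) a#)
    where a = cross d (s ⊖ p)

tuple : ∀ {N} (i j k l : Fin N) → Fin 4 → Fin N
tuple i j k l 0F = i
tuple i j k l 1F = j
tuple i j k l 2F = k
tuple i j k l 3F = l

tuple-increasing : ∀ {N} {i j k l : Fin N} → i Fin.< j → j Fin.< k → k Fin.< l → Increasing (tuple i j k l)
tuple-increasing i<j j<k k<l {0F} {1F} _ = i<j
tuple-increasing i<j j<k k<l {0F} {2F} _ = ℕₚ.<-trans i<j j<k
tuple-increasing i<j j<k k<l {0F} {3F} _ = ℕₚ.<-trans i<j (ℕₚ.<-trans j<k k<l)
tuple-increasing i<j j<k k<l {1F} {2F} _ = j<k
tuple-increasing i<j j<k k<l {1F} {3F} _ = ℕₚ.<-trans j<k k<l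
tuple-increasing i<j j<k k<l {2F} {3F} _ = k<l
tuple-increasing i<j j<k k<l {1F} {1F} (s≤s ())
tuple-increasing i<j j<k k<l {2F} {1F} (s≤s ())
tuple-increasing i<j j<k k<l {2F} {2F} (s≤s (s≤s ()))
tuple-increasing i<j j<k k<l {3F} {1F} (s≤s ())
tuple-increasing i<j j<k k<l {3F} {2F} (s≤s (s≤s ()))
tuple-increasing i<j j<k k<l {3F} {3F} (s≤s (s≤s (s≤s ())))

module _ {N : ℕ} (p : PointSeq N) (general : GeneralPosition p) where
  open GeneralPosition general

  at : ℕ → Fin N → Fin 3 → ℚ
  at n i k = seq (p i k) n

  orientation : ∀ {i j k l} → i Fin.< j → j Fin.< k → k Fin.< l →
    ∃[ s ] HasOrientation s (p ∘ tuple i j k l)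
  orientation {i} {j} {k} {l} i<j j<k k<l = notCoplanar⇒oriented (p ∘ tuple i j k l)
    (notCoplanar (tuple i j k l) (tuple-increasing i<j j<k k<l)) (distinctCoords i<j 0F)

  Oriented : ∀ (i j k l : Fin N) → ℕ → Set
  Oriented i j k l n = ∃[ s ] HasOrientation s (p ∘ tuple i j k l) ×
    HasSignℚ s (orient (at n i) (at n j) (at n k) (at n l))

  opaque
    unfolding orient

    eventually-oriented : ∀ {i j k l} → i Fin.< j → j Fin.< k → k Fin.< l → Eventually (Oriented i j k l)
    eventually-oriented {i} {j} {k} {l} i<j j<k k<l =
      let s , o = orientation i<j j<k k<l
          K , h = HasSign⇒HasSignℚ s {det (p j ⊖ p i) (p k ⊖ p i) (p l ⊖ p i)} o
      in K , λ n K≤n → s , o , h n K≤n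

  rational-stage : ∃[ n ] ∀ i j k l → i Fin.< j → j Fin.< k → k Fin.< l → Oriented i j k l n
  rational-stage =
    let K , h = eventually-∀ λ i → eventually-∀ λ j → eventually-∀ λ k → eventually-∀ λ l →
          eventually-→ (i Finₚ.<? j) λ i<j → eventually-→ (j Finₚ.<? k) λ j<k →
          eventually-→ (k Finₚ.<? l) λ k<l → eventually-oriented {i} {j} {k} {l} i<j j<k k<l
    in K , h K ℕₚ.≤-refl

forcesHomogeneous : ∀ n N → tower n ≤ N → ForcesHomogeneous n N
forcesHomogeneous n N big p general =
  let m , oriented = rational-stage p general
      x = at p general m
      σ , σ-inc , s , hom = homogeneous₄ x
        (λ i<j j<k k<l → let s , _ , o = oriented _ _ _ _ i<j j<k k<l in
          sgn-correct {s} o) n big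
  in σ , σ-inc , s , λ τ τ-inc →
    let 0<1 = s≤s z≤n
        1<2 = s≤s (s≤s z≤n)
        2<3 = s≤s (s≤s (s≤s z≤n))
        t , real , o = oriented (σ (τ 0F)) (σ (τ 1F)) (σ (τ 2F)) (σ (τ 3F))
          (σ-inc (τ-inc 0<1)) (σ-inc (τ-inc 1<2)) (σ-inc (τ-inc 2<3))
    in subst (λ u → HasOrientation u (p ∘ σ ∘ τ))
         (trans (sign-unique o (sgn-correct {t} o)) (hom (τ-inc 0<1) (τ-inc 1<2) (τ-inc 2<3))) real

-- Words and their first differences

Word : ℕ → Set
Word = Vec Bool

-- Lt a b d: a precedes b lexicographically, and d is the level (position
-- counted from the right end) of the first letter at which they differ.
data Lt : ∀ {l} → Word l → Word l → ℕ → Set where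
  here  : ∀ {l} {a b : Word l} → Lt (false ∷ a) (true ∷ b) l
  there : ∀ {l x d} {a b : Word l} → Lt a b d → Lt (x ∷ a) (x ∷ b) d

Lt-level : ∀ {l d} {a b : Word l} → Lt a b d → d < l
Lt-level here      = ℕₚ.≤-refl
Lt-level (there p) = ℕₚ.m≤n⇒m≤1+n (Lt-level p)

Lt-functional : ∀ {l d e} {a b : Word l} → Lt a b d → Lt a b e → d ≡ e
Lt-functional here      here      = refl
Lt-functional (there p) (there q) = Lt-functional p q

Lt-asym : ∀ {l d e} {a b : Word l} → Lt a b d → ¬ Lt b a e
Lt-asym (there p) (there q) = Lt-asym p q

-- At a common level the letter of b would be `true` as the larger word of the first pair and
-- `false` as the smaller word of the second.
Lt-consecutive : ∀ {l d e} {a b c : Word l} → Lt a b d → Lt b c e → d ≢ e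
Lt-consecutive here      (there q) refl = ℕₚ.<-irrefl refl (Lt-level q)
Lt-consecutive (there p) here      refl = ℕₚ.<-irrefl refl (Lt-level p)
Lt-consecutive (there p) (there q) d≡e  = Lt-consecutive p q d≡e

-- With `Lt-trans->` this is the ultrametric identity δ(a, c) = max(δ(a, b), δ(b, c)) on which
-- stepping up rests.
Lt-trans-< : ∀ {l d e} {a b c : Word l} → Lt a b d → Lt b c e → d < e → Lt a c e
Lt-trans-< here      (there q) d<e = ⊥-elim (ℕₚ.<-asym d<e (Lt-level q))
Lt-trans-< (there p) here      d<e = here
Lt-trans-< (there p) (there q) d<e = there (Lt-trans-< p q d<e)

Lt-trans-> : ∀ {l d e} {a b c : Word l} → Lt a b d → Lt b c e → e < d → Lt a c d
Lt-trans-> here      (there q) e<d = here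
Lt-trans-> (there p) here      e<d = ⊥-elim (ℕₚ.<-asym e<d (Lt-level p))
Lt-trans-> (there p) (there q) e<d = there (Lt-trans-> p q e<d)

word : ∀ l → ℕ → Word l
word zero    i = []
word (suc l) i with i ℕₚ.<? 2 ^ l
... | yes _ = false ∷ word l i
... | no  _ = true ∷ word l (i ∸ 2 ^ l)

word-< : ∀ l {i j} → i < j → j < 2 ^ l → ∃ (Lt (word l i) (word l j))
word-< zero {j = suc j} i<j (s≤s ())
word-< (suc l) {i} {j} i<j j< with i ℕₚ.<? 2 ^ l | j ℕₚ.<? 2 ^ l
... | yes i<2^l | yes j<2^l = _ , there (proj₂ (word-< l i<j j<2^l))
... | yes i<2^l | no  j≮2^l = l , here
... | no  i≮2^l | yes j<2^l = ⊥-elim (i≮2^l (ℕₚ.<-trans i<j j<2^l))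
... | no  i≮2^l | no  j≮2^l = _ , there (proj₂ (word-< l
  (ℕₚ.∸-monoˡ-< i<j (ℕₚ.≮⇒≥ i≮2^l))
  (ℕₚ.m<n+o⇒m∸n<o j (2 ^ l) {{ℕₚ.m^n≢0 2 l}} (subst (j <_) (2^suc l) j<))))

infix 4 _≻_
_≻_ : ∀ {l} → Rel (Word l) 0ℓ
a ≻ b = ∃ (Lt b a)

≻-asym : ∀ {l} → Asymmetric (_≻_ {l})
≻-asym (_ , p) (_ , q) = Lt-asym p q

Decreasing : ∀ {l} → List (Word l) → Set
Decreasing = AllPairs _≻_

record Halves {l} (ws : List (Word (suc l))) : Set where
  field
    upper lower      : List (Word l)
    decomposition    : ws ≡ map (true ∷_) upper ++ map (false ∷_) lower
    upper-decreasing : Decreasing upper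
    lower-decreasing : Decreasing lower

  upper∈ : ∀ {a} → a ∈ upper → true ∷ a ∈ ws
  upper∈ a∈ = subst (_ ∈_) (sym decomposition) (∈-++⁺ˡ (∈-map⁺ (true ∷_) a∈))

  lower∈ : ∀ {a} → a ∈ lower → false ∷ a ∈ ws
  lower∈ a∈ = subst (_ ∈_) (sym decomposition)
    (∈-++⁺ʳ (map (true ∷_) upper) (∈-map⁺ (false ∷_) a∈))

  length-halves : length ws ≡ length upper + length lower
  length-halves = trans (cong length decomposition)
    (trans (Listₚ.length-++ (map (true ∷_) upper))
      (cong₂ _+_ (Listₚ.length-map (true ∷_) upper) (Listₚ.length-map (false ∷_) lower)))

private
  below-false : ∀ {l} {a : Word l} {ws} → All (false ∷ a ≻_) ws →
    ∃[ bs ] ws ≡ map (false ∷_) bs × All (a ≻_) bs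
  below-false [] = [] , refl , []
  below-false ((_ , there p) ∷ ps) with below-false ps
  ... | bs , refl , below = _ ∷ bs , refl , (_ , p) ∷ below

  same-head : ∀ {l x} {ws : List (Word l)} → Decreasing (map (x ∷_) ws) → Decreasing ws
  same-head p = AllPairs.map (λ { (_ , there q) → _ , q }) (AllPairsₚ.map⁻ p)

halves : ∀ {l} {ws : List (Word (suc l))} → Decreasing ws → Halves ws
halves [] = record { upper = [] ; lower = [] ; decomposition = refl
                   ; upper-decreasing = [] ; lower-decreasing = [] }
halves {ws = (false ∷ a) ∷ ws} (p ∷ ps) with below-false p
... | bs , refl , below = record { upper = [] ; lower = a ∷ bs ; decomposition = refl
  ; upper-decreasing = [] ; lower-decreasing = below ∷ same-head ps }
halves {ws = (true ∷ a) ∷ ws} (p ∷ ps) with halves ps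
... | record { upper = us ; lower = ls ; decomposition = refl
             ; upper-decreasing = ud ; lower-decreasing = ld }
  = record { upper = a ∷ us ; lower = ls ; decomposition = refl
           ; upper-decreasing = All.map (λ { (_ , there q) → _ , q })
               (Allₚ.map⁻ (Allₚ.++⁻ˡ (map (true ∷_) us) p)) ∷ ud
           ; lower-decreasing = ld }

decreasing₀ : ∀ {ws : List (Word 0)} → Decreasing ws → length ws ≤ 1
decreasing₀ [] = z≤n
decreasing₀ (_ ∷ []) = ℕₚ.≤-refl
decreasing₀ (((_ , ()) ∷ _) ∷ _ ∷ _)

module _ {A : Set} where

  AllTriples-∈ : ∀ {R : Rel A 0ℓ} {T x y z xs} → Asymmetric R → AllPairs R xs → AllTriples T xs →
    x ∈ xs → y ∈ xs → z ∈ xs → R x y → R y z → T x y z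
  AllTriples-∈ asym (_ ∷ _) _ (here refl) (here refl) _ xy yz = ⊥-elim (asym xy xy)
  AllTriples-∈ asym (_ ∷ _) _ (here refl) (there y∈) (here refl) xy yz = ⊥-elim (asym xy yz)
  AllTriples-∈ asym (_ ∷ rs) (t , _) (here refl) (there y∈) (there z∈) xy yz =
    AllPairs-∈ asym rs t y∈ z∈ yz
  AllTriples-∈ asym (r ∷ _) _ (there x∈) (here refl) _ xy yz = ⊥-elim (asym xy (All.lookup r x∈))
  AllTriples-∈ asym (r ∷ _) _ (there x∈) (there y∈) (here refl) xy yz = ⊥-elim (asym yz (All.lookup r y∈))
  AllTriples-∈ asym (_ ∷ rs) (_ , ts) (there x∈) (there y∈) (there z∈) xy yz =
    AllTriples-∈ asym rs ts x∈ y∈ z∈ xy yz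

  AllTriples-map⁺ : ∀ {B : Set} {T} (f : B → A) {xs} →
    AllTriples (λ x y z → T (f x) (f y) (f z)) xs → AllTriples T (map f xs)
  AllTriples-map⁺ f {[]}     _       = tt
  AllTriples-map⁺ f {x ∷ xs} (t , ts) = AllPairsₚ.map⁺ t , AllTriples-map⁺ f ts

-- Lists of words along which the level of the first difference decreases:
-- R x y d says that x and y differ first at level d, and fixes their order.
data Comb {W : Set} (R : W → W → ℕ → Set) : List W → List ℕ → Set where
  single : ∀ x → Comb R (x ∷ []) []
  add : ∀ {x xs d ds} → All (λ y → R x y d) xs → All (_< d) ds → Comb R xs ds → Comb R (x ∷ xs) (d ∷ ds)

module _ {W : Set} {R : W → W → ℕ → Set} where

  comb-decreasing : ∀ {xs ds} → Comb R xs ds → AllPairs (flip _<_) ds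
  comb-decreasing (single _)         = []
  comb-decreasing (add _ lt c) = lt ∷ comb-decreasing c

  comb-All : ∀ {P : ℕ → Set} {xs ds} → Comb R xs ds →
    (∀ {x y d} → x ∈ xs → y ∈ xs → R x y d → P d) → All P ds
  comb-All (single _) _ = []
  comb-All {xs = x ∷ y ∷ ys} (add (r ∷ _) _ c) h =
    h (here refl) (there (here refl)) r ∷ comb-All c (λ x∈ y∈ → h (there x∈) (there y∈))

  -- In a comb the level of two words depends only on the earlier one. Hence any levels picked from
  -- `ds`, adjacent or not, are the consecutive levels of suitable words.
  comb-AllPairs : ∀ {P : ℕ → ℕ → Set} {xs ds} → Comb R xs ds →
    (∀ {x y z d e} → x ∈ xs → y ∈ xs → z ∈ xs → R x y d → R y z e → e < d → P d e) → AllPairs P ds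
  comb-AllPairs (single _) _ = []
  comb-AllPairs (add r lt c) h =
    All.zipWith (λ (p , e<d) → p e<d) (comb-All c (λ y∈ z∈ yz e<d →
      h (here refl) (there y∈) (there z∈) (All.lookup r y∈) yz e<d) , lt)
    ∷ comb-AllPairs c (λ x∈ y∈ z∈ → h (there x∈) (there y∈) (there z∈))

  comb-AllTriples : ∀ {T : ℕ → ℕ → ℕ → Set} {xs ds} → Comb R xs ds →
    (∀ {x y z w d e f} → x ∈ xs → y ∈ xs → z ∈ xs → w ∈ xs →
      R x y d → R y z e → R z w f → e < d → f < e → T d e f) → AllTriples T ds
  comb-AllTriples (single _) _ = tt
  comb-AllTriples (add r lt c) h =
    AllPairs.map (λ (t , e<d , f<e) → t e<d f<e)
      (AllPairs.zip (comb-AllPairs c (λ y∈ z∈ w∈ yz zw f<e e<d f<e′ →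
         h (here refl) (there y∈) (there z∈) (there w∈) (All.lookup r y∈) yz zw e<d f<e) ,
       AllPairs.zip (pairs lt , comb-decreasing c)))
    , comb-AllTriples c (λ x∈ y∈ z∈ w∈ → h (there x∈) (there y∈) (there z∈) (there w∈))
    where
    pairs : ∀ {d es} → All (_< d) es → AllPairs (λ e _ → e < d) es
    pairs []       = []
    pairs (p ∷ ps) = All.map (λ _ → p) ps ∷ pairs ps

comb-map : ∀ {V W : Set} {R : V → V → ℕ → Set} {R′ : W → W → ℕ → Set} (f : V → W) →
  (∀ {x y d} → R x y d → R′ (f x) (f y) d) → ∀ {xs ds} → Comb R xs ds → Comb R′ (map f xs) ds
comb-map f h (single x)         = single (f x)
comb-map f h (add r lt c) = add (Allₚ.map⁺ (All.map h r)) lt (comb-map f h c)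

NoPeak : ∀ {l} → List (Word l) → Set
NoPeak ws = ∀ {a b c d i j k} → a ∈ ws → b ∈ ws → c ∈ ws → d ∈ ws →
  Lt a b i → Lt b c j → Lt c d k → i < j → k < j → ⊥

Ascent Descent : ∀ {l} → Word l → Word l → ℕ → Set
Ascent      = Lt
Descent x y = Lt y x

record Valley {l} (ws : List (Word l)) : Set where
  field
    {xs ys} : List (Word l)
    {ds es} : List ℕ
    xs⊆     : All (_∈ ws) xs
    ys⊆     : All (_∈ ws) ys
    descent : Comb Descent xs ds
    ascent  : Comb Ascent ys es
    long    : length ws ≤ suc (length ds + length es)

-- Without peaks, at every branching of the tree of words one side is a single word.
valley : ∀ {l} {w} {ws : List (Word l)} → Decreasing (w ∷ ws) → NoPeak (w ∷ ws) → Valley (w ∷ ws)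
valley {zero} {w} dec _ = record { xs⊆ = here refl ∷ [] ; ys⊆ = here refl ∷ []
  ; descent = single w ; ascent = single w ; long = decreasing₀ dec }
valley {suc l} {w} {ws} dec noPeak = go (halves dec)
  where
  go : Halves (w ∷ ws) → Valley (w ∷ ws)
  go h@record { upper = [] ; lower = a ∷ as ; lower-decreasing = as-dec } =
    let open Halves h
        v = valley as-dec (λ a∈ b∈ c∈ d∈ p q r → noPeak (lower∈ a∈) (lower∈ b∈) (lower∈ c∈) (lower∈ d∈)
              (there p) (there q) (there r))
        open Valley v
    in record { xs⊆ = Allₚ.map⁺ (All.map lower∈ xs⊆) ; ys⊆ = Allₚ.map⁺ (All.map lower∈ ys⊆)
              ; descent = comb-map (false ∷_) there descent ; ascent = comb-map (false ∷_) there ascent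
              ; long = ℕₚ.≤-trans (ℕₚ.≤-reflexive length-halves) long }
  go h@record { upper = b ∷ bs ; lower = [] ; upper-decreasing = bs-dec } =
    let open Halves h
        v = valley bs-dec (λ a∈ b∈ c∈ d∈ p q r → noPeak (upper∈ a∈) (upper∈ b∈) (upper∈ c∈) (upper∈ d∈)
              (there p) (there q) (there r))
        open Valley v
    in record { xs⊆ = Allₚ.map⁺ (All.map upper∈ xs⊆) ; ys⊆ = Allₚ.map⁺ (All.map upper∈ ys⊆)
              ; descent = comb-map (true ∷_) there descent ; ascent = comb-map (true ∷_) there ascent
              ; long = ℕₚ.≤-trans (ℕₚ.≤-reflexive (trans length-halves (ℕₚ.+-identityʳ _))) long }
  go h@record { upper = b ∷ [] ; lower = a ∷ as ; lower-decreasing = as-dec } =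
    let open Halves h
        v = valley as-dec (λ a∈ b∈ c∈ d∈ p q r → noPeak (lower∈ a∈) (lower∈ b∈) (lower∈ c∈) (lower∈ d∈)
              (there p) (there q) (there r))
        open Valley v
    in record { xs⊆ = upper∈ (here refl) ∷ Allₚ.map⁺ (All.map lower∈ xs⊆) ; ys⊆ = Allₚ.map⁺ (All.map lower∈ ys⊆)
              ; descent = add (Allₚ.map⁺ (All.tabulate (λ _ → here))) (comb-All descent (λ _ _ → Lt-level))
                  (comb-map (false ∷_) there descent)
              ; ascent = comb-map (false ∷_) there ascent
              ; long = ℕₚ.≤-trans (ℕₚ.≤-reflexive length-halves) (s≤s long) }
  go h@record { upper = b ∷ b′ ∷ bs ; lower = a ∷ [] ; upper-decreasing = bs-dec } =
    let open Halves h
        v = valley bs-dec (λ a∈ b∈ c∈ d∈ p q r → noPeak (upper∈ a∈) (upper∈ b∈) (upper∈ c∈) (upper∈ d∈)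
              (there p) (there q) (there r))
        open Valley v
    in record { xs⊆ = Allₚ.map⁺ (All.map upper∈ xs⊆) ; ys⊆ = lower∈ (here refl) ∷ Allₚ.map⁺ (All.map upper∈ ys⊆)
              ; descent = comb-map (true ∷_) there descent
              ; ascent = add (Allₚ.map⁺ (All.tabulate (λ _ → here))) (comb-All ascent (λ _ _ → Lt-level))
                  (comb-map (true ∷_) there ascent)
              ; long = ℕₚ.≤-trans (ℕₚ.≤-reflexive (trans length-halves (ℕₚ.+-comm _ 1)))
                  (ℕₚ.≤-trans (s≤s long) (ℕₚ.≤-reflexive (cong suc (sym (ℕₚ.+-suc _ _))))) }
  go h@record { upper = b ∷ b′ ∷ bs ; lower = a ∷ a′ ∷ as
              ; upper-decreasing = ((_ , b′<b) ∷ _) ∷ _ ; lower-decreasing = ((_ , a′<a) ∷ _) ∷ _ } =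
    let open Halves h in
    ⊥-elim (noPeak (lower∈ (there (here refl))) (lower∈ (here refl)) (upper∈ (there (here refl))) (upper∈ (here refl))
      (there a′<a) here (there b′<b) (Lt-level a′<a) (Lt-level b′<b))
  go record { upper = [] ; lower = [] ; decomposition = () }

-- Homogeneous families of words

Compare : Sign → ℕ → ℕ → Set
Compare Sign.+ d e = d < e
Compare Sign.- d e = e < d

compare-sign : ∀ {d e} → d ≢ e → ∃[ s ] Compare s d e
compare-sign {d} {e} d≢e with ℕₚ.<-cmp d e
... | tri< d<e _ _ = Sign.+ , d<e
... | tri≈ _ d≡e _ = contradiction d≡e d≢e
... | tri> _ _ e<d = Sign.- , e<d

-- x, y, z is a rearrangement of i, j, k of the given sign.
data Permutation (i j k : ℕ) : (x y z : ℕ) → Sign → Set where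
  ijk : Permutation i j k i j k Sign.+
  jki : Permutation i j k j k i Sign.+
  kij : Permutation i j k k i j Sign.+
  jik : Permutation i j k j i k Sign.-
  ikj : Permutation i j k i k j Sign.-
  kji : Permutation i j k k j i Sign.-

module Planar (r : ℕ) where

  -- The orientation of the planar points with indices i < j < k.
  Orientation : Sign → ℕ → ℕ → ℕ → Set
  Orientation s i j k = ∃₂ λ d e →
    Lt (word r i) (word r j) d × Lt (word r j) (word r k) e × Compare s d e

  -- The sign of the determinant with columns i, j, k, in any order.
  OrientedColumns : Sign → ℕ → ℕ → ℕ → Set
  OrientedColumns s i j k = ∀ {x y z t} → Permutation i j k x y z t → x < y → y < z →
    Orientation (t Sign.* s) x y z

  -- What homogeneity of the space points leaves on the level of words. It is empty for quadruples
  -- with two equal levels, since `OrientedColumns` only speaks of strictly increasing x, y, z.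
  HomogeneousWords : Sign → ∀ {l} → List (Word l) → Set
  HomogeneousWords s ws = ∀ {a b c d i j k} → a ∈ ws → b ∈ ws → c ∈ ws → d ∈ ws →
    Lt a b i → Lt b c j → Lt c d k → OrientedColumns s i j k

  private
    compare-max : ∀ {x y z d e f} → Lt (word r x) (word r y) d → Lt (word r y) (word r z) e →
      Lt (word r x) (word r z) f → (d < e → e ≡ f) × (e < d → d ≡ f)
    compare-max p q r = (λ d<e → Lt-functional (Lt-trans-< p q d<e) r)
                      , (λ e<d → Lt-functional (Lt-trans-> p q e<d) r)

  -- Seen from y, the points x and z would lie on the two sides of the line yw
  -- in one order, and in the opposite order by the third orientation.
  no-crossing : ∀ s {x y z w} → x < y → z < y →
    Orientation s x y w → Orientation (Sign.- Sign.* s) z y w →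
    (x < z → Orientation (Sign.- Sign.* s) x z y) → (z < x → Orientation s z x y) → ⊥
  no-crossing s {x} {y} {z} {w} x<y z<y (p , q , xy , yw , c) (p′ , q′ , zy , yw′ , c′) h₁ h₂
    with Lt-functional yw yw′ | ℕₚ.<-cmp x z
  no-crossing Sign.+ x<y z<y (p , q , xy , yw , c) (p′ , _ , zy , _ , c′) h₁ h₂ | refl | tri≈ _ refl _
    with Lt-functional xy zy
  ... | refl = ℕₚ.<-asym c c′
  no-crossing Sign.- x<y z<y (p , q , xy , yw , c) (p′ , _ , zy , _ , c′) h₁ h₂ | refl | tri≈ _ refl _
    with Lt-functional xy zy
  ... | refl = ℕₚ.<-asym c c′
  no-crossing Sign.+ x<y z<y (p , q , xy , yw , c) (p′ , _ , zy , _ , c′) h₁ h₂ | refl | tri< x<z _ _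
    with h₁ x<z
  ... | m , _ , xz , zy′ , m> with Lt-functional zy zy′
  ... | refl with proj₂ (compare-max xz zy xy) m>
  ... | refl = ℕₚ.<-asym (ℕₚ.<-trans c c′) m>
  no-crossing Sign.- x<y z<y (p , q , xy , yw , c) (p′ , _ , zy , _ , c′) h₁ h₂ | refl | tri< x<z _ _
    with h₁ x<z
  ... | m , _ , xz , zy′ , m< with Lt-functional zy zy′
  ... | refl with proj₁ (compare-max xz zy xy) m<
  ... | refl = ℕₚ.<-asym c c′
  no-crossing Sign.+ x<y z<y (p , q , xy , yw , c) (p′ , _ , zy , _ , c′) h₁ h₂ | refl | tri> _ _ z<x
    with h₂ z<x
  ... | m , _ , zx , xy′ , m< with Lt-functional xy xy′
  ... | refl with proj₁ (compare-max zx xy zy) m<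
  ... | refl = ℕₚ.<-asym c c′
  no-crossing Sign.- x<y z<y (p , q , xy , yw , c) (p′ , _ , zy , _ , c′) h₁ h₂ | refl | tri> _ _ z<x
    with h₂ z<x
  ... | m , _ , zx , xy′ , m> with Lt-functional xy xy′
  ... | refl with proj₂ (compare-max zx xy zy) m>
  ... | refl = ℕₚ.<-asym (ℕₚ.<-trans c′ c) m>

  record HalfWithoutPeaks s {l} (ws : List (Word l)) : Set where
    field
      {level}     : ℕ
      level≤      : level ≤ l
      {half}      : List (Word level)
      homogeneous : HomogeneousWords s half
      decreasing  : Decreasing half
      noPeak      : NoPeak half
      long        : length ws ≤ length half + length half

  -- At the topmost branching, a word of one half differs from all words of the other at the level
  -- l, which exceeds every level inside that half. This is the column w that `no-crossing` asks
  -- for. Keeping the larger half costs a factor of at most 2.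
  half-without-peaks : ∀ s {l} {ws : List (Word l)} → Decreasing ws → HomogeneousWords s ws →
    HalfWithoutPeaks s ws
  half-without-peaks s {zero} {ws} dec hom = record { level≤ = ℕₚ.≤-refl ; homogeneous = hom ; decreasing = dec
    ; noPeak = λ { {[]} {[]} _ _ _ _ () } ; long = ℕₚ.m≤m+n _ _ }
  half-without-peaks s {suc l} {ws} dec hom = go (halves dec)
    where
    go : Halves ws → HalfWithoutPeaks s ws
    go h@record { upper = us ; lower = [] } =
      let open Halves h
          open HalfWithoutPeaks (half-without-peaks s upper-decreasing
            (λ a∈ b∈ c∈ d∈ p q r → hom (upper∈ a∈) (upper∈ b∈) (upper∈ c∈) (upper∈ d∈)
              (there p) (there q) (there r)))
      in record { level≤ = ℕₚ.m≤n⇒m≤1+n level≤ ; homogeneous = homogeneous ; decreasing = decreasing ; noPeak = noPeak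
                ; long = ℕₚ.≤-trans (ℕₚ.≤-reflexive (trans length-halves (ℕₚ.+-identityʳ _))) long }
    go h@record { upper = [] ; lower = _ ∷ _ } =
      let open Halves h
          open HalfWithoutPeaks (half-without-peaks s lower-decreasing
            (λ a∈ b∈ c∈ d∈ p q r → hom (lower∈ a∈) (lower∈ b∈) (lower∈ c∈) (lower∈ d∈)
              (there p) (there q) (there r)))
      in record { level≤ = ℕₚ.m≤n⇒m≤1+n level≤ ; homogeneous = homogeneous ; decreasing = decreasing ; noPeak = noPeak
                ; long = ℕₚ.≤-trans (ℕₚ.≤-reflexive length-halves) long }
    go h@record { upper = u ∷ us ; lower = v ∷ vs }
      with ℕₚ.≤-total (length (u ∷ us)) (length (v ∷ vs))
    ... | inj₁ us≤vs =
      let open Halves h in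
      record
        { level≤ = ℕₚ.n≤1+n l
        ; homogeneous = λ a∈ b∈ c∈ d∈ p q r → hom (lower∈ a∈) (lower∈ b∈) (lower∈ c∈) (lower∈ d∈)
            (there p) (there q) (there r)
        ; decreasing = lower-decreasing
        -- The quadruple a, b, c, u has the levels i, j, l, and b, c, d, u has j, k, l; both end in
        -- the common column l.
        ; noPeak = λ a∈ b∈ c∈ d∈ p q r i<j k<j → no-crossing s i<j k<j
            (hom (lower∈ a∈) (lower∈ b∈) (lower∈ c∈) (upper∈ (here refl)) (there p) (there q) here
              ijk i<j (Lt-level q))
            (hom (lower∈ b∈) (lower∈ c∈) (lower∈ d∈) (upper∈ (here refl)) (there q) (there r) here
              jik k<j (Lt-level q))
            (λ i<k → hom (lower∈ a∈) (lower∈ b∈) (lower∈ c∈) (lower∈ d∈) (there p) (there q) (there r)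
              ikj i<k k<j)
            (λ k<i → hom (lower∈ a∈) (lower∈ b∈) (lower∈ c∈) (lower∈ d∈) (there p) (there q) (there r)
              kij k<i i<j)
        ; long = ℕₚ.≤-trans (ℕₚ.≤-reflexive length-halves) (ℕₚ.+-monoˡ-≤ (length lower) us≤vs) }
    ... | inj₂ vs≤us =
      let open Halves h in
      record
        { level≤ = ℕₚ.n≤1+n l
        ; homogeneous = λ a∈ b∈ c∈ d∈ p q r → hom (upper∈ a∈) (upper∈ b∈) (upper∈ c∈) (upper∈ d∈)
            (there p) (there q) (there r)
        ; decreasing = upper-decreasing
        ; noPeak = λ a∈ b∈ c∈ d∈ p q r i<j k<j → no-crossing s i<j k<j
            (hom (lower∈ (here refl)) (upper∈ a∈) (upper∈ b∈) (upper∈ c∈) here (there p) (there q)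
              jki i<j (Lt-level q))
            (hom (lower∈ (here refl)) (upper∈ b∈) (upper∈ c∈) (upper∈ d∈) here (there q) (there r)
              kji k<j (Lt-level q))
            (λ i<k → hom (upper∈ a∈) (upper∈ b∈) (upper∈ c∈) (upper∈ d∈) (there p) (there q) (there r)
              ikj i<k k<j)
            (λ k<i → hom (upper∈ a∈) (upper∈ b∈) (upper∈ c∈) (upper∈ d∈) (there p) (there q) (there r)
              kij k<i i<j)
        ; long = ℕₚ.≤-trans (ℕₚ.≤-reflexive length-halves) (ℕₚ.+-monoʳ-≤ (length upper) vs≤us) }

  HomogeneousTriples : Sign → ∀ {l} → List (Word l) → Set
  HomogeneousTriples s ws = ∀ {a b c d e} → a ∈ ws → b ∈ ws → c ∈ ws →
    Lt a b d → Lt b c e → Compare s d e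

  -- At a branching, two words above it would give a triple of sign - and two words below it a
  -- triple of sign +. So one side, determined by s, has at most one word, and each level
  -- contributes at most one word.
  few-homogeneous-triples : ∀ s {l} {ws : List (Word l)} → Decreasing ws → HomogeneousTriples s ws →
    length ws ≤ suc l
  few-homogeneous-triples s {zero} dec _ = decreasing₀ dec
  few-homogeneous-triples s {suc l} {ws} dec hom = subst (_≤ suc (suc l)) (sym (Halves.length-halves (halves dec)))
    (go s hom (halves dec))
    where
    go : ∀ s → HomogeneousTriples s ws → (h : Halves ws) →
      length (Halves.upper h) + length (Halves.lower h) ≤ suc (suc l)
    go s hom h@record { upper = us ; lower = [] } =
      let open Halves h in
      ℕₚ.≤-trans (ℕₚ.≤-reflexive (ℕₚ.+-identityʳ _)) (ℕₚ.m≤n⇒m≤1+n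
        (few-homogeneous-triples s upper-decreasing λ a∈ b∈ c∈ p q →
          hom (upper∈ a∈) (upper∈ b∈) (upper∈ c∈) (there p) (there q)))
    go s hom h@record { upper = [] ; lower = vs } =
      let open Halves h in
      ℕₚ.m≤n⇒m≤1+n (few-homogeneous-triples s lower-decreasing λ a∈ b∈ c∈ p q →
        hom (lower∈ a∈) (lower∈ b∈) (lower∈ c∈) (there p) (there q))
    go s hom h@record { upper = u ∷ [] ; lower = v ∷ vs } =
      let open Halves h in
      s≤s (few-homogeneous-triples s lower-decreasing λ a∈ b∈ c∈ p q →
        hom (lower∈ a∈) (lower∈ b∈) (lower∈ c∈) (there p) (there q))
    go s hom h@record { upper = us ; lower = v ∷ [] } =
      let open Halves h in
      ℕₚ.≤-trans (ℕₚ.≤-reflexive (ℕₚ.+-comm _ 1)) (s≤s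
        (few-homogeneous-triples s upper-decreasing λ a∈ b∈ c∈ p q →
          hom (upper∈ a∈) (upper∈ b∈) (upper∈ c∈) (there p) (there q)))
    go Sign.+ hom h@record { upper = u ∷ u′ ∷ us ; lower = v ∷ _ ; upper-decreasing = ((_ , u′<u) ∷ _) ∷ _ } =
      let open Halves h in
      ⊥-elim (ℕₚ.<-asym (Lt-level u′<u)
        (hom (lower∈ (here refl)) (upper∈ (there (here refl))) (upper∈ (here refl)) here (there u′<u)))
    go Sign.- hom h@record { upper = u ∷ _ ; lower = v ∷ v′ ∷ vs ; lower-decreasing = ((_ , v′<v) ∷ _) ∷ _ } =
      let open Halves h in
      ⊥-elim (ℕₚ.<-asym (Lt-level v′<v)
        (hom (lower∈ (there (here refl))) (lower∈ (here refl)) (upper∈ (here refl)) (there v′<v) here))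

  -- The levels of the long words are themselves indices of planar points. Read as words of length
  -- r, they form a homogeneous family one exponential further down.
  few-indices : ∀ s {ds} → AllPairs (flip _<_) ds → All (_< 2 ^ r) ds →
    AllTriples (λ d e f → Orientation s f e d) ds → length ds ≤ suc r
  few-indices s {ds} dec bounded triples = subst (_≤ suc r) (Listₚ.length-map (word r) ds)
    (few-homogeneous-triples s words-decreasing λ a∈ b∈ c∈ p q →
      let _ , _ , p′ , q′ , cmp = AllTriples-∈ ≻-asym words-decreasing word-triples c∈ b∈ a∈ (_ , q) (_ , p)
      in subst₂ (Compare s) (Lt-functional p′ p) (Lt-functional q′ q) cmp)
    where
    words-decreasing : Decreasing (map (word r) ds)
    words-decreasing = AllPairsₚ.map⁺ (go dec bounded)
      where
      go : ∀ {ds} → AllPairs (flip _<_) ds → All (_< 2 ^ r) ds → AllPairs (λ d e → word r d ≻ word r e) ds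
      go []         []       = []
      go (ps ∷ pss) (b ∷ bs) = All.map (λ e<d → word-< r e<d b) ps ∷ go pss bs
    word-triples : AllTriples (λ a b c → ∃₂ λ d e → Lt c b d × Lt b a e × Compare s d e) (map (word r) ds)
    word-triples = AllTriples-map⁺ (word r) triples

  -- The kept half has at most 1 + (r + 1) + (r + 1) words: one for the bottom of the valley and r +
  -- 1 levels for each of its sides. The discarded half at most doubles this.
  few-homogeneous-words : ∀ s {ws : List (Word (2 ^ r))} → Decreasing ws → HomogeneousWords s ws →
    length ws ≤ 6 + 4 * r
  few-homogeneous-words s {ws} dec hom = go (half-without-peaks s dec hom)
    where
    open ℕₚ.≤-Reasoning
    go : HalfWithoutPeaks s ws → length ws ≤ 6 + 4 * r
    go record { half = [] ; long = long } = ℕₚ.≤-trans long z≤n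
    go record { level≤ = level≤ ; half = half@(_ ∷ _) ; homogeneous = homogeneous ; decreasing = decreasing
              ; noPeak = noPeak ; long = long₁ } = begin
      length ws                              ≤⟨ long₁ ⟩
      length half + length half              ≤⟨ ℕₚ.+-mono-≤ half≤ half≤ ⟩
      (3 + (r + r)) + (3 + (r + r))          ≡⟨ arithmetic r ⟩
      6 + 4 * r                              ∎
      where
      arithmetic : ∀ n → (3 + (n + n)) + (3 + (n + n)) ≡ 6 + 4 * n
      arithmetic = solve 1 (λ n → ((con 3 :+ (n :+ n)) :+ (con 3 :+ (n :+ n))) := (con 6 :+ con 4 :* n)) refl
        where open +-*-Solver
      open Valley (valley decreasing noPeak)
      levels : ∀ {x y : Word _} {d} → Lt x y d → d < 2 ^ r
      levels p = ℕₚ.<-≤-trans (Lt-level p) level≤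
      ds≤ : length ds ≤ suc r
      ds≤ = few-indices s (comb-decreasing descent) (comb-All descent (λ _ _ → levels))
        (comb-AllTriples descent λ x∈ y∈ z∈ w∈ p q r e<d f<e →
          homogeneous (All.lookup xs⊆ w∈) (All.lookup xs⊆ z∈) (All.lookup xs⊆ y∈) (All.lookup xs⊆ x∈)
            r q p ijk f<e e<d)
      es≤ : length es ≤ suc r
      -- Along the ascent the levels decrease from left to right; sorting the three columns is the
      -- odd permutation `kji` and flips the sign.
      es≤ = few-indices (Sign.- Sign.* s) (comb-decreasing ascent) (comb-All ascent (λ _ _ → levels))
        (comb-AllTriples ascent λ x∈ y∈ z∈ w∈ p q r e<d f<e →
          homogeneous (All.lookup ys⊆ x∈) (All.lookup ys⊆ y∈) (All.lookup ys⊆ z∈) (All.lookup ys⊆ w∈)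
            p q r kji f<e e<d)
      half≤ : length half ≤ 3 + (r + r)
      half≤ = ℕₚ.≤-trans long (s≤s (ℕₚ.≤-trans (ℕₚ.+-mono-≤ ds≤ es≤)
        (ℕₚ.≤-reflexive (cong suc (ℕₚ.+-suc r r)))))

-- Asymptotics in an integer base

ℤ-ring : AlmostCommutativeRing 0ℓ 0ℓ
ℤ-ring = fromCommutativeRing ℤₚ.+-*-commutativeRing (λ i → dec⇒maybe (0ℤ ℤₚ.≟ i))

module ℤ-Solver = RingSolver ℤ-ring

HasSignℤ : Sign → ℤ → Set
HasSignℤ Sign.+ i = 0ℤ ℤ.< i
HasSignℤ Sign.- i = i ℤ.< 0ℤ

HasSignℤ-neg : ∀ {s i} → HasSignℤ s i → HasSignℤ (Sign.- Sign.* s) (ℤ.- i)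
HasSignℤ-neg {Sign.+} = ℤₚ.neg-mono-<
HasSignℤ-neg {Sign.-} = ℤₚ.neg-mono-<

HasSignℤ-unique : ∀ {s t i} → HasSignℤ s i → HasSignℤ t i → s ≡ t
HasSignℤ-unique {Sign.+} {Sign.+} _ _ = refl
HasSignℤ-unique {Sign.-} {Sign.-} _ _ = refl
HasSignℤ-unique {Sign.+} {Sign.-} p q = ⊥-elim (ℤₚ.<-asym p q)
HasSignℤ-unique {Sign.-} {Sign.+} p q = ⊥-elim (ℤₚ.<-asym p q)

pow : ℕ → ℕ → ℤ
pow t d = ℤ.+ (suc t ^ d)

-- f t = c b^(d+1) + O(b^d) for the base b = t + 1; c = 0 is allowed.
record Leading (d : ℕ) (c : ℤ) (f : ℕ → ℤ) : Set where
  constructor leads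
  field
    C     : ℕ
    error : ∀ t → ℤ.∣ f t ℤ.- c ℤ.* pow t (suc d) ∣ ≤ C * suc t ^ d

leading-cong : ∀ {d c f g} → (∀ t → f t ≡ g t) → Leading d c f → Leading d c g
leading-cong {d} {c} f≗g (leads C h) = leads C λ t →
  subst (λ x → ℤ.∣ x ℤ.- c ℤ.* pow t (suc d) ∣ ≤ C * suc t ^ d) (f≗g t) (h t)

module _ where
  open ℤ-Solver
  open ℕₚ.≤-Reasoning

  private
    infixl 6 _⊝_
    _⊝_ : ∀ {n} → Expr ℤ n → Expr ℤ n → Expr ℤ n
    x ⊝ y = x ⊕ ⊝ y

  leading-+ : ∀ {d c c′ f g} → Leading d c f → Leading d c′ g → Leading d (c ℤ.+ c′) (λ t → f t ℤ.+ g t)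
  leading-+ {d} {c} {c′} {f} {g} (leads C h) (leads C′ h′) = leads (C + C′) λ t → begin
    ℤ.∣ (f t ℤ.+ g t) ℤ.- (c ℤ.+ c′) ℤ.* pow t (suc d) ∣
      ≡⟨ cong ℤ.∣_∣ (regroup (f t) (g t) c c′ (pow t (suc d))) ⟩
    ℤ.∣ (f t ℤ.- c ℤ.* pow t (suc d)) ℤ.+ (g t ℤ.- c′ ℤ.* pow t (suc d)) ∣
      ≤⟨ ℤₚ.∣i+j∣≤∣i∣+∣j∣ (f t ℤ.- c ℤ.* pow t (suc d)) _ ⟩
    ℤ.∣ f t ℤ.- c ℤ.* pow t (suc d) ∣ + ℤ.∣ g t ℤ.- c′ ℤ.* pow t (suc d) ∣
      ≤⟨ ℕₚ.+-mono-≤ (h t) (h′ t) ⟩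
    C * suc t ^ d + C′ * suc t ^ d
      ≡⟨ ℕₚ.*-distribʳ-+ (suc t ^ d) C C′ ⟨
    (C + C′) * suc t ^ d ∎
    where
    regroup : ∀ x y c c′ p → (x ℤ.+ y) ℤ.- (c ℤ.+ c′) ℤ.* p ≡ (x ℤ.- c ℤ.* p) ℤ.+ (y ℤ.- c′ ℤ.* p)
    regroup = solve 5 (λ x y c c′ p →
      ((x ⊕ y) ⊝ (c ⊕ c′) ⊗ p) ⊜ ((x ⊝ c ⊗ p) ⊕ (y ⊝ c′ ⊗ p))) refl

  leading-neg : ∀ {d c f} → Leading d c f → Leading d (ℤ.- c) (λ t → ℤ.- f t)
  leading-neg {d} {c} {f} (leads C h) = leads C λ t → subst (_≤ C * suc t ^ d)
    (trans (sym (ℤₚ.∣-i∣≡∣i∣ (f t ℤ.- c ℤ.* pow t (suc d)))) (cong ℤ.∣_∣ (negate (f t) c (pow t (suc d))))) (h t)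
    where
    negate : ∀ x c p → ℤ.- (x ℤ.- c ℤ.* p) ≡ (ℤ.- x) ℤ.- (ℤ.- c) ℤ.* p
    negate = solve 3 (λ x c p → (⊝ (x ⊝ c ⊗ p)) ⊜ ((⊝ x) ⊝ (⊝ c) ⊗ p)) refl

  private
    leading⇒bounded : ∀ {d c f} (F : Leading d c f) t → ℤ.∣ f t ∣ ≤ (Leading.C F + ℤ.∣ c ∣) * suc t ^ suc d
    leading⇒bounded {d} {c} {f} (leads C h) t = begin
      ℤ.∣ f t ∣
        ≡⟨ cong ℤ.∣_∣ (split (f t) (c ℤ.* p)) ⟩
      ℤ.∣ (f t ℤ.- c ℤ.* p) ℤ.+ c ℤ.* p ∣
        ≤⟨ ℤₚ.∣i+j∣≤∣i∣+∣j∣ (f t ℤ.- c ℤ.* p) (c ℤ.* p) ⟩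
      ℤ.∣ f t ℤ.- c ℤ.* p ∣ + ℤ.∣ c ℤ.* p ∣
        ≤⟨ ℕₚ.+-mono-≤ (h t) (ℕₚ.≤-reflexive (ℤₚ.abs-* c p)) ⟩
      C * suc t ^ d + ℤ.∣ c ∣ * suc t ^ suc d
        ≤⟨ ℕₚ.+-monoˡ-≤ _ (ℕₚ.*-monoʳ-≤ C (ℕₚ.^-monoʳ-≤ (suc t) (ℕₚ.n≤1+n d))) ⟩
      C * suc t ^ suc d + ℤ.∣ c ∣ * suc t ^ suc d
        ≡⟨ ℕₚ.*-distribʳ-+ (suc t ^ suc d) C ℤ.∣ c ∣ ⟨
      (C + ℤ.∣ c ∣) * suc t ^ suc d ∎
      where
      p = pow t (suc d)
      split : ∀ x y → x ≡ (x ℤ.- y) ℤ.+ y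
      split = solve 2 (λ x y → x ⊜ ((x ⊝ y) ⊕ y)) refl

  -- The exponent of the main term is one more than the index, so the indices d and e combine to d +
  -- e + 1.
  leading-* : ∀ {d e c c′ f g} → Leading d c f → Leading e c′ g →
    Leading (d + suc e) (c ℤ.* c′) (λ t → f t ℤ.* g t)
  leading-* {d} {e} {c} {c′} {f} {g} (leads C h) G@(leads C′ h′) = leads (C * B + ℤ.∣ c ∣ * C′) bound
    where
    B = C′ + ℤ.∣ c′ ∣
    regroup : ∀ x y c c′ p q → x ℤ.* y ℤ.- c ℤ.* c′ ℤ.* (p ℤ.* q) ≡
      (x ℤ.- c ℤ.* p) ℤ.* y ℤ.+ c ℤ.* p ℤ.* (y ℤ.- c′ ℤ.* q)
    regroup = solve 6 (λ x y c c′ p q → (x ⊗ y ⊝ c ⊗ c′ ⊗ (p ⊗ q)) ⊜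
      ((x ⊝ c ⊗ p) ⊗ y ⊕ c ⊗ p ⊗ (y ⊝ c′ ⊗ q))) refl
    shuffle : ∀ C B x b y c C′ →
      (C * x) * (B * (b * y)) + (c * (b * x)) * (C′ * y) ≡ (C * B + c * C′) * (x * (b * y))
    shuffle = +-*-Solver.solve 7 (λ C B x b y c C′ →
      ((C :* x) :* (B :* (b :* y)) :+ (c :* (b :* x)) :* (C′ :* y)) :=
      ((C :* B :+ c :* C′) :* (x :* (b :* y)))) refl
      where open +-*-Solver using (_:+_; _:*_; _:=_)
    bound : ∀ t → ℤ.∣ f t ℤ.* g t ℤ.- c ℤ.* c′ ℤ.* pow t (suc (d + suc e)) ∣ ≤
      (C * B + ℤ.∣ c ∣ * C′) * suc t ^ (d + suc e)
    bound t = begin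
      ℤ.∣ f t ℤ.* g t ℤ.- c ℤ.* c′ ℤ.* pow t (suc (d + suc e)) ∣
        ≡⟨ cong (λ z → ℤ.∣ f t ℤ.* g t ℤ.- c ℤ.* c′ ℤ.* z ∣)
             (trans (cong ℤ.+_ (ℕₚ.^-distribˡ-+-* b (suc d) (suc e))) (ℤₚ.pos-* (b ^ suc d) (b ^ suc e))) ⟩
      ℤ.∣ f t ℤ.* g t ℤ.- c ℤ.* c′ ℤ.* (p ℤ.* q) ∣
        ≡⟨ cong ℤ.∣_∣ (regroup (f t) (g t) c c′ p q) ⟩
      ℤ.∣ (f t ℤ.- c ℤ.* p) ℤ.* g t ℤ.+ c ℤ.* p ℤ.* (g t ℤ.- c′ ℤ.* q) ∣
        ≤⟨ ℤₚ.∣i+j∣≤∣i∣+∣j∣ ((f t ℤ.- c ℤ.* p) ℤ.* g t) _ ⟩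
      ℤ.∣ (f t ℤ.- c ℤ.* p) ℤ.* g t ∣ + ℤ.∣ c ℤ.* p ℤ.* (g t ℤ.- c′ ℤ.* q) ∣
        ≡⟨ cong₂ _+_ (ℤₚ.abs-* (f t ℤ.- c ℤ.* p) (g t))
             (trans (ℤₚ.abs-* (c ℤ.* p) _) (cong (_* ℤ.∣ g t ℤ.- c′ ℤ.* q ∣) (ℤₚ.abs-* c p))) ⟩
      ℤ.∣ f t ℤ.- c ℤ.* p ∣ * ℤ.∣ g t ∣ + (ℤ.∣ c ∣ * b ^ suc d) * ℤ.∣ g t ℤ.- c′ ℤ.* q ∣
        ≤⟨ ℕₚ.+-mono-≤ (ℕₚ.*-mono-≤ (h t) (leading⇒bounded G t)) (ℕₚ.*-monoʳ-≤ (ℤ.∣ c ∣ * b ^ suc d) (h′ t)) ⟩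
      (C * b ^ d) * (B * b ^ suc e) + (ℤ.∣ c ∣ * b ^ suc d) * (C′ * b ^ e)
        ≡⟨ shuffle C B (b ^ d) b (b ^ e) ℤ.∣ c ∣ C′ ⟩
      (C * B + ℤ.∣ c ∣ * C′) * (b ^ d * b ^ suc e)
        ≡⟨ cong ((C * B + ℤ.∣ c ∣ * C′) *_) (ℕₚ.^-distribˡ-+-* b d (suc e)) ⟨
      (C * B + ℤ.∣ c ∣ * C′) * b ^ (d + suc e) ∎
      where
      b = suc t
      p = pow t (suc d)
      q = pow t (suc e)

  private
    i≤∣i∣ : ∀ i → i ℤ.≤ ℤ.+ ℤ.∣ i ∣
    i≤∣i∣ (ℤ.+ n)     = ℤₚ.≤-refl
    i≤∣i∣ ℤ.-[1+ n ] = ℤ.-≤+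

    near-positive : ∀ {x y n} → ℤ.∣ x ℤ.- y ∣ < n → ℤ.+ n ℤ.≤ y → 0ℤ ℤ.< x
    near-positive {x} {y} {n} x≈y n≤y = ℤₚ.≰⇒> λ x≤0 → ℤₚ.<⇒≱ (ℤ.+<+ x≈y) (ℤₚ.≤-trans n≤y
      (ℤₚ.≤-trans (subst₂ ℤ._≤_ (ℤₚ.+-identityʳ y) refl (ℤₚ.+-monoʳ-≤ y (ℤₚ.neg-mono-≤ x≤0)))
        (subst (y ℤ.- x ℤ.≤_) (cong ℤ.+_ (ℤₚ.∣i-j∣≡∣j-i∣ y x)) (i≤∣i∣ (y ℤ.- x)))))

  -- As c ≥ 1, the error C b^d is smaller than the main term as soon as b > C.
  leading⇒eventually-positive : ∀ {d c f} → 0ℤ ℤ.< c → Leading d c f → Eventually (λ t → 0ℤ ℤ.< f t)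
  leading⇒eventually-positive {d} {ℤ.+ suc c} {f} (ℤ.+<+ _) (leads C h) = C , λ t C≤t →
    near-positive {f t} {ℤ.+ suc c ℤ.* pow t (suc d)} {suc t ^ suc d}
      (ℕₚ.≤-<-trans (h t) (ℕₚ.*-monoˡ-< (suc t ^ d) {{ℕₚ.m^n≢0 (suc t) d}} (s≤s C≤t)))
      (subst (pow t (suc d) ℤ.≤_) (ℤₚ.pos-* (suc c) (suc t ^ suc d))
        (ℤ.+≤+ (ℕₚ.m≤m+n (suc t ^ suc d) (c * suc t ^ suc d))))

  leading⇒eventually-sign : ∀ s {d c f} → HasSignℤ s c → Leading d c f → Eventually (λ t → HasSignℤ s (f t))
  leading⇒eventually-sign Sign.+ = leading⇒eventually-positive
  leading⇒eventually-sign Sign.- {f = f} c<0 lead =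
    let K , pos = leading⇒eventually-positive (ℤₚ.neg-mono-< c<0) (leading-neg lead)
    in K , λ t K≤t → subst (ℤ._< 0ℤ) (ℤₚ.neg-involutive (f t)) (ℤₚ.neg-mono-< (pos t K≤t))

-- Determinants and digit sums over the integers

Vectorℤ : Set
Vectorℤ = Fin 3 → ℤ

detℤ : (u v w : Vectorℤ) → ℤ
detℤ u v w =
    u 0F ℤ.* (v 1F ℤ.* w 2F ℤ.- w 1F ℤ.* v 2F)
  ℤ.- v 0F ℤ.* (u 1F ℤ.* w 2F ℤ.- w 1F ℤ.* u 2F)
  ℤ.+ w 0F ℤ.* (u 1F ℤ.* v 2F ℤ.- v 1F ℤ.* u 2F)

orientℤ : (a b c d : Vectorℤ) → ℤ
orientℤ a b c d = detℤ (λ i → b i ℤ.- a i) (λ i → c i ℤ.- a i) (λ i → d i ℤ.- a i)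

module ExprDet where
  open ℤ-Solver
  VectorE : ℕ → Set
  VectorE n = Expr ℤ n × Expr ℤ n × Expr ℤ n

  infixl 6 _⊝_ _⊖′_
  _⊝_ : ∀ {n} → Expr ℤ n → Expr ℤ n → Expr ℤ n
  x ⊝ y = x ⊕ ⊝ y

  _⊖′_ : ∀ {n} → VectorE n → VectorE n → VectorE n
  (u₀ , u₁ , u₂) ⊖′ (v₀ , v₁ , v₂) = u₀ ⊝ v₀ , u₁ ⊝ v₁ , u₂ ⊝ v₂

  columns : ∀ {n} {A : Set} → (VectorE n → VectorE n → VectorE n → A) →
    (u₀ u₁ u₂ v₀ v₁ v₂ w₀ w₁ w₂ : Expr ℤ n) → A
  columns f u₀ u₁ u₂ v₀ v₁ v₂ w₀ w₁ w₂ = f (u₀ , u₁ , u₂) (v₀ , v₁ , v₂) (w₀ , w₁ , w₂)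

  det″ : ∀ {n} (u v w : VectorE n) → Expr ℤ n
  det″ (u₀ , u₁ , u₂) (v₀ , v₁ , v₂) (w₀ , w₁ , w₂) =
    u₀ ⊗ (v₁ ⊗ w₂ ⊝ w₁ ⊗ v₂) ⊝ v₀ ⊗ (u₁ ⊗ w₂ ⊝ w₁ ⊗ u₂) ⊕ w₀ ⊗ (u₁ ⊗ v₂ ⊝ v₁ ⊗ u₂)

  orient″ : ∀ {n} (a b c d : VectorE n) → Expr ℤ n
  orient″ a b c d = det″ (b ⊖′ a) (c ⊖′ a) (d ⊖′ a)

module _ where
  open ℤ-Solver
  open ExprDet

  module _ (u v w : Vectorℤ) where
    det-vwu : detℤ v w u ≡ detℤ u v w
    det-vwu = solve 9 (columns λ u v w → det″ v w u ⊜ det″ u v w) refl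
      (u 0F) (u 1F) (u 2F) (v 0F) (v 1F) (v 2F) (w 0F) (w 1F) (w 2F)

    det-wuv : detℤ w u v ≡ detℤ u v w
    det-wuv = solve 9 (columns λ u v w → det″ w u v ⊜ det″ u v w) refl
      (u 0F) (u 1F) (u 2F) (v 0F) (v 1F) (v 2F) (w 0F) (w 1F) (w 2F)

    det-vuw : detℤ v u w ≡ ℤ.- detℤ u v w
    det-vuw = solve 9 (columns λ u v w → det″ v u w ⊜ (⊝ det″ u v w)) refl
      (u 0F) (u 1F) (u 2F) (v 0F) (v 1F) (v 2F) (w 0F) (w 1F) (w 2F)

    det-uwv : detℤ u w v ≡ ℤ.- detℤ u v w
    det-uwv = solve 9 (columns λ u v w → det″ u w v ⊜ (⊝ det″ u v w)) refl
      (u 0F) (u 1F) (u 2F) (v 0F) (v 1F) (v 2F) (w 0F) (w 1F) (w 2F)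

    det-wvu : detℤ w v u ≡ ℤ.- detℤ u v w
    det-wvu = solve 9 (columns λ u v w → det″ w v u ⊜ (⊝ det″ u v w)) refl
      (u 0F) (u 1F) (u 2F) (v 0F) (v 1F) (v 2F) (w 0F) (w 1F) (w 2F)

    -- The order of the factors is that of the columns, so that the degrees of
    -- the three products agree definitionally.
    det-expand : detℤ u v w ≡
      u 0F ℤ.* (v 1F ℤ.* w 2F ℤ.- v 2F ℤ.* w 1F)
      ℤ.+ (u 1F ℤ.* (v 2F ℤ.* w 0F ℤ.- v 0F ℤ.* w 2F)
      ℤ.+ u 2F ℤ.* (v 0F ℤ.* w 1F ℤ.- v 1F ℤ.* w 0F))
    det-expand = solve 9 (columns λ { u@(u₀ , u₁ , u₂) v@(v₀ , v₁ , v₂) w@(w₀ , w₁ , w₂) →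
        det″ u v w ⊜ (u₀ ⊗ (v₁ ⊗ w₂ ⊝ v₂ ⊗ w₁) ⊕ (u₁ ⊗ (v₂ ⊗ w₀ ⊝ v₀ ⊗ w₂) ⊕ u₂ ⊗ (v₀ ⊗ w₁ ⊝ v₁ ⊗ w₀))) }) refl
      (u 0F) (u 1F) (u 2F) (v 0F) (v 1F) (v 2F) (w 0F) (w 1F) (w 2F)

  -- Column operations replace the differences from a by consecutive ones, whose leading terms
  -- `leading-weighted` provides.
  orient-consecutive : ∀ a b c d → orientℤ a b c d ≡
    detℤ (λ i → b i ℤ.- a i) (λ i → c i ℤ.- b i) (λ i → d i ℤ.- c i)
  orient-consecutive a b c d = solve 12 (λ a₀ a₁ a₂ b₀ b₁ b₂ c₀ c₁ c₂ d₀ d₁ d₂ →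
      let a = a₀ , a₁ , a₂ ; b = b₀ , b₁ , b₂ ; c = c₀ , c₁ , c₂ ; d = d₀ , d₁ , d₂ in
      orient″ a b c d ⊜ det″ (b ⊖′ a) (c ⊖′ b) (d ⊖′ c)) refl
    (a 0F) (a 1F) (a 2F) (b 0F) (b 1F) (b 2F) (c 0F) (c 1F) (c 2F) (d 0F) (d 1F) (d 2F)

  vandermonde : ∀ i j k l →
    let m = λ (x : ℤ) → λ { 0F → x ; 1F → x ℤ.* x ; 2F → x ℤ.* (x ℤ.* x) } in
    orientℤ (m i) (m j) (m k) (m l) ≡
      (j ℤ.- i) ℤ.* ((k ℤ.- i) ℤ.* ((l ℤ.- i) ℤ.* ((k ℤ.- j) ℤ.* ((l ℤ.- j) ℤ.* (l ℤ.- k)))))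
  vandermonde = solve 4 (λ i j k l →
      let m = λ x → (x , x ⊗ x , x ⊗ (x ⊗ x)) in
      orient″ (m i) (m j) (m k) (m l) ⊜
      ((j ⊝ i) ⊗ ((k ⊝ i) ⊗ ((l ⊝ i) ⊗ ((k ⊝ j) ⊗ ((l ⊝ j) ⊗ (l ⊝ k))))))) refl

leading-det : ∀ {d e f} {cu cv cw : Vectorℤ} {u v w : ℕ → Vectorℤ} →
  (∀ i → Leading d (cu i) (λ t → u t i)) → (∀ i → Leading e (cv i) (λ t → v t i)) →
  (∀ i → Leading f (cw i) (λ t → w t i)) →
  Leading (d + suc (e + suc f)) (detℤ cu cv cw) (λ t → detℤ (u t) (v t) (w t))
leading-det {cu = cu} {cv} {cw} {u} {v} {w} hu hv hw =
  leading-cong (λ t → sym (det-expand (u t) (v t) (w t)))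
    (subst (λ c → Leading _ c _) (sym (det-expand cu cv cw))
      (leading-+ (leading-* (hu 0F) (minor 1F 2F))
        (leading-+ (leading-* (hu 1F) (minor 2F 0F)) (leading-* (hu 2F) (minor 0F 1F)))))
  where
  minor : ∀ i j → Leading _ (cv i ℤ.* cw j ℤ.- cv j ℤ.* cw i) (λ t → v t i ℤ.* w t j ℤ.- v t j ℤ.* w t i)
  minor i j = leading-+ (leading-* (hv i) (hw j)) (leading-neg (leading-* (hv j) (hw i)))

-- The sum of `w j` times b^(j+1) over the levels j at which the word has the letter 1. The shift in
-- the exponent makes every such sum divisible by the base b = t + 1.
weighted : (ℕ → ℤ) → ℕ → ∀ {l} → Word l → ℤ
weighted w t []                = 0ℤ
weighted w t (false ∷ a)       = weighted w t a
weighted w t {suc l} (true ∷ a) = w l ℤ.* pow t (suc l) ℤ.+ weighted w t a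

weighted-bounded : ∀ w {l} (a : Word l) → ∃[ C ] ∀ t → ℤ.∣ weighted w t a ∣ ≤ C * suc t ^ l
weighted-bounded w [] = 0 , λ _ → z≤n
weighted-bounded w {suc l} (false ∷ a) with weighted-bounded w a
... | C , h = C , λ t → ℕₚ.≤-trans (h t) (ℕₚ.*-monoʳ-≤ C (ℕₚ.^-monoʳ-≤ (suc t) (ℕₚ.n≤1+n l)))
weighted-bounded w {suc l} (true ∷ a) with weighted-bounded w a
... | C , h = ℤ.∣ w l ∣ + C , λ t → begin
    ℤ.∣ w l ℤ.* pow t (suc l) ℤ.+ weighted w t a ∣
      ≤⟨ ℤₚ.∣i+j∣≤∣i∣+∣j∣ (w l ℤ.* pow t (suc l)) (weighted w t a) ⟩
    ℤ.∣ w l ℤ.* pow t (suc l) ∣ + ℤ.∣ weighted w t a ∣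
      ≤⟨ ℕₚ.+-mono-≤ (ℕₚ.≤-reflexive (ℤₚ.abs-* (w l) (pow t (suc l))))
           (ℕₚ.≤-trans (h t) (ℕₚ.*-monoʳ-≤ C (ℕₚ.^-monoʳ-≤ (suc t) (ℕₚ.n≤1+n l)))) ⟩
    ℤ.∣ w l ∣ * suc t ^ suc l + C * suc t ^ suc l
      ≡⟨ ℕₚ.*-distribʳ-+ (suc t ^ suc l) ℤ.∣ w l ∣ C ⟨
    (ℤ.∣ w l ∣ + C) * suc t ^ suc l ∎
  where open ℕₚ.≤-Reasoning

module _ (w : ℕ → ℤ) (m m′ : ℤ) where
  open ℤ-Solver
  open ExprDet using (_⊝_)
  open ℕₚ.≤-Reasoning

  -- Above level d the two words agree and cancel; at level d only b has the letter 1. The lower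
  -- levels and the offsets m, m′ are O(b^d).
  leading-weighted : ∀ {l d} {a b : Word l} → Lt a b d →
    Leading d (w d) (λ t → (weighted w t b ℤ.+ m′) ℤ.- (weighted w t a ℤ.+ m))
  leading-weighted {suc l} (here {a = a} {b}) with weighted-bounded w a | weighted-bounded w b
  ... | C , h | C′ , h′ = leads (C′ + ℤ.∣ m′ ∣ + (C + ℤ.∣ m ∣)) λ t → begin
    ℤ.∣ (w l ℤ.* pow t (suc l) ℤ.+ weighted w t b ℤ.+ m′) ℤ.- (weighted w t a ℤ.+ m) ℤ.- w l ℤ.* pow t (suc l) ∣
      ≡⟨ cong ℤ.∣_∣ (cancel (w l ℤ.* pow t (suc l)) (weighted w t b) m′ (weighted w t a) m) ⟩
    ℤ.∣ (weighted w t b ℤ.+ m′) ℤ.- (weighted w t a ℤ.+ m) ∣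
      ≤⟨ ℤₚ.∣i-j∣≤∣i∣+∣j∣ (weighted w t b ℤ.+ m′) (weighted w t a ℤ.+ m) ⟩
    ℤ.∣ weighted w t b ℤ.+ m′ ∣ + ℤ.∣ weighted w t a ℤ.+ m ∣
      ≤⟨ ℕₚ.+-mono-≤ (absorb t m′ (weighted w t b) {C′} (h′ t)) (absorb t m (weighted w t a) {C} (h t)) ⟩
    (C′ + ℤ.∣ m′ ∣) * suc t ^ l + (C + ℤ.∣ m ∣) * suc t ^ l
      ≡⟨ ℕₚ.*-distribʳ-+ (suc t ^ l) (C′ + ℤ.∣ m′ ∣) (C + ℤ.∣ m ∣) ⟨
    (C′ + ℤ.∣ m′ ∣ + (C + ℤ.∣ m ∣)) * suc t ^ l ∎
    where
    cancel : ∀ x b m′ a m → (x ℤ.+ b ℤ.+ m′) ℤ.- (a ℤ.+ m) ℤ.- x ≡ (b ℤ.+ m′) ℤ.- (a ℤ.+ m)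
    cancel = solve 5 (λ x b m′ a m → ((x ⊕ b ⊕ m′) ⊝ (a ⊕ m) ⊝ x) ⊜ ((b ⊕ m′) ⊝ (a ⊕ m))) refl
    absorb : ∀ t n x {C} → ℤ.∣ x ∣ ≤ C * suc t ^ l → ℤ.∣ x ℤ.+ n ∣ ≤ (C + ℤ.∣ n ∣) * suc t ^ l
    absorb t n x {C} x≤ = begin
      ℤ.∣ x ℤ.+ n ∣                              ≤⟨ ℤₚ.∣i+j∣≤∣i∣+∣j∣ x n ⟩
      ℤ.∣ x ∣ + ℤ.∣ n ∣                          ≤⟨ ℕₚ.+-mono-≤ x≤ (ℕₚ.m≤m*n ℤ.∣ n ∣ (suc t ^ l) {{ℕₚ.m^n≢0 (suc t) l}}) ⟩
      C * suc t ^ l + ℤ.∣ n ∣ * suc t ^ l        ≡⟨ ℕₚ.*-distribʳ-+ (suc t ^ l) C ℤ.∣ n ∣ ⟨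
      (C + ℤ.∣ n ∣) * suc t ^ l                  ∎
  leading-weighted (there {x = false} p) = leading-weighted p
  leading-weighted {suc l} (there {x = true} {a = a} {b} p) = leading-cong
    (λ t → sym (cancel (w l ℤ.* pow t (suc l)) (weighted w t b) m′ (weighted w t a) m)) (leading-weighted p)
    where
    cancel : ∀ x b m′ a m → (x ℤ.+ b ℤ.+ m′) ℤ.- (x ℤ.+ a ℤ.+ m) ≡ (b ℤ.+ m′) ℤ.- (a ℤ.+ m)
    cancel = solve 5 (λ x b m′ a m → ((x ⊕ b ⊕ m′) ⊝ (x ⊕ a ⊕ m)) ⊜ ((b ⊕ m′) ⊝ (a ⊕ m))) refl

-- Congruence modulo the base b = t + 1.
infix 4 _≡_[_]
record _≡_[_] (x y : ℤ) (t : ℕ) : Set where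
  constructor congruent
  field
    quotient : ℤ
    equation : x ≡ y ℤ.+ quotient ℤ.* ℤ.+ suc t

module _ where
  open ℤ-Solver
  open ExprDet using (_⊝_)

  mod-+ : ∀ {t x x′ y y′} → x ≡ x′ [ t ] → y ≡ y′ [ t ] → x ℤ.+ y ≡ x′ ℤ.+ y′ [ t ]
  mod-+ {t} {x′ = x} {y′ = y} (congruent p refl) (congruent q refl) = congruent (p ℤ.+ q) (solve 5 (λ x y p q b →
    ((x ⊕ p ⊗ b) ⊕ (y ⊕ q ⊗ b)) ⊜ ((x ⊕ y) ⊕ (p ⊕ q) ⊗ b)) refl x y p q (ℤ.+ suc t))

  mod-- : ∀ {t x x′ y y′} → x ≡ x′ [ t ] → y ≡ y′ [ t ] → x ℤ.- y ≡ x′ ℤ.- y′ [ t ]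
  mod-- {t} {x′ = x} {y′ = y} (congruent p refl) (congruent q refl) = congruent (p ℤ.- q) (solve 5 (λ x y p q b →
    ((x ⊕ p ⊗ b) ⊝ (y ⊕ q ⊗ b)) ⊜ ((x ⊝ y) ⊕ (p ⊝ q) ⊗ b)) refl x y p q (ℤ.+ suc t))

  mod-* : ∀ {t x x′ y y′} → x ≡ x′ [ t ] → y ≡ y′ [ t ] → x ℤ.* y ≡ x′ ℤ.* y′ [ t ]
  mod-* {t} {x′ = x} {y′ = y} (congruent p refl) (congruent q refl) = congruent (p ℤ.* y ℤ.+ x ℤ.* q ℤ.+ p ℤ.* q ℤ.* ℤ.+ suc t)
    (solve 5 (λ x y p q b → ((x ⊕ p ⊗ b) ⊗ (y ⊕ q ⊗ b)) ⊜ ((x ⊗ y) ⊕ (p ⊗ y ⊕ x ⊗ q ⊕ p ⊗ q ⊗ b) ⊗ b)) refl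
      x y p q (ℤ.+ suc t))

  mod-weighted : ∀ w t {l} (a : Word l) m → weighted w t a ℤ.+ m ≡ m [ t ]
  mod-weighted w t a m =
    let q , eq = go a in congruent q (trans (cong (ℤ._+ m) eq) (ℤₚ.+-comm (q ℤ.* ℤ.+ suc t) m))
    where
    go : ∀ {l} (a : Word l) → ∃[ q ] weighted w t a ≡ q ℤ.* ℤ.+ suc t
    go [] = 0ℤ , refl
    go (false ∷ a) = go a
    go {suc l} (true ∷ a) with go a
    ... | q , eq = w l ℤ.* pow t l ℤ.+ q , trans
      (cong₂ (λ x y → w l ℤ.* x ℤ.+ y) (ℤₚ.pos-* (suc t) (suc t ^ l)) eq)
      (solve 4 (λ w b p q → (w ⊗ (b ⊗ p) ⊕ q ⊗ b) ⊜ ((w ⊗ p ⊕ q) ⊗ b)) refl (w l) (ℤ.+ suc t) (pow t l) q)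

mod-det : ∀ {t} (u u′ v v′ w w′ : Vectorℤ) → (∀ i → u i ≡ u′ i [ t ]) → (∀ i → v i ≡ v′ i [ t ]) →
  (∀ i → w i ≡ w′ i [ t ]) → detℤ u v w ≡ detℤ u′ v′ w′ [ t ]
mod-det u u′ v v′ w w′ hu hv hw = mod-+ {x′ = term₁ ℤ.- term₂} {y′ = term₃}
  (mod-- {x′ = term₁} {y′ = term₂} (term u u′ v v′ w w′ hu hv hw) (term v v′ u u′ w w′ hv hu hw))
  (term w w′ u u′ v v′ hw hu hv)
  where
  term₁ = u′ 0F ℤ.* (v′ 1F ℤ.* w′ 2F ℤ.- w′ 1F ℤ.* v′ 2F)
  term₂ = v′ 0F ℤ.* (u′ 1F ℤ.* w′ 2F ℤ.- w′ 1F ℤ.* u′ 2F)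
  term₃ = w′ 0F ℤ.* (u′ 1F ℤ.* v′ 2F ℤ.- v′ 1F ℤ.* u′ 2F)
  term : ∀ {t} (u u′ v v′ w w′ : Vectorℤ) → (∀ i → u i ≡ u′ i [ t ]) → (∀ i → v i ≡ v′ i [ t ]) →
    (∀ i → w i ≡ w′ i [ t ]) →
    u 0F ℤ.* (v 1F ℤ.* w 2F ℤ.- w 1F ℤ.* v 2F) ≡ u′ 0F ℤ.* (v′ 1F ℤ.* w′ 2F ℤ.- w′ 1F ℤ.* v′ 2F) [ t ]
  term u u′ v v′ w w′ hu hv hw = mod-* {x′ = u′ 0F} {y′ = v′ 1F ℤ.* w′ 2F ℤ.- w′ 1F ℤ.* v′ 2F} (hu 0F)
    (mod-- {x′ = v′ 1F ℤ.* w′ 2F} {y′ = w′ 1F ℤ.* v′ 2F}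
      (mod-* {x′ = v′ 1F} {y′ = w′ 2F} (hv 1F) (hw 2F)) (mod-* {x′ = w′ 1F} {y′ = v′ 2F} (hw 1F) (hv 2F)))

-- A nonzero integer of absolute value at most t is no multiple of t + 1.
mod-nonzero : ∀ {t x y} → x ≡ y [ t ] → y ≢ 0ℤ → ℤ.∣ y ∣ ≤ t → x ≢ 0ℤ
mod-nonzero {t} {x} {y} (congruent q eq) y≢0 ∣y∣≤t x≡0 = ℕₚ.<⇒≱ (s≤s ∣y∣≤t) (multiple ℤ.∣ q ∣ refl)
  where
  open ℤ-Solver
  y≡ : y ≡ ℤ.- (q ℤ.* ℤ.+ suc t)
  y≡ = trans (solve 2 (λ y p → y ⊜ ((y ⊕ p) ⊕ ⊝ p)) refl y (q ℤ.* ℤ.+ suc t))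
    (trans (cong (ℤ._- q ℤ.* ℤ.+ suc t) (trans (sym eq) x≡0)) (ℤₚ.+-identityˡ _))
  ∣y∣≡ : ℤ.∣ y ∣ ≡ ℤ.∣ q ∣ * suc t
  ∣y∣≡ = trans (cong ℤ.∣_∣ y≡) (trans (ℤₚ.∣-i∣≡∣i∣ (q ℤ.* ℤ.+ suc t)) (ℤₚ.abs-* q (ℤ.+ suc t)))
  multiple : ∀ n → ℤ.∣ q ∣ ≡ n → suc t ≤ ℤ.∣ y ∣
  multiple zero    q≡ = ⊥-elim (y≢0 (ℤₚ.∣i∣≡0⇒i≡0 (trans ∣y∣≡ (cong (_* suc t) q≡))))
  multiple (suc n) q≡ = subst (suc t ≤_) (sym (trans ∣y∣≡ (cong (_* suc t) q≡))) (ℕₚ.m≤m+n (suc t) (n * suc t))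

-- The planar points and their orientations

module PlanarPoints (r : ℕ) where
  open Planar r

  -- Column (1, x, y) of the planar point with index i, for the base t + 1.
  column : ℕ → ℕ → Vectorℤ
  column t i 0F = 1ℤ
  -- The zero offsets give the coordinates the form that `leading-weighted` expects.
  column t i 1F = weighted (λ _ → 1ℤ) t (word r i) ℤ.+ 0ℤ
  column t i 2F = weighted ℤ.+_ t (word r i) ℤ.+ 0ℤ

  private
    det-columns : ∀ t i j k →
      (column t j 1F ℤ.- column t i 1F) ℤ.* (column t k 2F ℤ.- column t j 2F)
        ℤ.- (column t j 2F ℤ.- column t i 2F) ℤ.* (column t k 1F ℤ.- column t j 1F) ≡
      detℤ (column t i) (column t j) (column t k)
    det-columns t i j k = solve 6 (λ x₁ y₁ x₂ y₂ x₃ y₃ →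
        ((x₂ ⊝ x₁) ⊗ (y₃ ⊝ y₂) ⊝ (y₂ ⊝ y₁) ⊗ (x₃ ⊝ x₂)) ⊜
        det″ (Κ 1ℤ , x₁ , y₁) (Κ 1ℤ , x₂ , y₂) (Κ 1ℤ , x₃ , y₃)) refl
      (column t i 1F) (column t i 2F) (column t j 1F) (column t j 2F) (column t k 1F) (column t k 2F)
      where
      open ℤ-Solver
      open ExprDet

    -- The integer is the determinant of (1, d) and (1, e), the leading coefficient of the
    -- orientation of three planar points with first differences at d and e.
    compare⇒sign : ∀ s {d e} → Compare s d e → HasSignℤ s (1ℤ ℤ.* ℤ.+ e ℤ.- ℤ.+ d ℤ.* 1ℤ)
    compare⇒sign s {d} {e} h = subst (HasSignℤ s)
      (solve 2 (λ d e → (e ⊝ d) ⊜ (Κ 1ℤ ⊗ e ⊝ d ⊗ Κ 1ℤ)) refl (ℤ.+ d) (ℤ.+ e)) (difference s h)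
      where
      open ℤ-Solver
      open ExprDet using (_⊝_)
      difference : ∀ s → Compare s d e → HasSignℤ s (ℤ.+ e ℤ.- ℤ.+ d)
      difference Sign.+ d<e = subst (ℤ._< ℤ.+ e ℤ.- ℤ.+ d) (ℤₚ.+-inverseʳ (ℤ.+ d))
        (ℤₚ.+-monoˡ-< (ℤ.- ℤ.+ d) (ℤ.+<+ d<e))
      difference Sign.- e<d = subst (ℤ.+ e ℤ.- ℤ.+ d ℤ.<_) (ℤₚ.+-inverseʳ (ℤ.+ d))
        (ℤₚ.+-monoˡ-< (ℤ.- ℤ.+ d) (ℤ.+<+ e<d))

  Faithful : ℕ → (i j k : ℕ) → Set
  Faithful t i j k = ∃[ s ] HasSignℤ s (detℤ (column t i) (column t j) (column t k)) × Orientation s i j k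

  eventually-faithful : ∀ {i j k} → i < j → j < k → k < 2 ^ r → Eventually (λ t → Faithful t i j k)
  eventually-faithful {i} {j} {k} i<j j<k k< =
    let d , p = word-< r i<j (ℕₚ.<-trans j<k k<)
        e , q = word-< r j<k k<
        s , cmp = compare-sign (Lt-consecutive p q)
        K , h = leading⇒eventually-sign s (compare⇒sign s {d} {e} cmp)
          (leading-cong {d + suc e} (λ t → det-columns t i j k)
            (leading-+ (leading-* (leading-weighted (λ _ → 1ℤ) 0ℤ 0ℤ p) (leading-weighted ℤ.+_ 0ℤ 0ℤ q))
              (leading-neg (leading-* (leading-weighted ℤ.+_ 0ℤ 0ℤ p) (leading-weighted (λ _ → 1ℤ) 0ℤ 0ℤ q)))))
    in K , λ t K≤t → s , h t K≤t , d , e , p , q , cmp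

  faithful-base : ∃[ t ] ∀ {i j k} → i < j → j < k → k < 2 ^ r → Faithful t i j k
  faithful-base =
    let K , h = eventually-∀ λ (i : Fin (2 ^ r)) → eventually-∀ λ (j : Fin (2 ^ r)) →
          eventually-∀ λ (k : Fin (2 ^ r)) → eventually-→ (toℕ i ℕₚ.<? toℕ j) λ i<j →
          eventually-→ (toℕ j ℕₚ.<? toℕ k) λ j<k → eventually-faithful i<j j<k (Finₚ.toℕ<n k)
    in K , λ {i} {j} {k} i<j j<k k< →
      let j< = ℕₚ.<-trans j<k k<
          i< = ℕₚ.<-trans i<j j<
          eqᵢ = Finₚ.toℕ-fromℕ< i<
          eqⱼ = Finₚ.toℕ-fromℕ< j<
          eqₖ = Finₚ.toℕ-fromℕ< k<
      in subst (λ i → Faithful K i j k) eqᵢ (subst₂ (Faithful K _) eqⱼ eqₖ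
        (h K ℕₚ.≤-refl (Fin.fromℕ< i<) (Fin.fromℕ< j<) (Fin.fromℕ< k<)
          (subst₂ _<_ (sym eqᵢ) (sym eqⱼ) i<j) (subst₂ _<_ (sym eqⱼ) (sym eqₖ) j<k)))

  opaque
    base : ℕ
    base = proj₁ faithful-base

    base-faithful : ∀ {i j k} → i < j → j < k → k < 2 ^ r → Faithful base i j k
    base-faithful = proj₂ faithful-base

  v : ℕ → Vectorℤ
  v = column base

  sign-permutation : ∀ {s i j k x y z t} → Permutation i j k x y z t →
    HasSignℤ s (detℤ (v i) (v j) (v k)) → HasSignℤ (t Sign.* s) (detℤ (v x) (v y) (v z))
  sign-permutation ijk h = h
  sign-permutation {s} {i} {j} {k} jki h = subst (HasSignℤ s) (sym (det-vwu (v i) (v j) (v k))) h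
  sign-permutation {s} {i} {j} {k} kij h = subst (HasSignℤ s) (sym (det-wuv (v i) (v j) (v k))) h
  sign-permutation {s} {i} {j} {k} jik h =
    subst (HasSignℤ (Sign.- Sign.* s)) (sym (det-vuw (v i) (v j) (v k))) (HasSignℤ-neg {s} h)
  sign-permutation {s} {i} {j} {k} ikj h =
    subst (HasSignℤ (Sign.- Sign.* s)) (sym (det-uwv (v i) (v j) (v k))) (HasSignℤ-neg {s} h)
  sign-permutation {s} {i} {j} {k} kji h =
    subst (HasSignℤ (Sign.- Sign.* s)) (sym (det-wvu (v i) (v j) (v k))) (HasSignℤ-neg {s} h)

  inverse : ∀ {i j k x y z t} → Permutation i j k x y z t → Permutation x y z i j k t
  inverse ijk = ijk
  inverse jki = kij
  inverse kij = jki
  inverse jik = jik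
  inverse ikj = ikj
  inverse kji = kji

-- The stepped-up point set

eventually-map : ∀ {P Q : ℕ → Set} → (∀ {n} → P n → Q n) → Eventually P → Eventually Q
eventually-map f (K , h) = K , λ n K≤n → f (h n K≤n)

moment : ℕ → Vectorℤ
moment n 0F = ℤ.+ n
moment n 1F = ℤ.+ n ℤ.* ℤ.+ n
moment n 2F = ℤ.+ n ℤ.* (ℤ.+ n ℤ.* ℤ.+ n)

moment-distinct : ∀ {m n} → m < n → ∀ i → moment n i ℤ.- moment m i ≢ 0ℤ
moment-distinct {m} {n} m<n i eq = ℤₚ.<-irrefl (sym (ℤₚ.i-j≡0⇒i≡j (moment n i) (moment m i) eq)) (moment-< i)
  where
  square : ∀ k → ℤ.+ k ℤ.* ℤ.+ k ≡ ℤ.+ (k * k)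
  square k = sym (ℤₚ.pos-* k k)
  cube : ∀ k → ℤ.+ k ℤ.* (ℤ.+ k ℤ.* ℤ.+ k) ≡ ℤ.+ (k * (k * k))
  cube k = trans (cong (ℤ.+ k ℤ.*_) (square k)) (sym (ℤₚ.pos-* k (k * k)))
  moment-< : ∀ i → moment m i ℤ.< moment n i
  moment-< 0F = ℤ.+<+ m<n
  moment-< 1F = subst₂ ℤ._<_ (sym (square m)) (sym (square n)) (ℤ.+<+ (ℕₚ.*-mono-< m<n m<n))
  moment-< 2F = subst₂ ℤ._<_ (sym (cube m)) (sym (cube n)) (ℤ.+<+ (ℕₚ.*-mono-< m<n (ℕₚ.*-mono-< m<n m<n)))

*-nonzero : ∀ {i j} → i ≢ 0ℤ → j ≢ 0ℤ → i ℤ.* j ≢ 0ℤ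
*-nonzero {i} i≢0 j≢0 ij≡0 with ℤₚ.i*j≡0⇒i≡0∨j≡0 i ij≡0
... | inj₁ i≡0 = i≢0 i≡0
... | inj₂ j≡0 = j≢0 j≡0

moment-oriented : ∀ {i j k l} → i < j → j < k → k < l →
  orientℤ (moment i) (moment j) (moment k) (moment l) ≢ 0ℤ
moment-oriented {i} {j} {k} {l} i<j j<k k<l eq =
  *-nonzero (d i<j) (*-nonzero (d i<k) (*-nonzero (d (ℕₚ.<-trans i<k k<l))
    (*-nonzero (d j<k) (*-nonzero (d (ℕₚ.<-trans j<k k<l)) (d k<l)))))
    (trans (sym (vandermonde (ℤ.+ i) (ℤ.+ j) (ℤ.+ k) (ℤ.+ l))) eq)
  where
  i<k = ℕₚ.<-trans i<j j<k
  d : ∀ {m n} → m < n → ℤ.+ n ℤ.- ℤ.+ m ≢ 0ℤ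
  d m<n = moment-distinct m<n 0F

module Points (r : ℕ) where
  open Planar r
  open PlanarPoints r

  private
    T = 2 ^ r

  -- Modulo the base t + 1 these are points of the moment curve, hence in general position.
  point : ℕ → ℕ → Vectorℤ
  point t n i = weighted (λ l → v l i) t (word T n) ℤ.+ moment n i

  -- Quantifying over the signs of the determinant covers the degenerate case too: if two of the
  -- levels coincide, the determinant is 0, has no sign, and the condition is void.
  StepUp : (t a b c d : ℕ) → Set
  StepUp t a b c d = ∃[ i ] ∃[ j ] ∃[ k ]
    Lt (word T a) (word T b) i × Lt (word T b) (word T c) j × Lt (word T c) (word T d) k ×
    (∀ s → HasSignℤ s (detℤ (v i) (v j) (v k)) →
           HasSignℤ s (orientℤ (point t a) (point t b) (point t c) (point t d)))

  eventually-distinct : ∀ {a b} → a < b → ∀ k → Eventually (λ t → point t b k ℤ.- point t a k ≢ 0ℤ)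
  eventually-distinct {a} {b} a<b k = ℤ.∣ moment b k ℤ.- moment a k ∣ , λ t →
    mod-nonzero {y = moment b k ℤ.- moment a k}
      (mod-- {x′ = moment b k} {y′ = moment a k} (mod-weighted (λ l → v l k) t (word T b) (moment b k))
        (mod-weighted (λ l → v l k) t (word T a) (moment a k)))
      (moment-distinct a<b k)

  eventually-oriented-points : ∀ {a b c d} → a < b → b < c → c < d →
    Eventually (λ t → orientℤ (point t a) (point t b) (point t c) (point t d) ≢ 0ℤ)
  eventually-oriented-points {a} {b} {c} {d} a<b b<c c<d =
    ℤ.∣ orientℤ (moment a) (moment b) (moment c) (moment d) ∣ , λ t →
    mod-nonzero {y = orientℤ (moment a) (moment b) (moment c) (moment d)}
      (mod-det _ _ _ _ _ _ (difference t b) (difference t c) (difference t d)) (moment-oriented a<b b<c c<d)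
    where
    difference : ∀ t n k → (point t n k ℤ.- point t a k) ≡ (moment n k ℤ.- moment a k) [ t ]
    difference t n k = mod-- {x′ = moment n k} {y′ = moment a k}
      (mod-weighted (λ l → v l k) t (word T n) (moment n k))
      (mod-weighted (λ l → v l k) t (word T a) (moment a k))

  eventually-stepUp : ∀ {a b c d} → a < b → b < c → c < d → d < 2 ^ T → Eventually (λ t → StepUp t a b c d)
  eventually-stepUp {a} {b} {c} {d} a<b b<c c<d d< =
    eventually-map (λ h → i , j , k , p , q , r′ , h) (go (ℤₚ.<-cmp 0ℤ (detℤ (v i) (v j) (v k))))
    where
    c< = ℕₚ.<-trans c<d d<
    i = proj₁ (word-< T a<b (ℕₚ.<-trans b<c c<))
    p = proj₂ (word-< T a<b (ℕₚ.<-trans b<c c<))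
    j = proj₁ (word-< T b<c c<)
    q = proj₂ (word-< T b<c c<)
    k = proj₁ (word-< T c<d d<)
    r′ = proj₂ (word-< T c<d d<)
    Transfers : ℕ → Set
    Transfers t = ∀ s → HasSignℤ s (detℤ (v i) (v j) (v k)) →
      HasSignℤ s (orientℤ (point t a) (point t b) (point t c) (point t d))
    leading : Leading (i + suc (j + suc k)) (detℤ (v i) (v j) (v k))
      (λ t → orientℤ (point t a) (point t b) (point t c) (point t d))
    leading = leading-cong (λ t → sym (orient-consecutive (point t a) (point t b) (point t c) (point t d)))
      (leading-det (λ x → leading-weighted (λ l → v l x) (moment a x) (moment b x) p)
                   (λ x → leading-weighted (λ l → v l x) (moment b x) (moment c x) q)
                   (λ x → leading-weighted (λ l → v l x) (moment c x) (moment d x) r′))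
    with-sign : ∀ s → HasSignℤ s (detℤ (v i) (v j) (v k)) → Eventually Transfers
    with-sign s h = eventually-map
      (λ {t} h′ s′ h″ → subst (λ s → HasSignℤ s (orientℤ (point t a) (point t b) (point t c) (point t d)))
        (HasSignℤ-unique {s} {s′} h h″) h′)
      (leading⇒eventually-sign s h leading)
    go : _ → Eventually Transfers
    go (tri< 0<z _ _) = with-sign Sign.+ 0<z
    go (tri> _ _ z<0) = with-sign Sign.- z<0
    go (tri≈ _ 0≡z _) = 0 , λ { _ _ Sign.+ 0<z → ⊥-elim (ℤₚ.<-irrefl 0≡z 0<z)
                              ; _ _ Sign.- z<0 → ⊥-elim (ℤₚ.<-irrefl (sym 0≡z) z<0) }

  private
    M = 2 ^ T

  record Good (t : ℕ) : Set where
    field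
      distinct : ∀ (a b : Fin M) → a Fin.< b → ∀ k → point t (toℕ b) k ℤ.- point t (toℕ a) k ≢ 0ℤ
      quadruple : ∀ (a b c d : Fin M) → a Fin.< b → b Fin.< c → c Fin.< d →
        orientℤ (point t (toℕ a)) (point t (toℕ b)) (point t (toℕ c)) (point t (toℕ d)) ≢ 0ℤ ×
        StepUp t (toℕ a) (toℕ b) (toℕ c) (toℕ d)

  opaque
    good : ∃ Good
    good =
      let K , h = eventually-×
            (eventually-∀ λ (a : Fin M) → eventually-∀ λ (b : Fin M) → eventually-→ (a Finₚ.<? b) λ a<b →
              eventually-∀ (eventually-distinct a<b))
            (eventually-∀ λ (a : Fin M) → eventually-∀ λ (b : Fin M) →
             eventually-∀ λ (c : Fin M) → eventually-∀ λ (d : Fin M) →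
             eventually-→ (a Finₚ.<? b) λ a<b → eventually-→ (b Finₚ.<? c) λ b<c →
             eventually-→ (c Finₚ.<? d) λ c<d → eventually-×
               (eventually-oriented-points a<b b<c c<d) (eventually-stepUp a<b b<c c<d (Finₚ.toℕ<n d)))
          dist , quad = h K ℕₚ.≤-refl
      in K , record { distinct = dist ; quadruple = quad }

  points : Fin M → Vectorℤ
  points a = point (proj₁ good) (toℕ a)

  open Good (proj₂ good) public

  private
    permutation-bounded : ∀ {i j k x y z t m} → Permutation i j k x y z t → i < m → j < m → k < m → z < m
    permutation-bounded ijk _ _ k< = k<
    permutation-bounded jki i< _ _ = i<
    permutation-bounded kij _ j< _ = j<
    permutation-bounded jik _ _ k< = k<
    permutation-bounded ikj _ j< _ = j<
    permutation-bounded kji i< _ _ = i<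

    sign-swap : ∀ t {s s′} → t Sign.* s′ ≡ s → s′ ≡ t Sign.* s
    sign-swap Sign.+ refl = refl
    sign-swap Sign.- {s′ = Sign.+} refl = refl
    sign-swap Sign.- {s′ = Sign.-} refl = refl

  -- Sorted columns have the sign predicted by the planar orientation. Undoing the permutation
  -- multiplies it by t, and `StepUp` carries the product to the space orientation, which has the
  -- sign s.
  orientedColumns : ∀ {s a b c d i j k} → StepUp (proj₁ good) a b c d →
    HasSignℤ s (orientℤ (point (proj₁ good) a) (point (proj₁ good) b) (point (proj₁ good) c) (point (proj₁ good) d)) →
    Lt (word T a) (word T b) i → Lt (word T b) (word T c) j → Lt (word T c) (word T d) k → OrientedColumns s i j k
  orientedColumns {s} (_ , _ , _ , p′ , q′ , r′ , transfer) h p q r π x<y y<z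
    with refl ← Lt-functional p′ p | refl ← Lt-functional q′ q | refl ← Lt-functional r′ r =
    columns π x<y y<z
    where
    columns : OrientedColumns s _ _ _
    columns {x} {y} {z} {t} π x<y y<z =
      let s′ , h′ , o = base-faithful x<y y<z
            (permutation-bounded π (Lt-level p′) (Lt-level q′) (Lt-level r′))
      in subst (λ u → Orientation u x y z)
           (sign-swap t (HasSignℤ-unique {t Sign.* s′} {s}
             (transfer (t Sign.* s′) (sign-permutation {s′} (inverse π) h′)) h)) o

  few-homogeneous-points : ∀ s n (σ : Fin n → Fin M) → Increasing σ →
    (∀ {a b c d} → a Fin.< b → b Fin.< c → c Fin.< d →
      HasSignℤ s (orientℤ (points (σ a)) (points (σ b)) (points (σ c)) (points (σ d)))) →
    n ≤ 6 + 4 * r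
  few-homogeneous-points s n σ σ-inc hom = subst (_≤ 6 + 4 * r) (Listₚ.length-tabulate w)
    (few-homogeneous-words s decreasing homogeneous)
    where
    w : Fin n → Word T
    -- Reversed, because `Decreasing` lists start with the largest word.
    w a = word T (toℕ (σ (Fin.opposite a)))
    w-< : ∀ {a b} → a Fin.< b → w a ≻ w b
    w-< {a} {b} a<b = word-< T (σ-inc (opposite-anti-< a<b)) (Finₚ.toℕ<n (σ (Fin.opposite a)))
    decreasing : Decreasing (tabulate w)
    decreasing = AllPairsₚ.tabulate⁺-< w-<
    index-< : ∀ {a b d} → Lt (w a) (w b) d → Fin.opposite a Fin.< Fin.opposite b
    index-< {a} {b} p with Finₚ.<-cmp a b
    ... | tri< a<b _ _ = ⊥-elim (≻-asym (w-< a<b) (_ , p))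
    ... | tri≈ _ refl _ = ⊥-elim (Lt-asym p p)
    ... | tri> _ _ b<a = opposite-anti-< b<a
    homogeneous : HomogeneousWords s (tabulate w)
    homogeneous a∈ b∈ c∈ d∈ p q r
      with a , refl ← ∈-tabulate⁻ a∈
      with b , refl ← ∈-tabulate⁻ b∈
      with c , refl ← ∈-tabulate⁻ c∈
      with d , refl ← ∈-tabulate⁻ d∈
      = orientedColumns {s} (proj₂ (quadruple _ _ _ _
          (σ-inc (index-< p)) (σ-inc (index-< q)) (σ-inc (index-< r))))
          (hom (index-< p) (index-< q) (index-< r)) p q r

-- Integer points as real points

integer : ℤ → ℚ
integer i = ℚ.mkℚ i 0 (Coprime.sym (Coprime.1-coprimeTo _))

integer-+ : ∀ i j → integer (i ℤ.+ j) ≡ integer i ℚ.+ integer j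
integer-+ i j = ℚₚ.toℚᵘ-injective (ℚᵘₚ.≃-trans (ℚᵘ.*≡* (solve 2 (λ i j →
    ((i ⊕ j) ⊗ Κ 1ℤ) ⊜ ((i ⊗ Κ 1ℤ ⊕ j ⊗ Κ 1ℤ) ⊗ Κ 1ℤ)) refl i j))
  (ℚᵘₚ.≃-sym (ℚₚ.toℚᵘ-homo-+ (integer i) (integer j))))
  where open ℤ-Solver

integer-* : ∀ i j → integer (i ℤ.* j) ≡ integer i ℚ.* integer j
integer-* i j = ℚₚ.toℚᵘ-injective (ℚᵘₚ.≃-trans (ℚᵘ.*≡* refl)
  (ℚᵘₚ.≃-sym (ℚₚ.toℚᵘ-homo-* (integer i) (integer j))))

integer-neg : ∀ i → integer (ℤ.- i) ≡ ℚ.- integer i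
integer-neg i = ℚₚ.toℚᵘ-injective (ℚᵘₚ.≃-trans (ℚᵘ.*≡* refl)
  (ℚᵘₚ.≃-sym (ℚₚ.toℚᵘ-homo‿- (integer i))))

integer-- : ∀ i j → integer (i ℤ.- j) ≡ integer i ℚ.- integer j
integer-- i j = trans (integer-+ i (ℤ.- j)) (cong (integer i ℚ.+_) (integer-neg j))

integer-mono-< : ∀ {i j} → i ℤ.< j → integer i ℚ.< integer j
integer-mono-< {i} {j} i<j = ℚ.*<* (subst₂ ℤ._<_ (sym (ℤₚ.*-identityʳ i)) (sym (ℤₚ.*-identityʳ j)) i<j)

integer-cancel-< : ∀ {i j} → integer i ℚ.< integer j → i ℤ.< j
integer-cancel-< {i} {j} (ℚ.*<* i<j) = subst₂ ℤ._<_ (ℤₚ.*-identityʳ i) (ℤₚ.*-identityʳ j) i<j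

HasSignℚ⇒HasSignℤ : ∀ s {i} → HasSignℚ s (integer i) → HasSignℤ s i
HasSignℚ⇒HasSignℤ Sign.+ {i} h = integer-cancel-< {0ℤ} {i} h
HasSignℚ⇒HasSignℤ Sign.- {i} h = integer-cancel-< {i} {0ℤ} h

integer-det : ∀ u v w → integer (detℤ u v w) ≡ detℚ (integer ∘ u) (integer ∘ v) (integer ∘ w)
integer-det u v w = trans (integer-+ (t u v w ℤ.- t v u w) (t w u v))
  (cong₂ ℚ._+_ (trans (integer-- (t u v w) (t v u w)) (cong₂ ℚ._-_ (term u v w) (term v u w))) (term w u v))
  where
  t : (u v w : Vectorℤ) → ℤ
  t u v w = u 0F ℤ.* (v 1F ℤ.* w 2F ℤ.- w 1F ℤ.* v 2F)
  term : ∀ u v w → integer (t u v w) ≡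
    integer (u 0F) ℚ.* (integer (v 1F) ℚ.* integer (w 2F) ℚ.- integer (w 1F) ℚ.* integer (v 2F))
  term u v w = trans (integer-* (u 0F) _) (cong (integer (u 0F) ℚ.*_)
    (trans (integer-- (v 1F ℤ.* w 2F) (w 1F ℤ.* v 2F))
      (cong₂ ℚ._-_ (integer-* (v 1F) (w 2F)) (integer-* (w 1F) (v 2F)))))

detℚ-cong : ∀ {u u′ v v′ w w′ : Fin 3 → ℚ} → (∀ i → u i ≡ u′ i) → (∀ i → v i ≡ v′ i) →
  (∀ i → w i ≡ w′ i) → detℚ u v w ≡ detℚ u′ v′ w′
detℚ-cong {u} {u′} {v} {v′} {w} {w′} hu hv hw =
  cong₂ ℚ._+_ (cong₂ ℚ._-_ (term u u′ v v′ w w′ hu hv hw) (term v v′ u u′ w w′ hv hu hw))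
    (term w w′ u u′ v v′ hw hu hv)
  where
  term : ∀ (u u′ v v′ w w′ : Fin 3 → ℚ) → (∀ i → u i ≡ u′ i) → (∀ i → v i ≡ v′ i) → (∀ i → w i ≡ w′ i) →
    u 0F ℚ.* (v 1F ℚ.* w 2F ℚ.- w 1F ℚ.* v 2F) ≡ u′ 0F ℚ.* (v′ 1F ℚ.* w′ 2F ℚ.- w′ 1F ℚ.* v′ 2F)
  term u u′ v v′ w w′ hu hv hw = cong₂ ℚ._*_ (hu 0F)
    (cong₂ ℚ._-_ (cong₂ ℚ._*_ (hv 1F) (hw 2F)) (cong₂ ℚ._*_ (hw 1F) (hv 2F)))

module _ where
  open ℚ-Solver
  open OrientExpr using (_⊝_)

  fromℚ-< : ∀ {x y} → x ℚ.< y → fromℚ x D.< fromℚ y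
  fromℚ-< {x} {y} x<y = y ℚ.- x
    , subst (ℚ._< y ℚ.- x) (ℚₚ.+-inverseʳ x) (ℚₚ.+-monoˡ-< (ℚ.- x) x<y)
    , 0 , λ _ _ → ℚₚ.≤-reflexive (solve 2 (λ x y → (x ⊕ (y ⊝ x)) ⊜ y) refl x y)

  private
    p≤∣p∣ : ∀ p → p ℚ.≤ ℚ.∣ p ∣
    p≤∣p∣ p with ℚₚ.≤-total 0ℚ p
    ... | inj₁ 0≤p = ℚₚ.≤-reflexive (sym (ℚₚ.0≤p⇒∣p∣≡p 0≤p))
    ... | inj₂ p≤0 = ℚₚ.≤-trans p≤0 (ℚₚ.0≤∣p∣ p)

    quarter : ∀ {ε} → 0ℚ ℚ.< ε → 0ℚ ℚ.< ½ ℚ.* (½ ℚ.* ε)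
    quarter 0<ε = sign-* {Sign.+} {Sign.+} {½} (ℚₚ.positive⁻¹ ½) (sign-* {Sign.+} {Sign.+} {½} (ℚₚ.positive⁻¹ ½) 0<ε)

    four-quarters : ∀ ε → let δ = ½ ℚ.* (½ ℚ.* ε) in δ ≡ ε ℚ.- (δ ℚ.+ δ) ℚ.- δ
    four-quarters ε = trans (solve 1 (λ ε → (Κ ½ ⊗ (Κ ½ ⊗ ε)) ⊜
      (ε ⊝ (Κ ½ ⊗ (Κ ½ ⊗ ε) ⊕ Κ ½ ⊗ (Κ ½ ⊗ ε)) ⊝ Κ ½ ⊗ (Κ ½ ⊗ ε))) refl ε) refl

    -‿mono-≤ : ∀ {x y u v} → x ℚ.≤ y → u ℚ.≤ v → x ℚ.- v ℚ.≤ y ℚ.- u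
    -‿mono-≤ x≤y u≤v = ℚₚ.+-mono-≤ x≤y (ℚₚ.neg-antimono-≤ u≤v)

  -- A rational approximation x₀ decides the case. With δ = ε/4 and all later terms of x within δ of
  -- x₀: if x₀ ≥ 2δ then x ≥ δ, and otherwise y ≥ ε - 2δ - δ = δ.
  +-positive : ∀ x y → 0ℝ D.< x D.+ y → 0ℝ D.< x ⊎ 0ℝ D.< y
  +-positive x y (ε , 0<ε , K , h) with cauchy x (½ ℚ.* (½ ℚ.* ε)) (quarter 0<ε)
  ... | L , close = split (δ ℚ.+ δ ℚₚ.≤? x₀)
    where
    open ℚₚ.≤-Reasoning
    δ = ½ ℚ.* (½ ℚ.* ε)
    m = K ⊔ L
    x₀ = seq x m
    split : Dec (δ ℚ.+ δ ℚ.≤ x₀) → 0ℝ D.< x ⊎ 0ℝ D.< y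
    split (yes 2δ≤x₀) = inj₁ (δ , quarter 0<ε , m , λ n m≤n → begin
      0ℚ ℚ.+ δ                      ≡⟨ solve 1 (λ δ → (Κ 0ℚ ⊕ δ) ⊜ (δ ⊕ δ ⊝ δ)) refl δ ⟩
      δ ℚ.+ δ ℚ.- δ                 ≤⟨ -‿mono-≤ 2δ≤x₀ (ℚₚ.<⇒≤ (ℚₚ.≤-<-trans (p≤∣p∣ (x₀ ℚ.- seq x n))
                                         (close m n (ℕₚ.m≤n⊔m K L) (ℕₚ.≤-trans (ℕₚ.m≤n⊔m K L) m≤n)))) ⟩
      x₀ ℚ.- (x₀ ℚ.- seq x n)       ≡⟨ solve 2 (λ a b → (a ⊝ (a ⊝ b)) ⊜ b) refl x₀ (seq x n) ⟩
      seq x n                       ∎)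
    split (no 2δ≰x₀) = inj₂ (δ , quarter 0<ε , m , λ n m≤n → begin
      0ℚ ℚ.+ δ                      ≡⟨ trans (ℚₚ.+-identityˡ δ) (four-quarters ε) ⟩
      ε ℚ.- (δ ℚ.+ δ) ℚ.- δ
        ≤⟨ -‿mono-≤ (-‿mono-≤ (subst (ℚ._≤ seq x n ℚ.+ seq y n) (ℚₚ.+-identityˡ ε)
                                (h n (ℕₚ.≤-trans (ℕₚ.m≤m⊔n K L) m≤n)))
                              (ℚₚ.<⇒≤ (ℚₚ.≰⇒> 2δ≰x₀)))
             (ℚₚ.<⇒≤ (ℚₚ.≤-<-trans (p≤∣p∣ (seq x n ℚ.- x₀))
               (close n m (ℕₚ.≤-trans (ℕₚ.m≤n⊔m K L) m≤n) (ℕₚ.m≤n⊔m K L)))) ⟩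
      seq x n ℚ.+ seq y n ℚ.- x₀ ℚ.- (seq x n ℚ.- x₀)
        ≡⟨ solve 3 (λ a b c → (a ⊕ b ⊝ c ⊝ (a ⊝ c)) ⊜ b) refl (seq x n) (seq y n) x₀ ⟩
      seq y n                       ∎)

  private
    0<-⇒<0 : ∀ {x} → 0ℝ D.< D.- x → x D.< 0ℝ
    0<-⇒<0 {x} = <-transfer {0ℝ} {D.- x} {x} {0ℝ}
      (λ n → solve 1 (λ a → (a ⊝ Κ 0ℚ) ⊜ (Κ 0ℚ ⊝ ⊝ a)) refl (seq x n))

  +-apart : ∀ x y → x D.+ y # 0ℝ → x # 0ℝ ⊎ y # 0ℝ
  +-apart x y (inj₂ 0<x+y) = Sum.map inj₂ inj₂ (+-positive x y 0<x+y)
  +-apart x y (inj₁ x+y<0) = Sum.map (inj₁ ∘ 0<-⇒<0 {x}) (inj₁ ∘ 0<-⇒<0 {y}) (+-positive (D.- x) (D.- y)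
    (<-transfer {x D.+ y} {0ℝ} {0ℝ} {(D.- x) D.+ (D.- y)}
      (λ n → solve 2 (λ a b → (Κ 0ℚ ⊝ (⊝ a ⊕ ⊝ b)) ⊜ (a ⊕ b ⊝ Κ 0ℚ)) refl (seq x n) (seq y n)) x+y<0))

  *-positive : ∀ c y → 0ℚ ℚ.< c → 0ℝ D.< fromℚ c D.* y → 0ℝ D.< y
  *-positive c y 0<c (ε , 0<ε , K , h) = δ , ℚₚ.positive⁻¹ δ , K , λ n K≤n →
    ℚₚ.*-cancelˡ-≤-pos c (begin
      c ℚ.* (0ℚ ℚ.+ δ)             ≡⟨ cong (c ℚ.*_) (ℚₚ.+-identityˡ δ) ⟩
      c ℚ.* ((ℚ.1/ c) ℚ.* ε)       ≡⟨ ℚₚ.*-assoc c (ℚ.1/ c) ε ⟨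
      c ℚ.* (ℚ.1/ c) ℚ.* ε         ≡⟨ cong (ℚ._* ε) (ℚₚ.*-inverseʳ c) ⟩
      1ℚ ℚ.* ε                     ≡⟨ ℚₚ.*-identityˡ ε ⟩
      ε                            ≡⟨ ℚₚ.+-identityˡ ε ⟨
      0ℚ ℚ.+ ε                     ≤⟨ h n K≤n ⟩
      c ℚ.* seq y n                ∎)
    where
    open ℚₚ.≤-Reasoning
    instance
      c⁺ = ℚ.positive 0<c
      ε⁺ = ℚ.positive 0<ε
      c≢0 = ℚₚ.pos⇒nonZero c
      1/c⁺ = ℚₚ.1/pos⇒pos c
    δ = (ℚ.1/ c) ℚ.* ε
    instance
      δ⁺ = ℚₚ.pos*pos⇒pos (ℚ.1/ c) ε

  *-apart : ∀ c y → fromℚ c D.* y # 0ℝ → y # 0ℝ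
  *-apart c y cy# with ℚₚ.<-cmp 0ℚ c
  *-apart c y (inj₂ 0<cy) | tri< 0<c _ _ = inj₂ (*-positive c y 0<c 0<cy)
  *-apart c y (inj₁ cy<0) | tri< 0<c _ _ = inj₁ (0<-⇒<0 {y} (*-positive c (D.- y) 0<c
    (<-transfer {fromℚ c D.* y} {0ℝ} {0ℝ} {fromℚ c D.* D.- y}
      (λ n → solve 2 (λ c y → (Κ 0ℚ ⊝ c ⊗ ⊝ y) ⊜ (c ⊗ y ⊝ Κ 0ℚ)) refl c (seq y n)) cy<0)))
  *-apart c y (inj₂ 0<cy) | tri> _ _ c<0 = inj₁ (0<-⇒<0 {y} (*-positive (ℚ.- c) (D.- y) (ℚₚ.neg-antimono-< c<0)
    (<-transfer {0ℝ} {fromℚ c D.* y} {0ℝ} {fromℚ (ℚ.- c) D.* D.- y}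
      (λ n → solve 2 (λ c y → (Κ 0ℚ ⊝ ⊝ c ⊗ ⊝ y) ⊜ (Κ 0ℚ ⊝ c ⊗ y)) refl c (seq y n)) 0<cy)))
  *-apart c y (inj₁ cy<0) | tri> _ _ c<0 = inj₂ (*-positive (ℚ.- c) y (ℚₚ.neg-antimono-< c<0)
    (<-transfer {fromℚ c D.* y} {0ℝ} {0ℝ} {fromℚ (ℚ.- c) D.* y}
      (λ n → solve 2 (λ c y → (Κ 0ℚ ⊝ ⊝ c ⊗ y) ⊜ (c ⊗ y ⊝ Κ 0ℚ)) refl c (seq y n)) cy<0))
  *-apart c y cy# | tri≈ _ refl _ = #-≗-contra {fromℚ 0ℚ D.* y} {0ℝ} (λ n → ℚₚ.*-zeroˡ (seq y n)) cy#

  *-apart⁻¹ : ∀ c y → c ≢ 0ℚ → y # 0ℝ → fromℚ c D.* y # 0ℝ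
  *-apart⁻¹ c y c≢0 y# = *-apart (ℚ.1/ c) (fromℚ c D.* y)
    (#-transfer {y} {0ℝ} {fromℚ (ℚ.1/ c) D.* (fromℚ c D.* y)} {0ℝ}
      (λ n → cong (ℚ._- 0ℚ) (trans (sym (ℚₚ.*-assoc (ℚ.1/ c) c (seq y n)))
        (trans (cong (ℚ._* seq y n) (ℚₚ.*-inverseˡ c)) (ℚₚ.*-identityˡ (seq y n))))) y#)
    where instance _ = ℚ.≢-nonZero c≢0

  private
    telescope : ∀ x y z → ((x ℚ.- z) ℚ.+ (z ℚ.- y)) ℚ.- 0ℚ ≡ x ℚ.- y
    telescope = solve 3 (λ x y z → (((x ⊝ z) ⊕ (z ⊝ y)) ⊝ Κ 0ℚ) ⊜ (x ⊝ y)) refl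

  #-difference : ∀ x y → x D.- y # 0ℝ → x # y
  #-difference x y = #-transfer {x D.- y} {0ℝ} {x} {y} (λ n → sym (ℚₚ.+-identityʳ (seq x n ℚ.- seq y n)))

  #-cotrans : ∀ {x y} z → x # y → x # z ⊎ z # y
  #-cotrans {x} {y} z x#y = Sum.map (#-difference x z) (#-difference z y)
    (+-apart (x D.- z) (z D.- y) (#-transfer {x} {y} {(x D.- z) D.+ (z D.- y)} {0ℝ}
      (λ n → telescope (seq x n) (seq y n) (seq z n)) x#y))

crossℚ : (u v : Fin 3 → ℚ) → Fin 3 → ℚ
crossℚ u v 0F = u 1F ℚ.* v 2F ℚ.- u 2F ℚ.* v 1F
crossℚ u v 1F = u 2F ℚ.* v 0F ℚ.- u 0F ℚ.* v 2F
crossℚ u v 2F = u 0F ℚ.* v 1F ℚ.- u 1F ℚ.* v 0F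

_-ᵥ_ : (u v : Fin 3 → ℚ) → Fin 3 → ℚ
(u -ᵥ v) i = u i ℚ.- v i

dotℚ : (u v : Fin 3 → ℚ) → ℚ
dotℚ u v = u 0F ℚ.* v 0F ℚ.+ u 1F ℚ.* v 1F ℚ.+ u 2F ℚ.* v 2F

module _ (p q r s a : Fin 3 → ℚ) where
  open ℚ-Solver
  open OrientExpr

  private
    equation : ∀ {n} → (Vector n → Expr ℚ n) → (p q r s a : Vector n) → Expr ℚ n × Expr ℚ n
    equation π p q r s a = (orient′ p q r s ⊗ π a) ⊜
      (π (cross′ (r ⊖′ p) (s ⊖′ p)) ⊗ (dot′ a q ⊝ dot′ a p) ⊕
      (π (cross′ (s ⊖′ p) (q ⊖′ p)) ⊗ (dot′ a r ⊝ dot′ a p) ⊕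
       π (cross′ (q ⊖′ p) (r ⊖′ p)) ⊗ (dot′ a s ⊝ dot′ a p)))

  opaque
    unfolding orient

    -- Up to the factor `orient p q r s`, the three cross products are the dual basis of q - p, r -
    -- p, s - p.
    cramer : ∀ i → orient p q r s ℚ.* a i ≡
      crossℚ (r -ᵥ p) (s -ᵥ p) i ℚ.* (dotℚ a q ℚ.- dotℚ a p) ℚ.+
      (crossℚ (s -ᵥ p) (q -ᵥ p) i ℚ.* (dotℚ a r ℚ.- dotℚ a p) ℚ.+
       crossℚ (q -ᵥ p) (r -ᵥ p) i ℚ.* (dotℚ a s ℚ.- dotℚ a p))
    cramer 0F = solve 15 (λ p₀ p₁ p₂ q₀ q₁ q₂ r₀ r₁ r₂ s₀ s₁ s₂ a₀ a₁ a₂ → equation (λ (x , _ , _) → x)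
        (p₀ , p₁ , p₂) (q₀ , q₁ , q₂) (r₀ , r₁ , r₂) (s₀ , s₁ , s₂) (a₀ , a₁ , a₂)) refl
      (p 0F) (p 1F) (p 2F) (q 0F) (q 1F) (q 2F) (r 0F) (r 1F) (r 2F) (s 0F) (s 1F) (s 2F) (a 0F) (a 1F) (a 2F)
    cramer 1F = solve 15 (λ p₀ p₁ p₂ q₀ q₁ q₂ r₀ r₁ r₂ s₀ s₁ s₂ a₀ a₁ a₂ → equation (λ (_ , x , _) → x)
        (p₀ , p₁ , p₂) (q₀ , q₁ , q₂) (r₀ , r₁ , r₂) (s₀ , s₁ , s₂) (a₀ , a₁ , a₂)) refl
      (p 0F) (p 1F) (p 2F) (q 0F) (q 1F) (q 2F) (r 0F) (r 1F) (r 2F) (s 0F) (s 1F) (s 2F) (a 0F) (a 1F) (a 2F)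
    cramer 2F = solve 15 (λ p₀ p₁ p₂ q₀ q₁ q₂ r₀ r₁ r₂ s₀ s₁ s₂ a₀ a₁ a₂ → equation (λ (_ , _ , x) → x)
        (p₀ , p₁ , p₂) (q₀ , q₁ , q₂) (r₀ , r₁ , r₂) (s₀ , s₁ , s₂) (a₀ , a₁ , a₂)) refl
      (p 0F) (p 1F) (p 2F) (q 0F) (q 1F) (q 2F) (r 0F) (r 1F) (r 2F) (s 0F) (s 1F) (s 2F) (a 0F) (a 1F) (a 2F)

-- If all of the a · pⱼ were the same real number b then, by Cramer's rule, a would vanish.
oriented⇒notCoplanar : ∀ (P : Fin 4 → Fin 3 → ℚ) → orient (P 0F) (P 1F) (P 2F) (P 3F) ≢ 0ℚ →
  NotCoplanar (λ j i → fromℚ (P j i))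
oriented⇒notCoplanar P nonzero a b (i , aᵢ#0) =
  [ from c₁ 1F , [ from c₂ 2F , from c₃ 3F ]′ ∘ +-apart (term c₂ 2F) (term c₃ 3F) ]′
    (+-apart (term c₁ 1F) (term c₂ 2F D.+ term c₃ 3F)
      (#-transfer {fromℚ O D.* a i} {0ℝ} {term c₁ 1F D.+ (term c₂ 2F D.+ term c₃ 3F)} {0ℝ}
        (λ n → cong (ℚ._- 0ℚ) (sym (cramer (P 0F) (P 1F) (P 2F) (P 3F) (λ k → seq (a k) n) i)))
        (*-apart⁻¹ O (a i) nonzero aᵢ#0)))
  where
  O = orient (P 0F) (P 1F) (P 2F) (P 3F)
  value : Fin 4 → ℝ
  value j = dot a (λ k → fromℚ (P j k))
  d : Fin 4 → Fin 3 → ℚ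
  d j = P j -ᵥ P 0F
  c₁ = crossℚ (d 2F) (d 3F) i
  c₂ = crossℚ (d 3F) (d 1F) i
  c₃ = crossℚ (d 1F) (d 2F) i
  term : ℚ → Fin 4 → ℝ
  term c j = fromℚ c D.* (value j D.- value 0F)
  from : ∀ c j → term c j # 0ℝ → ∃[ j ] value j # b
  -- Two of the values are apart, so b is apart from one of them.
  from c j t# = [ (λ h → j , h) , (λ h → 0F , #-sym {b} {value 0F} h) ]′
    (#-cotrans {value j} {value 0F} b (#-difference (value j) (value 0F)
      (*-apart c (value j D.- value 0F) t#)))

opaque
  unfolding orient

  integer-orient : ∀ a b c d → orient (integer ∘ a) (integer ∘ b) (integer ∘ c) (integer ∘ d) ≡ integer (orientℤ a b c d)
  integer-orient a b c d = trans
    (detℚ-cong (λ i → sym (integer-- (b i) (a i))) (λ i → sym (integer-- (c i) (a i))) (λ i → sym (integer-- (d i) (a i))))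
    (sym (integer-det (λ i → b i ℤ.- a i) (λ i → c i ℤ.- a i) (λ i → d i ℤ.- a i)))

  HasOrientation⇒HasSignℤ : ∀ s (P : Fin 4 → Vectorℤ) → HasOrientation s (λ j i → fromℚ (integer (P j i))) →
    HasSignℤ s (orientℤ (P 0F) (P 1F) (P 2F) (P 3F))
  HasOrientation⇒HasSignℤ s P h =
    let q = λ j i → fromℚ (integer (P j i))
        K , h′ = HasSign⇒HasSignℚ s {det (q 1F ⊖ q 0F) (q 2F ⊖ q 0F) (q 3F ⊖ q 0F)} h
    in HasSignℚ⇒HasSignℤ s (subst (HasSignℚ s) (integer-orient (P 0F) (P 1F) (P 2F) (P 3F)) (h′ K ℕₚ.≤-refl))

-- The lower bound and the final estimates

module LowerBound (r : ℕ) where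
  open Points r

  sequence : PointSeq (2 ^ 2 ^ r)
  sequence a i = fromℚ (integer (points a i))

  sequence-general : GeneralPosition sequence
  sequence-general = record
    { notCoplanar = λ σ σ-inc → oriented⇒notCoplanar (λ j → integer ∘ points (σ j)) λ eq →
        proj₁ (quadruple _ _ _ _ (σ-inc (s≤s z≤n)) (σ-inc (s≤s (s≤s z≤n))) (σ-inc (s≤s (s≤s (s≤s z≤n)))))
          (cong ℚ.numerator (trans (sym (integer-orient (points (σ 0F)) (points (σ 1F)) (points (σ 2F)) (points (σ 3F)))) eq))
    ; distinctCoords = λ {a} {b} a<b i → apart a b i (distinct a b a<b i)
    }
    where
    apart : ∀ a b i → points b i ℤ.- points a i ≢ 0ℤ → sequence a i # sequence b i
    apart a b i ≢0 with ℤₚ.<-cmp (points a i) (points b i)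
    ... | tri< a<b _ _ = inj₁ (fromℚ-< (integer-mono-< a<b))
    ... | tri≈ _ a≡b _ = ⊥-elim (≢0 (trans (cong (λ x → x ℤ.- points a i) (sym a≡b)) (ℤₚ.+-inverseʳ (points a i))))
    ... | tri> _ _ b<a = inj₂ (fromℚ-< (integer-mono-< b<a))

  module _ {n N} (forces : ForcesHomogeneous n N) (N≤ : N ≤ 2 ^ 2 ^ r) where
    private
      ι : Fin N → Fin (2 ^ 2 ^ r)
      ι i = Fin.inject≤ i N≤

      ι-inc : Increasing ι
      ι-inc {i} {j} = subst₂ _<_ (sym (Finₚ.toℕ-inject≤ i N≤)) (sym (Finₚ.toℕ-inject≤ j N≤))

      general : GeneralPosition (sequence ∘ ι)
      general = record
        { notCoplanar = λ σ σ-inc → GeneralPosition.notCoplanar sequence-general (ι ∘ σ) (ι-inc ∘ σ-inc)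
        ; distinctCoords = λ i<j → GeneralPosition.distinctCoords sequence-general (ι-inc i<j) }

      forced = forces (sequence ∘ ι) general

    -- An increasing map from `Fin n` to `Fin N` comes out of `forces` only when some sequence of N
    -- points in general position is put in; the first N constructed points serve.
    forces⇒n≤N : n ≤ N
    forces⇒n≤N = Finₚ.injective⇒≤ {f = proj₁ forced} λ {i} {j} σi≡σj → case Finₚ.<-cmp i j of λ
      { (tri< i<j _ _) → ⊥-elim (Finₚ.<-irrefl σi≡σj (proj₁ (proj₂ forced) i<j))
      ; (tri≈ _ i≡j _) → i≡j
      ; (tri> _ _ j<i) → ⊥-elim (Finₚ.<-irrefl (sym σi≡σj) (proj₁ (proj₂ forced) j<i)) }

    forces⇒small : n ≤ 6 + 4 * r
    forces⇒small =
      let σ , σ-inc , s , hom = forced in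
      few-homogeneous-points s n (ι ∘ σ) (ι-inc ∘ σ-inc) λ {a} {b} {c} {d} a<b b<c c<d →
        HasOrientation⇒HasSignℤ s (points ∘ ι ∘ σ ∘ tuple a b c d)
          (hom (tuple a b c d) (tuple-increasing a<b b<c c<d))

-- Without a decision procedure for P the least element exists only up to double negation: if there
-- were none, strong induction would refute every P n.
¬¬-minimum : ∀ (P : ℕ → Set) {m} → P m → ¬ ¬ (∃[ n ] P n × (∀ k → P k → n ≤ k))
¬¬-minimum P {m} pm none = <-rec (λ n → ¬ P n) (λ n ih pn → none (n , pn , λ k pk →
  ℕₚ.≮⇒≥ (λ k<n → ih k<n pk))) m pm

^-distribʳ-* : ∀ k m n → (m * n) ^ k ≡ m ^ k * n ^ k
^-distribʳ-* zero    m n = refl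
^-distribʳ-* (suc k) m n = trans (cong (m * n *_) (^-distribʳ-* k m n))
  (solve 4 (λ m n x y → ((m :* n) :* (x :* y)) := ((m :* x) :* (n :* y))) refl m n (m ^ k) (n ^ k))
  where open +-*-Solver

^-cancelʳ-≤ : ∀ k {m n} → m ^ suc k ≤ n ^ suc k → m ≤ n
^-cancelʳ-≤ k m^≤n^ = ℕₚ.≮⇒≥ λ n<m → ℕₚ.<⇒≱ (ℕₚ.^-monoˡ-< (suc k) n<m) m^≤n^

module _ where
  open ℕₚ.≤-Reasoning

  2^2^-intro : ∀ k {n r N} → n ≤ suc k * r → 2 ^ 2 ^ r ≤ N → 2^2^[ n / suc k ]≤ N
  2^2^-intro k {n} {r} {N} n≤ tower≤ a b _ a^k≤ = begin
    2 ^ a                ≤⟨ ℕₚ.^-monoʳ-≤ 2 (^-cancelʳ-≤ k {a} {2 ^ r * b} (begin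
      a ^ suc k                       ≤⟨ a^k≤ ⟩
      2 ^ n * b ^ suc k               ≤⟨ ℕₚ.*-monoˡ-≤ (b ^ suc k) (ℕₚ.^-monoʳ-≤ 2 n≤) ⟩
      2 ^ (suc k * r) * b ^ suc k     ≡⟨ cong (λ e → 2 ^ e * b ^ suc k) (ℕₚ.*-comm (suc k) r) ⟩
      2 ^ (r * suc k) * b ^ suc k     ≡⟨ cong (_* b ^ suc k) (ℕₚ.^-*-assoc 2 r (suc k)) ⟨
      (2 ^ r) ^ suc k * b ^ suc k     ≡⟨ ^-distribʳ-* (suc k) (2 ^ r) b ⟨
      (2 ^ r * b) ^ suc k             ∎)) ⟩
    2 ^ (2 ^ r * b)      ≡⟨ ℕₚ.^-*-assoc 2 (2 ^ r) b ⟨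
    (2 ^ 2 ^ r) ^ b      ≤⟨ ℕₚ.^-monoˡ-≤ b tower≤ ⟩
    N ^ b                ∎

  -- 2 ^ 2 ^ (n / 22) ≤ 2 ^ (3 / 2) ≤ 3 for n ≤ 11.
  2^2^-small : ∀ {n N} → n ≤ 11 → 3 ≤ N → 2^2^[ n / 22 ]≤ N
  2^2^-small {n} {N} n≤11 3≤N a b _ a^k≤ = begin
    2 ^ a   ≤⟨ ^-cancelʳ-≤ 1 {2 ^ a} {3 ^ b} (begin
      (2 ^ a) ^ 2      ≡⟨ ℕₚ.^-*-assoc 2 a 2 ⟩
      2 ^ (a * 2)      ≤⟨ ℕₚ.^-monoʳ-≤ 2 2a≤3b ⟩
      2 ^ (3 * b)      ≡⟨ ℕₚ.^-*-assoc 2 3 b ⟨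
      8 ^ b            ≤⟨ ℕₚ.^-monoˡ-≤ b (ℕₚ.n≤1+n 8) ⟩
      (3 ^ 2) ^ b      ≡⟨ trans (ℕₚ.^-*-assoc 3 2 b) (cong (3 ^_) (ℕₚ.*-comm 2 b)) ⟩
      3 ^ (b * 2)      ≡⟨ ℕₚ.^-*-assoc 3 b 2 ⟨
      (3 ^ b) ^ 2      ∎) ⟩
    3 ^ b   ≤⟨ ℕₚ.^-monoˡ-≤ b 3≤N ⟩
    N ^ b   ∎
    where
    2a≤3b : a * 2 ≤ 3 * b
    2a≤3b = ^-cancelʳ-≤ 21 {a * 2} {3 * b} (begin
      (a * 2) ^ 22              ≡⟨ ^-distribʳ-* 22 a 2 ⟩
      a ^ 22 * 2 ^ 22           ≤⟨ ℕₚ.*-monoˡ-≤ (2 ^ 22) a^k≤ ⟩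
      2 ^ n * b ^ 22 * 2 ^ 22   ≤⟨ ℕₚ.*-monoˡ-≤ (2 ^ 22) (ℕₚ.*-monoˡ-≤ (b ^ 22) (ℕₚ.^-monoʳ-≤ 2 n≤11)) ⟩
      2 ^ 11 * b ^ 22 * 2 ^ 22  ≡⟨ trans (ℕₚ.*-comm (2 ^ 11 * b ^ 22) (2 ^ 22)) (sym (ℕₚ.*-assoc (2 ^ 22) (2 ^ 11) (b ^ 22))) ⟩
      -- 2 ^ 33 = 8 ^ 11 ≤ 9 ^ 11 = 3 ^ 22, which is 2 ^ (1 / 2) ≤ 3 / 2 cleared of roots.
      8 ^ 11 * b ^ 22           ≤⟨ ℕₚ.*-monoˡ-≤ (b ^ 22) (ℕₚ.^-monoˡ-≤ 11 (ℕₚ.n≤1+n 8)) ⟩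
      3 ^ 22 * b ^ 22           ≡⟨ ^-distribʳ-* 22 3 b ⟨
      (3 * b) ^ 22              ∎)

  tower-bound : ∀ n → 1 ≤ n → tower n ≤ 2 ^ (2 ^ (28 * n))
  tower-bound n 1≤n = ℕₚ.^-monoʳ-≤ 2 (ℕₚ.^-monoʳ-≤ 2 (begin
    suc (thinnedLength n + (thinnedLength n + thinnedLength n))   ≡⟨ simplify n ⟩
    16 + 12 * n        ≤⟨ ℕₚ.+-monoˡ-≤ (12 * n) (ℕₚ.*-monoʳ-≤ 16 1≤n) ⟩
    16 * n + 12 * n    ≡⟨ ℕₚ.*-distribʳ-+ n 16 12 ⟨
    28 * n             ∎))
    where
    open +-*-Solver
    simplify : ∀ n → suc (thinnedLength n + (thinnedLength n + thinnedLength n)) ≡ 16 + 12 * n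
    simplify = solve 1 (λ n → let s = con 1 :+ (n :+ n) ; l = con 3 :+ (s :+ s) in
      (con 1 :+ (l :+ (l :+ l))) := (con 16 :+ con 12 :* n)) refl

  levels : ∀ {n} → 11 < n → ∃[ r ] 7 + 4 * r ≤ n × n ≤ 22 * r
  levels {n} 11<n = r , lower , upper r refl
    where
    m = n ∸ 7
    -- The largest r for which n exceeds the bound 6 + 4 r of `forces⇒small`; it is positive since n
    -- > 11.
    r = m / 4
    n≡ : n ≡ 7 + (m % 4 + r * 4)
    n≡ = trans (sym (ℕₚ.m+[n∸m]≡n (ℕₚ.≤-trans (ℕₚ.m≤m+n 7 5) 11<n))) (cong (7 +_) (m≡m%n+[m/n]*n m 4))
    lower : 7 + 4 * r ≤ n
    lower = ℕₚ.≤-trans (ℕₚ.+-monoʳ-≤ 7 (ℕₚ.≤-trans (ℕₚ.≤-reflexive (ℕₚ.*-comm 4 r)) (ℕₚ.m≤n+m (r * 4) (m % 4))))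
      (ℕₚ.≤-reflexive (sym n≡))
    n≤ : n ≤ 10 + r * 4
    n≤ = ℕₚ.≤-trans (ℕₚ.≤-reflexive n≡) (ℕₚ.+-monoʳ-≤ 7 (ℕₚ.+-monoˡ-≤ (r * 4) (ℕₚ.≤-pred (m%n<n m 4))))
    upper : ∀ r′ → r ≡ r′ → n ≤ 22 * r
    upper zero r≡0 = ⊥-elim (ℕₚ.<⇒≱ 11<n (ℕₚ.≤-trans n≤
      (ℕₚ.≤-trans (ℕₚ.≤-reflexive (cong (λ x → 10 + x * 4) r≡0)) (ℕₚ.n≤1+n 10))))
    upper (suc r′) r≡ = begin
      n                        ≤⟨ n≤ ⟩
      10 + r * 4               ≤⟨ ℕₚ.+-monoˡ-≤ (r * 4) (ℕₚ.*-mono-≤ {10} {18} (ℕₚ.m≤m+n 10 8) (subst (1 ≤_) (sym r≡) (s≤s z≤n))) ⟩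
      18 * r + r * 4           ≡⟨ cong (18 * r +_) (ℕₚ.*-comm r 4) ⟩
      18 * r + 4 * r           ≡⟨ ℕₚ.*-distribʳ-+ r 18 4 ⟨
      22 * r                   ∎

-- The restriction to n ≥ 3 is essential: for n = 1 and n = 2 the least N is n itself, which is
-- smaller than 2 ^ 2 ^ (n / k) for every k. Small n are settled by N ≥ n alone, the others by the
-- construction.
lower-bound : ∀ {n N} → ForcesHomogeneous n N → 3 ≤ n → 2^2^[ n / 22 ]≤ N
lower-bound {n} {N} forces 3≤n with n ℕₚ.≤? 11
... | yes n≤11 = 2^2^-small n≤11 (ℕₚ.≮⇒≥ λ N<3 →
  -- The construction for r = 1 has four points, more than N.
  ℕₚ.<⇒≱ N<3 (ℕₚ.≤-trans 3≤n (LowerBound.forces⇒n≤N 1 forces (ℕₚ.≤-trans (ℕₚ.<⇒≤ N<3) (ℕₚ.n≤1+n 3)))))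
... | no n≰11 =
  let r , 7+4r≤n , n≤22r = levels (ℕₚ.≰⇒> n≰11) in
  2^2^-intro 21 {n} {r} n≤22r (ℕₚ.≮⇒≥ λ N< →
    ℕₚ.<⇒≱ 7+4r≤n (LowerBound.forces⇒small r forces (ℕₚ.<⇒≤ N<)))

corollary1p4 : (∀ (n : ℕ) → ¬ ¬ (∃[ N ] IsOT₃ n N)) ×
    (∃[ k ] ∃[ C ] (0 < k × 0 < C ×
    (∀ (n N : ℕ) → IsOT₃ n N →
    (3 ≤ n → 2^2^[ n / k ]≤ N) ×
    (1 ≤ n → N ≤ 2 ^ (2 ^ (C * n))))))
corollary1p4 =
    (λ n → ¬¬-minimum (ForcesHomogeneous n) (forcesHomogeneous n (tower n) ℕₚ.≤-refl))
  , 22 , 28 , s≤s z≤n , s≤s z≤n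
  , λ n N (forces , minimal) → lower-bound forces
    , λ 1≤n → ℕₚ.≤-trans (minimal (tower n) (forcesHomogeneous n (tower n) ℕₚ.≤-refl)) (tower-bound n 1≤n)
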